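{- There is an absolute constant $C>0$ such that the following holds. Let $p$ be a prime, let $\mathcal{X}\subset\{0,1,\ldots,p-1\}$, and let $\Delta\ge 0$ be a real number such that $$\max_{(a,p)=1}\left|\sum_{x\in\mathcal{X}}e^{\frac{2\pi i a x}{p}}\right|\le|\mathcal{X}|\Delta,$$ where the maximum is over integers $a$ coprime to $p$ and $|\mathcal{X}|$ denotes the number of elements of $\mathcal{X}$. Let $S$ and $T$ be any integers with $1\le T\le p$, and let $J_3$ denote the number of pairs of integers $(x,y)$ satisfying $$x\equiv y\pmod p,\qquad x\in\mathcal{X},\quad S+1\le y\le S+T.$$ Then $$\left|J_3-\frac{|\mathcal{X}|T}{p}\right|\le C\left(\frac{|\mathcal{X}|T^{1/3}\Delta^{2/3}}{p^{1/3}}+|\mathcal{X}|\Delta\right).$$ -}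

module Defs where

import Algebra.Definitions.RawSemiring
open import Data.Bool.Base using (if_then_else_)
open import Data.Fin.Base using (Fin; toℕ)
open import Data.Fin.Subset using (Subset)
open import Data.Fin.Subset.Properties using (_∈?_)
open import Data.Integer.Base as ℤ using (ℤ; +_)
import Data.Integer.Divisibility.Signed as ℤ
import Data.Integer.Properties as ℤ
open import Data.List.Base using (List; []; _∷_; map; filter; foldr; length; upTo; allFin; cartesianProduct)
open import Data.Nat.Base as ℕ using (ℕ; zero; suc; _≤_)
import Data.Nat.Properties as ℕ
open import Data.Product.Base using (Σ; _×_; _,_; proj₁; proj₂)
open import Data.Rational.Base as ℚ using (ℚ; 0ℚ; 1ℚ; ½; _+_; _*_; -_; _-_; ∣_∣; _/_; toℚᵘ)
import Data.Rational.Properties as ℚ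
open import Data.Rational.Solver using (module +-*-Solver)
open import Data.Rational.Unnormalised.Base as ℚᵘ using (mkℚᵘ)
import Data.Rational.Unnormalised.Properties as ℚᵘ
open import Data.Sum.Base using (_⊎_; inj₁; inj₂)
open import Relation.Binary.PropositionalEquality
open import Relation.Nullary using (Dec; does; yes; no)

open Algebra.Definitions.RawSemiring ℚ.+-*-rawSemiring public using () renaming (_^_ to _^ℚ_)

module RationalLemmas where

  open +-*-Solver using (solve; _:+_; _:*_; _:-_; :-_; con; _:=_)

  ι : ℕ → ℚ
  ι n = + n / 1

  recip : ℕ → ℚ
  recip n = + 1 / suc n

  toℚᵘ-/ : ∀ i n → toℚᵘ (i / suc n) ℚᵘ.≃ mkℚᵘ i n
  toℚᵘ-/ i n = ℚ.toℚᵘ-fromℚᵘ (mkℚᵘ i n)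

  ι-suc : ∀ n → ι (suc n) ≡ 1ℚ + ι n
  ι-suc n = ℚ.toℚᵘ-injective (ℚᵘ.≃-trans (toℚᵘ-/ (+ suc n) 0) (ℚᵘ.≃-sym
    (ℚᵘ.≃-trans (ℚ.toℚᵘ-homo-+ 1ℚ (ι n)) (ℚᵘ.≃-trans (ℚᵘ.+-congʳ (toℚᵘ 1ℚ) (toℚᵘ-/ (+ n) 0))
      (ℚᵘ.*≡* (cong (ℤ._* + 1) (cong (λ z → + 1 ℤ.+ z) (ℤ.*-identityʳ (+ n)))))))))

  /-ι : ∀ j n → + j / suc n ≡ ι j * recip n
  /-ι j n = ℚ.toℚᵘ-injective (ℚᵘ.≃-trans (toℚᵘ-/ (+ j) n) (ℚᵘ.≃-sym
    (ℚᵘ.≃-trans (ℚ.toℚᵘ-homo-* (ι j) (recip n))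
      (ℚᵘ.≃-trans (ℚᵘ.*-cong (toℚᵘ-/ (+ j) 0) (toℚᵘ-/ (+ 1) n))
        (ℚᵘ.*≡* (cong₂ ℤ._*_ (ℤ.*-identityʳ (+ j)) (sym (ℤ.*-identityˡ (+ suc n)))))))))

  ι*recip : ∀ n → ι (suc n) * recip n ≡ 1ℚ
  ι*recip n = trans (sym (/-ι (suc n) n))
    (ℚ.toℚᵘ-injective (ℚᵘ.≃-trans (toℚᵘ-/ (+ suc n) n) (ℚᵘ.*≡* (ℤ.*-comm (+ suc n) (+ 1)))))

  0≤ι : ∀ n → 0ℚ ℚ.≤ ι n
  0≤ι n = ℚ.nonNegative⁻¹ (ι n) {{ℚ.normalize-nonNeg n 1}}

  0<recip : ∀ n → 0ℚ ℚ.< recip n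
  0<recip n = ℚ.positive⁻¹ (recip n) {{ℚ.normalize-pos 1 (suc n)}}

  0≤recip : ∀ n → 0ℚ ℚ.≤ recip n
  0≤recip n = ℚ.<⇒≤ (0<recip n)

  0≤1 : 0ℚ ℚ.≤ 1ℚ
  0≤1 = 0≤ι 1

  0<1 : 0ℚ ℚ.< 1ℚ
  0<1 = 0<recip 0

  ≤-add : ∀ {p q} → 0ℚ ℚ.≤ q → p ℚ.≤ p + q
  ≤-add {p} 0≤q = subst (ℚ._≤ p + _) (ℚ.+-identityʳ p) (ℚ.+-monoʳ-≤ p 0≤q)

  ι-mono : ∀ {m n} → m ≤ n → ι m ℚ.≤ ι n
  ι-mono {n = n} ℕ.z≤n = 0≤ι n
  ι-mono (ℕ.s≤s {m} {n} m≤n) = subst₂ ℚ._≤_ (sym (ι-suc m)) (sym (ι-suc n)) (ℚ.+-monoʳ-≤ 1ℚ (ι-mono m≤n))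

  archimedean : ∀ q → q ℚ.≤ ι ℤ.∣ ℚ.↥ q ∣
  archimedean q@(ℚ.mkℚ n d _) = ℚ.toℚᵘ-cancel-≤ (ℚᵘ.≤-respʳ-≃ (ℚᵘ.≃-sym (toℚᵘ-/ (+ ℤ.∣ n ∣) 0))
    (ℚᵘ.*≤* (subst₂ ℤ._≤_ (sym (ℤ.*-identityʳ n)) (ℤ.pos-* ℤ.∣ n ∣ (suc d))
      (ℤ.≤-trans (n≤∣n∣ n) (ℤ.+≤+ (ℕ.m≤m*n ℤ.∣ n ∣ (suc d)))))))
    where
    n≤∣n∣ : ∀ z → z ℤ.≤ + ℤ.∣ z ∣
    n≤∣n∣ (+ z) = ℤ.≤-refl
    n≤∣n∣ ℤ.-[1+ z ] = ℤ.-≤+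

  *-mono : ∀ {a b c d} → 0ℚ ℚ.≤ a → 0ℚ ℚ.≤ c → a ℚ.≤ b → c ℚ.≤ d → a * c ℚ.≤ b * d
  *-mono {a} {b} {c} {d} 0≤a 0≤c a≤b c≤d = ℚ.≤-trans
    (ℚ.*-monoˡ-≤-nonNeg a {{ℚ.nonNegative 0≤a}} c≤d)
    (ℚ.*-monoʳ-≤-nonNeg d {{ℚ.nonNegative (ℚ.≤-trans 0≤c c≤d)}} a≤b)

  *-monoˡ : ∀ {a c d} → 0ℚ ℚ.≤ a → c ℚ.≤ d → a * c ℚ.≤ a * d
  *-monoˡ {a} 0≤a = ℚ.*-monoˡ-≤-nonNeg a {{ℚ.nonNegative 0≤a}}

  *-monoʳ : ∀ {a c d} → 0ℚ ℚ.≤ a → c ℚ.≤ d → c * a ℚ.≤ d * a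
  *-monoʳ {a} 0≤a = ℚ.*-monoʳ-≤-nonNeg a {{ℚ.nonNegative 0≤a}}

  0≤* : ∀ {a b} → 0ℚ ℚ.≤ a → 0ℚ ℚ.≤ b → 0ℚ ℚ.≤ a * b
  0≤* {a} {b} 0≤a 0≤b = subst (ℚ._≤ a * b) (ℚ.*-zeroʳ a) (*-monoˡ 0≤a 0≤b)

  0<* : ∀ {a b} → 0ℚ ℚ.< a → 0ℚ ℚ.< b → 0ℚ ℚ.< a * b
  0<* {a} {b} 0<a 0<b = ℚ.positive⁻¹ (a * b)
    {{ℚ.pos*pos⇒pos a {{ℚ.positive 0<a}} b {{ℚ.positive 0<b}}}}

  0≤+ : ∀ {a b} → 0ℚ ℚ.≤ a → 0ℚ ℚ.≤ b → 0ℚ ℚ.≤ a + b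
  0≤+ = ℚ.+-mono-≤

  ∣∣≤ : ∀ {p r} → p ℚ.≤ r → - p ℚ.≤ r → ∣ p ∣ ℚ.≤ r
  ∣∣≤ {p} p≤r -p≤r with ℚ.∣p∣≡p∨∣p∣≡-p p
  ... | inj₁ eq = subst (ℚ._≤ _) (sym eq) p≤r
  ... | inj₂ eq = subst (ℚ._≤ _) (sym eq) -p≤r

  ≤∣∣ : ∀ p → p ℚ.≤ ∣ p ∣
  ≤∣∣ p with ℚ.≤-total 0ℚ p
  ... | inj₁ 0≤p = ℚ.≤-reflexive (sym (ℚ.0≤p⇒∣p∣≡p 0≤p))
  ... | inj₂ p≤0 = ℚ.≤-trans p≤0 (ℚ.0≤∣p∣ p)

  ∣-∣-comm : ∀ p q → ∣ p - q ∣ ≡ ∣ q - p ∣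
  ∣-∣-comm p q = trans (sym (ℚ.∣-p∣≡∣p∣ (p - q)))
    (cong ∣_∣ (solve 2 (λ p q → :- (p :- q) := q :- p) refl p q))

  triangle : ∀ p q r → ∣ p - r ∣ ℚ.≤ ∣ p - q ∣ + ∣ q - r ∣
  triangle p q r = subst (ℚ._≤ ∣ p - q ∣ + ∣ q - r ∣)
    (cong ∣_∣ (solve 3 (λ p q r → (p :- q) :+ (q :- r) := p :- r) refl p q r))
    (ℚ.∣p+q∣≤∣p∣+∣q∣ (p - q) (q - r))

  ≤-from-diff : ∀ {p q e} → ∣ p - q ∣ ℚ.≤ e → p ℚ.≤ q + e
  ≤-from-diff {p} {q} {e} h = subst (ℚ._≤ q + e) (solve 2 (λ p q → q :+ (p :- q) := p) refl p q)
    (ℚ.+-monoʳ-≤ q (ℚ.≤-trans (≤∣∣ (p - q)) h))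

  ∣-∣≤ : ∀ p q {e} → p ℚ.≤ q + e → q ℚ.≤ p + e → ∣ p - q ∣ ℚ.≤ e
  ∣-∣≤ p q {e} p≤ q≤ = ∣∣≤ (half p q p≤)
    (subst (ℚ._≤ e) (solve 2 (λ p q → q :- p := :- (p :- q)) refl p q) (half q p q≤))
    where
    half : ∀ p q → p ℚ.≤ q + e → p - q ℚ.≤ e
    half p q p≤ = subst (p - q ℚ.≤_) (solve 2 (λ q e → (q :+ e) :- q := e) refl q e) (ℚ.+-monoˡ-≤ (- q) p≤)

  0<½* : ∀ {e} → 0ℚ ℚ.< e → 0ℚ ℚ.< ½ * e
  0<½* 0<e = 0<* (0<recip 1) 0<e

  halves : ∀ e → ½ * e + ½ * e ≡ e
  halves e = trans (sym (ℚ.*-distribʳ-+ e ½ ½)) (ℚ.*-identityˡ e)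

  scale-down : ∀ {K e} → 0ℚ ℚ.< K → 0ℚ ℚ.< e → Σ ℚ λ d → 0ℚ ℚ.< d × K * d ≡ e
  scale-down {K} {e} 0<K 0<e = (1/K * e) , 0<* 0<1/K 0<e ,
    trans (sym (ℚ.*-assoc K 1/K e)) (trans (cong (_* e) (ℚ.*-inverseʳ K {{nz}})) (ℚ.*-identityˡ e))
    where
    nz = ℚ.>-nonZero 0<K
    1/K = (ℚ.1/ K) {{nz}}
    0<1/K : 0ℚ ℚ.< 1/K
    0<1/K = ℚ.positive⁻¹ 1/K {{ℚ.1/pos⇒pos K {{ℚ.positive 0<K}}}}

  recip-small : ∀ {e} → 0ℚ ℚ.< e → Σ ℕ λ N → ∀ n → N ≤ n → recip n ℚ.≤ e
  recip-small {e} 0<e with scale-down 0<e 0<1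
  ... | d , 0<d , ed≡1 = N , λ n N≤n →
    let n≤ : d ℚ.≤ ι (suc n)
        n≤ = ℚ.≤-trans (archimedean d) (ι-mono (ℕ.≤-trans N≤n (ℕ.n≤1+n n)))
    in subst₂ ℚ._≤_ (trans (cong (_* recip n) ed≡1) (ℚ.*-identityˡ (recip n)))
         (trans (ℚ.*-assoc e (ι (suc n)) (recip n)) (trans (cong (e *_) (ι*recip n)) (ℚ.*-identityʳ e)))
         (*-monoʳ (0≤recip n) (*-monoˡ (ℚ.<⇒≤ 0<e) n≤))
    where N = ℤ.∣ ℚ.↥ d ∣

  0<1+ : ∀ {K} → 0ℚ ℚ.≤ K → 0ℚ ℚ.< 1ℚ + K
  0<1+ {K} 0≤K = ℚ.<-≤-trans {0ℚ} {1ℚ} {1ℚ + K} 0<1 (≤-add {1ℚ} {K} 0≤K)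

  ≤1+ : ∀ K → K ℚ.≤ 1ℚ + K
  ≤1+ K = subst (ℚ._≤ 1ℚ + K) (ℚ.+-identityˡ K) (ℚ.+-monoˡ-≤ K {0ℚ} {1ℚ} 0≤1)

  scaled-recip-small : ∀ {K e} → 0ℚ ℚ.≤ K → 0ℚ ℚ.< e → Σ ℕ λ N → ∀ n → N ≤ n → recip n * K ℚ.≤ e
  scaled-recip-small {K} {e} 0≤K 0<e = N , bound
    where
    δ : Σ ℚ λ d → 0ℚ ℚ.< d × (1ℚ + K) * d ≡ e
    δ = scale-down {1ℚ + K} {e} (0<1+ {K} 0≤K) 0<e
    d = proj₁ δ
    small = recip-small {d} (proj₁ (proj₂ δ))
    N = proj₁ small
    bound : ∀ n → N ≤ n → recip n * K ℚ.≤ e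
    bound n N≤n = ℚ.≤-trans {recip n * K} {d * (1ℚ + K)} {e}
      (*-mono {recip n} {d} {K} {1ℚ + K} (0≤recip n) 0≤K (proj₂ small n N≤n) (≤1+ K))
      (ℚ.≤-reflexive (trans (ℚ.*-comm d (1ℚ + K)) (proj₂ (proj₂ δ))))

  ^-nonNeg : ∀ {a} k → 0ℚ ℚ.≤ a → 0ℚ ℚ.≤ a ^ℚ k
  ^-nonNeg zero 0≤a = 0≤1
  ^-nonNeg (suc k) 0≤a = 0≤* 0≤a (^-nonNeg k 0≤a)

  ^-pos : ∀ {a} k → 0ℚ ℚ.< a → 0ℚ ℚ.< a ^ℚ k
  ^-pos zero 0<a = 0<1
  ^-pos (suc k) 0<a = 0<* 0<a (^-pos k 0<a)

  ^-mono : ∀ {a b} k → 0ℚ ℚ.≤ a → a ℚ.≤ b → a ^ℚ k ℚ.≤ b ^ℚ k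
  ^-mono zero 0≤a a≤b = ℚ.≤-refl
  ^-mono (suc k) 0≤a a≤b = *-mono 0≤a (^-nonNeg k 0≤a) a≤b (^-mono k 0≤a a≤b)

  ^-superadditive : ∀ {a b} k → 0ℚ ℚ.≤ a → 0ℚ ℚ.≤ b → a ^ℚ suc k + b ^ℚ suc k ℚ.≤ (a + b) ^ℚ suc k
  ^-superadditive {a} {b} zero 0≤a 0≤b = ℚ.≤-reflexive (sym (ℚ.*-distribʳ-+ 1ℚ a b))
  ^-superadditive {a} {b} (suc k) 0≤a 0≤b = ℚ.≤-trans
    (ℚ.+-mono-≤ (*-monoˡ 0≤a (^-mono (suc k) 0≤a (≤-add 0≤b)))
                (*-monoˡ 0≤b (^-mono (suc k) 0≤b (subst (b ℚ.≤_) (ℚ.+-comm b a) (≤-add 0≤a)))))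
    (ℚ.≤-reflexive (sym (ℚ.*-distribʳ-+ ((a + b) ^ℚ suc k) a b)))

  ≤-suc-^ : ∀ {a} k → 1ℚ ℚ.≤ a → a ℚ.≤ a ^ℚ suc k
  ≤-suc-^ {a} zero 1≤a = ℚ.≤-reflexive (sym (ℚ.*-identityʳ a))
  ≤-suc-^ {a} (suc k) 1≤a = subst (ℚ._≤ a ^ℚ suc (suc k)) (ℚ.*-identityʳ a)
    (*-monoˡ (ℚ.≤-trans 0≤1 1≤a) (ℚ.≤-trans 1≤a (≤-suc-^ k 1≤a)))

open RationalLemmas

IsCauchy : (ℕ → ℚ) → Set
IsCauchy s = ∀ ε → 0ℚ ℚ.< ε → Σ ℕ λ N → ∀ m n → N ≤ m → N ≤ n → ∣ s m - s n ∣ ℚ.≤ ε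

-- No quotient is taken: x and y represent the same real number when x ≤ℝ y and y ≤ℝ x.
record ℝ : Set where
  constructor mkℝ
  field
    seq    : ℕ → ℚ
    cauchy : IsCauchy seq
open ℝ public

infix 4 _≤ℝ_ _<ℝ_

_≤ℝ_ : ℝ → ℝ → Set
x ≤ℝ y = ∀ ε → 0ℚ ℚ.< ε → Σ ℕ λ N → ∀ n → N ≤ n → seq x n ℚ.≤ seq y n + ε

_<ℝ_ : ℝ → ℝ → Set
x <ℝ y = Σ ℚ λ ε → 0ℚ ℚ.< ε × Σ ℕ λ N → ∀ n → N ≤ n → seq x n + ε ℚ.≤ seq y n

module CauchyLemmas where

  open +-*-Solver using (solve; _:+_; _:*_; _:-_; :-_; _:=_)

  const-cauchy : ∀ q → IsCauchy (λ _ → q)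
  const-cauchy q ε 0<ε = 0 , λ _ _ _ _ → subst (λ z → ∣ z ∣ ℚ.≤ ε) (sym (ℚ.+-inverseʳ q)) (ℚ.<⇒≤ 0<ε)

  +-cauchy : ∀ s t → IsCauchy s → IsCauchy t → IsCauchy (λ n → s n + t n)
  +-cauchy s t cs ct ε 0<ε with cs (½ * ε) (0<½* 0<ε) | ct (½ * ε) (0<½* 0<ε)
  ... | M , hs | N , ht = M ℕ.⊔ N , λ m n m≥ n≥ → ℚ.≤-trans
    (subst (ℚ._≤ ∣ s m - s n ∣ + ∣ t m - t n ∣)
      (cong ∣_∣ (solve 4 (λ a b c d → (a :- b) :+ (c :- d) := (a :+ c) :- (b :+ d)) refl (s m) (s n) (t m) (t n)))
      (ℚ.∣p+q∣≤∣p∣+∣q∣ (s m - s n) (t m - t n)))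
    (ℚ.≤-trans
      (ℚ.+-mono-≤ (hs m n (ℕ.m⊔n≤o⇒m≤o M N m≥) (ℕ.m⊔n≤o⇒m≤o M N n≥))
                  (ht m n (ℕ.m⊔n≤o⇒n≤o M N m≥) (ℕ.m⊔n≤o⇒n≤o M N n≥)))
      (ℚ.≤-reflexive (halves ε)))

  neg-cauchy : ∀ s → IsCauchy s → IsCauchy (λ n → - s n)
  neg-cauchy s cs ε 0<ε with cs ε 0<ε
  ... | N , h = N , λ m n m≥ n≥ → subst (ℚ._≤ ε)
    (trans (∣-∣-comm (s m) (s n)) (cong ∣_∣ (solve 2 (λ a b → b :- a := (:- a) :- (:- b)) refl (s m) (s n))))
    (h m n m≥ n≥)

  abs-cauchy : ∀ s → IsCauchy s → IsCauchy (λ n → ∣ s n ∣)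
  abs-cauchy s cs ε 0<ε with cs ε 0<ε
  ... | N , h = N , λ m n m≥ n≥ → ℚ.≤-trans
    (∣∣≤ (reverse (s m) (s n))
         (subst₂ ℚ._≤_ (solve 2 (λ a b → b :- a := :- (a :- b)) refl ∣ s m ∣ ∣ s n ∣)
                       (∣-∣-comm (s n) (s m)) (reverse (s n) (s m))))
    (h m n m≥ n≥)
    where
    reverse : ∀ p q → ∣ p ∣ - ∣ q ∣ ℚ.≤ ∣ p - q ∣
    reverse p q = subst (∣ p ∣ - ∣ q ∣ ℚ.≤_)
      (solve 2 (λ a b → (a :+ b) :- b := a) refl ∣ p - q ∣ ∣ q ∣)
      (ℚ.+-monoˡ-≤ (- ∣ q ∣) (subst (λ z → ∣ z ∣ ℚ.≤ ∣ p - q ∣ + ∣ q ∣)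
        (solve 2 (λ p q → (p :- q) :+ q := p) refl p q) (ℚ.∣p+q∣≤∣p∣+∣q∣ (p - q) q)))

  eventually-bounded : ∀ s → IsCauchy s →
    Σ ℚ λ K → 0ℚ ℚ.< K × Σ ℕ λ N → ∀ n → N ≤ n → ∣ s n ∣ ℚ.≤ K
  eventually-bounded s cs with cs 1ℚ 0<1
  ... | N , h = 1ℚ + ∣ s N ∣ , ℚ.<-≤-trans 0<1 (≤-add {1ℚ} (ℚ.0≤∣p∣ (s N))) , N , λ n n≥ →
    ℚ.≤-trans
      (subst (λ z → ∣ z ∣ ℚ.≤ ∣ s n - s N ∣ + ∣ s N ∣)
        (solve 2 (λ p q → (p :- q) :+ q := p) refl (s n) (s N)) (ℚ.∣p+q∣≤∣p∣+∣q∣ (s n - s N) (s N)))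
      (ℚ.+-monoˡ-≤ ∣ s N ∣ (h n N n≥ ℕ.≤-refl))

  *-diff : ∀ a a′ b b′ → a * (b - b′) + b′ * (a - a′) ≡ a * b - a′ * b′
  *-diff = solve 4 (λ a a′ b b′ → a :* (b :- b′) :+ b′ :* (a :- a′) := a :* b :- a′ :* b′) refl

  ∣*∣≤ : ∀ x y {k l} → ∣ x ∣ ℚ.≤ k → ∣ y ∣ ℚ.≤ l → ∣ x * y ∣ ℚ.≤ k * l
  ∣*∣≤ x y {k} {l} hx hy = subst (ℚ._≤ k * l) (sym (ℚ.∣p*q∣≡∣p∣*∣q∣ x y))
    (*-mono {∣ x ∣} {k} {∣ y ∣} {l} (ℚ.0≤∣p∣ x) (ℚ.0≤∣p∣ y) hx hy)

  *-diff-bound : ∀ a a′ b b′ {K L d e} → ∣ a ∣ ℚ.≤ K → ∣ b′ ∣ ℚ.≤ L → ∣ b - b′ ∣ ℚ.≤ d → ∣ a - a′ ∣ ℚ.≤ e →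
    ∣ a * b - a′ * b′ ∣ ℚ.≤ K * d + L * e
  *-diff-bound a a′ b b′ {K} {L} {d} {e} ha hb hd he =
    subst (λ z → ∣ z ∣ ℚ.≤ K * d + L * e) (*-diff a a′ b b′)
      (ℚ.≤-trans (ℚ.∣p+q∣≤∣p∣+∣q∣ (a * (b - b′)) (b′ * (a - a′)))
        (ℚ.+-mono-≤ (∣*∣≤ a (b - b′) ha hd) (∣*∣≤ b′ (a - a′) hb he)))

  *-cauchy : ∀ s t → IsCauchy s → IsCauchy t → IsCauchy (λ n → s n * t n)
  *-cauchy s t cs ct ε 0<ε = Z , λ m n m≥ n≥ → subst (∣ s m * t m - s n * t n ∣ ℚ.≤_) sum≡ε
    (*-diff-bound (s m) (s n) (t m) (t n)
      (bs m (ℕ.≤-trans A≤Z m≥)) (bt n (ℕ.≤-trans B≤Z n≥))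
      (proj₂ ht m n (ℕ.≤-trans N≤Z m≥) (ℕ.≤-trans N≤Z n≥))
      (proj₂ hs m n (ℕ.≤-trans M≤Z m≥) (ℕ.≤-trans M≤Z n≥)))
    where
    bounded-s = eventually-bounded s cs
    bounded-t = eventually-bounded t ct
    K = proj₁ bounded-s
    L = proj₁ bounded-t
    A = proj₁ (proj₂ (proj₂ bounded-s))
    B = proj₁ (proj₂ (proj₂ bounded-t))
    bs : ∀ n → A ≤ n → ∣ s n ∣ ℚ.≤ K
    bs = proj₂ (proj₂ (proj₂ bounded-s))
    bt : ∀ n → B ≤ n → ∣ t n ∣ ℚ.≤ L
    bt = proj₂ (proj₂ (proj₂ bounded-t))
    δ : Σ ℚ λ d → 0ℚ ℚ.< d × K * d ≡ ½ * ε
    δ = scale-down (proj₁ (proj₂ bounded-s)) (0<½* 0<ε)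
    η : Σ ℚ λ e → 0ℚ ℚ.< e × L * e ≡ ½ * ε
    η = scale-down (proj₁ (proj₂ bounded-t)) (0<½* 0<ε)
    sum≡ε : K * proj₁ δ + L * proj₁ η ≡ ε
    sum≡ε = trans (cong₂ _+_ (proj₂ (proj₂ δ)) (proj₂ (proj₂ η))) (halves ε)
    hs = cs (proj₁ η) (proj₁ (proj₂ η))
    ht = ct (proj₁ δ) (proj₁ (proj₂ δ))
    M = proj₁ hs
    N = proj₁ ht
    Z = (A ℕ.⊔ B) ℕ.⊔ (M ℕ.⊔ N)
    A≤Z = ℕ.≤-trans (ℕ.m≤m⊔n A B) (ℕ.m≤m⊔n (A ℕ.⊔ B) (M ℕ.⊔ N))
    B≤Z = ℕ.≤-trans (ℕ.m≤n⊔m A B) (ℕ.m≤m⊔n (A ℕ.⊔ B) (M ℕ.⊔ N))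
    M≤Z = ℕ.≤-trans (ℕ.m≤m⊔n M N) (ℕ.m≤n⊔m (A ℕ.⊔ B) (M ℕ.⊔ N))
    N≤Z = ℕ.≤-trans (ℕ.m≤n⊔m M N) (ℕ.m≤n⊔m (A ℕ.⊔ B) (M ℕ.⊔ N))

open CauchyLemmas

fromℚ : ℚ → ℝ
fromℚ q = mkℝ (λ _ → q) (const-cauchy q)

0ℝ 1ℝ : ℝ
0ℝ = fromℚ 0ℚ
1ℝ = fromℚ 1ℚ

fromℕ : ℕ → ℝ
fromℕ n = fromℚ (+ n / 1)

infixl 6 _+ℝ_ _-ℝ_
infixl 7 _*ℝ_
infixr 8 _^ℝ_

_+ℝ_ _-ℝ_ _*ℝ_ : ℝ → ℝ → ℝ
x +ℝ y = mkℝ (λ n → seq x n + seq y n) (+-cauchy (seq x) (seq y) (cauchy x) (cauchy y))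
x -ℝ y = mkℝ (λ n → seq x n - seq y n) (+-cauchy (seq x) (λ n → - seq y n) (cauchy x) (neg-cauchy (seq y) (cauchy y)))
x *ℝ y = mkℝ (λ n → seq x n * seq y n) (*-cauchy (seq x) (seq y) (cauchy x) (cauchy y))

∣_∣ℝ : ℝ → ℝ
∣ x ∣ℝ = mkℝ (λ n → ∣ seq x n ∣) (abs-cauchy (seq x) (cauchy x))

_^ℝ_ : ℝ → ℕ → ℝ
x ^ℝ zero  = 1ℝ
x ^ℝ suc n = x *ℝ x ^ℝ n

-- The largest j ≤ b with (j/(n+1))ᵏ ≤ q, or 0 if there is none.
greatest : ℕ → ℚ → ℕ → ℕ → ℕ
greatest k q n zero    = 0
greatest k q n (suc b) = if does ((+ suc b / suc n) ^ℚ k ℚ.≤? q) then suc b else greatest k q n b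

-- The search bound (n+1)(∣↥ q∣+1) is large enough for q ≥ 0 and k ≥ 1, since q < ∣↥ q∣+1.
rootApprox : ℕ → ℚ → ℕ → ℚ
rootApprox k q n = + greatest k q n (suc n ℕ.* suc ℤ.∣ ℚ.↥ q ∣) / suc n

module RootLemmas where

  open +-*-Solver using (solve; _:+_; _:*_; _:-_; :-_; _:=_)

  0≤/ : ∀ j n → 0ℚ ℚ.≤ + j / suc n
  0≤/ j n = subst (0ℚ ℚ.≤_) (sym (/-ι j n)) (0≤* (0≤ι j) (0≤recip n))

  suc-/ : ∀ j n → + suc j / suc n ≡ + j / suc n + recip n
  suc-/ j n = begin
    + suc j / suc n             ≡⟨ /-ι (suc j) n ⟩
    ι (suc j) * recip n         ≡⟨ cong (_* recip n) (ι-suc j) ⟩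
    (1ℚ + ι j) * recip n        ≡⟨ ℚ.*-distribʳ-+ (recip n) 1ℚ (ι j) ⟩
    1ℚ * recip n + ι j * recip n ≡⟨ cong₂ _+_ (ℚ.*-identityˡ (recip n)) (sym (/-ι j n)) ⟩
    recip n + + j / suc n       ≡⟨ ℚ.+-comm (recip n) (+ j / suc n) ⟩
    + j / suc n + recip n       ∎
    where open ≡-Reasoning

  cancel-/ : ∀ n u → + (suc n ℕ.* u) / suc n ≡ ι u
  cancel-/ n u = ℚ.toℚᵘ-injective (ℚᵘ.≃-trans (toℚᵘ-/ (+ (suc n ℕ.* u)) n) (ℚᵘ.≃-trans
    (ℚᵘ.*≡* (trans (ℤ.*-identityʳ (+ (suc n ℕ.* u))) (trans (cong +_ (ℕ.*-comm (suc n) u)) (ℤ.pos-* u (suc n)))))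
    (ℚᵘ.≃-sym (toℚᵘ-/ (+ u) 0))))

  greatest-lower : ∀ k {q} n b → 0ℚ ℚ.≤ q → (+ greatest (suc k) q n b / suc n) ^ℚ suc k ℚ.≤ q
  greatest-lower k {q} n zero 0≤q = subst (ℚ._≤ q)
    (sym (trans (cong (_* (0/ ^ℚ k)) (ℚ.0/n≡0 (suc n))) (ℚ.*-zeroˡ (0/ ^ℚ k)))) 0≤q
    where 0/ = + 0 / suc n
  greatest-lower k {q} n (suc b) 0≤q = go ((+ suc b / suc n) ^ℚ suc k ℚ.≤? q)
    where
    go : (d : Dec ((+ suc b / suc n) ^ℚ suc k ℚ.≤ q)) →
      (+ (if does d then suc b else greatest (suc k) q n b) / suc n) ^ℚ suc k ℚ.≤ q
    go (yes h) = h
    go (no  _) = greatest-lower k n b 0≤q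

  greatest-upper : ∀ k {q} n b → q ℚ.< (+ suc b / suc n) ^ℚ k →
    q ℚ.< (+ suc (greatest k q n b) / suc n) ^ℚ k
  greatest-upper k n zero    h = h
  greatest-upper k {q} n (suc b) h = go ((+ suc b / suc n) ^ℚ k ℚ.≤? q)
    where
    go : (d : Dec ((+ suc b / suc n) ^ℚ k ℚ.≤ q)) →
      q ℚ.< (+ suc (if does d then suc b else greatest k q n b) / suc n) ^ℚ k
    go (yes _) = h
    go (no ¬h) = greatest-upper k n b (ℚ.≰⇒> ¬h)

  bound-works : ∀ k q n → q ℚ.< (+ suc (suc n ℕ.* suc ℤ.∣ ℚ.↥ q ∣) / suc n) ^ℚ suc k
  bound-works k q n = ℚ.≤-<-trans (archimedean q) (ℚ.<-≤-trans u<x (≤-suc-^ k 1≤x))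
    where
    u = ℤ.∣ ℚ.↥ q ∣
    x = + suc (suc n ℕ.* suc u) / suc n
    su≤x : 1ℚ + ι u ℚ.≤ x
    su≤x = subst₂ ℚ._≤_ (trans (cancel-/ n (suc u)) (ι-suc u)) (sym (suc-/ (suc n ℕ.* suc u) n))
      (≤-add (0≤recip n))
    1≤x : 1ℚ ℚ.≤ x
    1≤x = ℚ.≤-trans (≤-add {1ℚ} (0≤ι u)) su≤x
    u<x : ι u ℚ.< x
    u<x = ℚ.<-≤-trans (subst (ℚ._< 1ℚ + ι u) (ℚ.+-identityˡ (ι u)) (ℚ.+-monoˡ-< (ι u) 0<1)) su≤x

  root-lower : ∀ k {q} n → 0ℚ ℚ.≤ q → rootApprox (suc k) q n ^ℚ suc k ℚ.≤ q
  root-lower k {q} n = greatest-lower k n (suc n ℕ.* suc ℤ.∣ ℚ.↥ q ∣)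

  root-upper : ∀ k q n → q ℚ.< (rootApprox (suc k) q n + recip n) ^ℚ suc k
  root-upper k q n = subst (λ z → q ℚ.< z ^ℚ suc k) (suc-/ (greatest (suc k) q n b) n)
    (greatest-upper (suc k) n b (bound-works k q n))
    where b = suc n ℕ.* suc ℤ.∣ ℚ.↥ q ∣

  0≤root : ∀ k q n → 0ℚ ℚ.≤ rootApprox k q n
  0≤root k q n = 0≤/ (greatest k q n (suc n ℕ.* suc ℤ.∣ ℚ.↥ q ∣)) n

  ^-close : ∀ k {p q e c r s} → 0ℚ ℚ.≤ e → c ℚ.≤ e → 0ℚ ℚ.≤ c → 0ℚ ℚ.≤ s →
    p ℚ.≤ q + e ^ℚ suc k → r ^ℚ suc k ℚ.≤ p → q ℚ.< (s + c) ^ℚ suc k → r ℚ.≤ s + (e + e)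
  ^-close k {p} {q} {e} {c} {r} {s} 0≤e c≤e 0≤c 0≤s p≤q lower upper =
    ℚ.≮⇒≥ λ s+2e<r → ℚ.<-irrefl {p} {p} refl
    (begin-strict
      p                            ≤⟨ p≤q ⟩
      q + e ^ℚ suc k               <⟨ ℚ.+-monoˡ-< (e ^ℚ suc k) upper ⟩
      (s + c) ^ℚ suc k + e ^ℚ suc k ≤⟨ ℚ.+-monoˡ-≤ (e ^ℚ suc k) (^-mono (suc k) (0≤+ {s} {c} 0≤s 0≤c) (ℚ.+-monoʳ-≤ s c≤e)) ⟩
      (s + e) ^ℚ suc k + e ^ℚ suc k ≤⟨ ^-superadditive {s + e} {e} k (0≤+ {s} {e} 0≤s 0≤e) 0≤e ⟩
      (s + e + e) ^ℚ suc k         ≡⟨ cong (_^ℚ suc k) (ℚ.+-assoc s e e) ⟩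
      (s + (e + e)) ^ℚ suc k       ≤⟨ ^-mono (suc k) (0≤+ {s} {e + e} 0≤s (0≤+ {e} {e} 0≤e 0≤e)) (ℚ.<⇒≤ s+2e<r) ⟩
      r ^ℚ suc k                   ≤⟨ lower ⟩
      p                            ∎)
    where open ℚ.≤-Reasoning

  root-close : ∀ k {p q e} m n → 0ℚ ℚ.≤ p → 0ℚ ℚ.≤ e → recip n ℚ.≤ e → p ℚ.≤ q + e ^ℚ suc k →
    rootApprox (suc k) p m ℚ.≤ rootApprox (suc k) q n + (e + e)
  root-close k {p} {q} {e} m n 0≤p 0≤e n≤e p≤q =
    ^-close k {p} {q} {e} {recip n} {rootApprox (suc k) p m} {rootApprox (suc k) q n}
      0≤e n≤e (0≤recip n) (0≤root (suc k) q n) p≤q (root-lower k m 0≤p) (root-upper k q n)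

  max0-close : ∀ {p q e} → 0ℚ ℚ.≤ e → p ℚ.≤ q + e → p ℚ.⊔ 0ℚ ℚ.≤ q ℚ.⊔ 0ℚ + e
  max0-close {p} {q} {e} 0≤e p≤ = ℚ.⊔-lub
    (ℚ.≤-trans p≤ (ℚ.+-monoˡ-≤ e (ℚ.p≤p⊔q q 0ℚ)))
    (0≤+ (ℚ.p≤q⊔p q 0ℚ) 0≤e)

  root-cauchy : ∀ k .{{_ : ℕ.NonZero k}} s → IsCauchy s → IsCauchy (λ n → rootApprox k (s n ℚ.⊔ 0ℚ) n)
  root-cauchy (suc k) s cs ε 0<ε = M ℕ.⊔ N , λ m n m≥ n≥ →
    ∣-∣≤ (r m) (r n) (one m n m≥ n≥) (one n m n≥ m≥)
    where
    e = ½ * ε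
    r : ℕ → ℚ
    r n = rootApprox (suc k) (s n ℚ.⊔ 0ℚ) n
    0<e : 0ℚ ℚ.< e
    0<e = 0<½* {ε} 0<ε
    0≤e = ℚ.<⇒≤ 0<e
    small = recip-small {e} 0<e
    close = cs (e ^ℚ suc k) (^-pos (suc k) 0<e)
    M = proj₁ small
    N = proj₁ close
    one : ∀ m n → M ℕ.⊔ N ≤ m → M ℕ.⊔ N ≤ n → r m ℚ.≤ r n + ε
    one m n m≥ n≥ = subst (λ z → r m ℚ.≤ r n + z) (halves ε)
      (root-close k {s m ℚ.⊔ 0ℚ} {s n ℚ.⊔ 0ℚ} {e} m n (ℚ.p≤q⊔p (s m) 0ℚ) 0≤e
        (proj₂ small n (ℕ.m⊔n≤o⇒m≤o M N n≥))
        (max0-close {s m} {s n} {e ^ℚ suc k} (^-nonNeg (suc k) 0≤e)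
          (≤-from-diff {s m} {s n} (proj₂ close m n (ℕ.m⊔n≤o⇒n≤o M N m≥) (ℕ.m⊔n≤o⇒n≤o M N n≥)))))

open RootLemmas

-- x ^ (1/k) for x ≥ 0; negative x are sent to 0.
root : (k : ℕ) .{{_ : ℕ.NonZero k}} → ℝ → ℝ
root k x = mkℝ (λ n → rootApprox k (seq x n ℚ.⊔ 0ℚ) n) (root-cauchy k (seq x) (cauchy x))

sqrt cbrt : ℝ → ℝ
sqrt = root 2
cbrt = root 3

record ℂ : Set where
  constructor _+i_
  field
    re im : ℝ
open ℂ public

infixl 6 _+ℂ_

0ℂ : ℂ
0ℂ = 0ℝ +i 0ℝ

_+ℂ_ : ℂ → ℂ → ℂ
(a +i b) +ℂ (c +i d) = (a +ℝ c) +i (b +ℝ d)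

∣_∣ℂ : ℂ → ℝ
∣ a +i b ∣ℂ = sqrt (a ^ℝ 2 +ℝ b ^ℝ 2)

record ℚ[i] : Set where
  constructor _+i_
  field
    re im : ℚ

module GaussianRationals where

  open ℚ[i]

  infixl 6 _⊞_ _⊟_
  infixl 7 _⊠_ _⊡_

  _⊞_ _⊟_ _⊠_ : ℚ[i] → ℚ[i] → ℚ[i]
  (a +i b) ⊞ (c +i d) = (a + c) +i (b + d)
  (a +i b) ⊟ (c +i d) = (a - c) +i (b - d)
  (a +i b) ⊠ (c +i d) = (a * c - b * d) +i (a * d + b * c)

  _⊡_ : ℚ → ℚ[i] → ℚ[i]
  q ⊡ (a +i b) = (q * a) +i (q * b)

  -- zᵏ/k!
  expTerm : ℚ[i] → ℕ → ℚ[i]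
  expTerm z zero    = 1ℚ +i 0ℚ
  expTerm z (suc k) = (+ 1 / suc k) ⊡ (z ⊠ expTerm z k)

  expSum : ℚ[i] → ℕ → ℚ[i]
  expSum z zero    = 0ℚ +i 0ℚ
  expSum z (suc n) = expSum z n ⊞ expTerm z n

module ExpLemmas where

  open ℚ[i]
  open GaussianRationals
  open +-*-Solver using (solve; _:+_; _:*_; _:-_; :-_; con; _:=_)

  ‖_‖ : ℚ[i] → ℚ
  ‖ a +i b ‖ = ∣ a ∣ + ∣ b ∣

  ‖‖-nonNeg : ∀ z → 0ℚ ℚ.≤ ‖ z ‖
  ‖‖-nonNeg (a +i b) = 0≤+ {∣ a ∣} {∣ b ∣} (ℚ.0≤∣p∣ a) (ℚ.0≤∣p∣ b)

  re≤‖‖ : ∀ z → ∣ re z ∣ ℚ.≤ ‖ z ‖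
  re≤‖‖ (a +i b) = ≤-add {∣ a ∣} {∣ b ∣} (ℚ.0≤∣p∣ b)

  im≤‖‖ : ∀ z → ∣ im z ∣ ℚ.≤ ‖ z ‖
  im≤‖‖ (a +i b) = subst (∣ b ∣ ℚ.≤_) (ℚ.+-comm (∣ b ∣) (∣ a ∣)) (≤-add {∣ b ∣} {∣ a ∣} (ℚ.0≤∣p∣ a))

  +-interchange : ∀ a b c d → (a + b) + (c + d) ≡ (a + c) + (b + d)
  +-interchange = solve 4 (λ a b c d → (a :+ b) :+ (c :+ d) := (a :+ c) :+ (b :+ d)) refl

  ‖⊞‖ : ∀ z w → ‖ z ⊞ w ‖ ℚ.≤ ‖ z ‖ + ‖ w ‖
  ‖⊞‖ (a +i b) (c +i d) = subst (∣ a + c ∣ + ∣ b + d ∣ ℚ.≤_) (+-interchange (∣ a ∣) (∣ c ∣) (∣ b ∣) (∣ d ∣))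
    (ℚ.+-mono-≤ (ℚ.∣p+q∣≤∣p∣+∣q∣ a c) (ℚ.∣p+q∣≤∣p∣+∣q∣ b d))

  ‖⊡‖ : ∀ q z → 0ℚ ℚ.≤ q → ‖ q ⊡ z ‖ ≡ q * ‖ z ‖
  ‖⊡‖ q (a +i b) 0≤q = trans (cong₂ _+_ (abs a) (abs b)) (sym (ℚ.*-distribˡ-+ q (∣ a ∣) (∣ b ∣)))
    where
    abs : ∀ a → ∣ q * a ∣ ≡ q * ∣ a ∣
    abs a = trans (ℚ.∣p*q∣≡∣p∣*∣q∣ q a) (cong (_* ∣ a ∣) (ℚ.0≤p⇒∣p∣≡p 0≤q))

  ‖⊠‖ : ∀ z w → ‖ z ⊠ w ‖ ℚ.≤ ‖ z ‖ * ‖ w ‖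
  ‖⊠‖ (a +i b) (c +i d) = subst (∣ a * c - b * d ∣ + ∣ a * d + b * c ∣ ℚ.≤_)
    (solve 4 (λ a b c d → (a :* c :+ b :* d) :+ (a :* d :+ b :* c) := (a :+ b) :* (c :+ d)) refl (∣ a ∣) (∣ b ∣) (∣ c ∣) (∣ d ∣))
    (ℚ.+-mono-≤
      (ℚ.≤-trans (ℚ.∣p-q∣≤∣p∣+∣q∣ (a * c) (b * d)) (ℚ.≤-reflexive (cong₂ _+_ (ℚ.∣p*q∣≡∣p∣*∣q∣ a c) (ℚ.∣p*q∣≡∣p∣*∣q∣ b d))))
      (ℚ.≤-trans (ℚ.∣p+q∣≤∣p∣+∣q∣ (a * d) (b * c)) (ℚ.≤-reflexive (cong₂ _+_ (ℚ.∣p*q∣≡∣p∣*∣q∣ a d) (ℚ.∣p*q∣≡∣p∣*∣q∣ b c)))))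

  ⊞-⊟ : ∀ x u y v → (x ⊞ u) ⊟ (y ⊞ v) ≡ (x ⊟ y) ⊞ (u ⊟ v)
  ⊞-⊟ (a +i b) (c +i d) (a′ +i b′) (c′ +i d′) = cong₂ _+i_ (lem a c a′ c′) (lem b d b′ d′)
    where
    lem : ∀ a c a′ c′ → (a + c) - (a′ + c′) ≡ (a - a′) + (c - c′)
    lem = solve 4 (λ a c a′ c′ → (a :+ c) :- (a′ :+ c′) := (a :- a′) :+ (c :- c′)) refl

  ⊟-self : ∀ z → z ⊟ z ≡ 0ℚ +i 0ℚ
  ⊟-self (a +i b) = cong₂ _+i_ (ℚ.+-inverseʳ a) (ℚ.+-inverseʳ b)

  ⊟-split : ∀ x y z → x ⊟ z ≡ (x ⊟ y) ⊞ (y ⊟ z)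
  ⊟-split (a +i b) (c +i d) (e +i f) = cong₂ _+i_ (lem a c e) (lem b d f)
    where
    lem : ∀ a c e → a - e ≡ (a - c) + (c - e)
    lem = solve 3 (λ a c e → a :- e := (a :- c) :+ (c :- e)) refl

  ⊟-add : ∀ x y u → (y ⊞ u) ⊟ x ≡ (y ⊟ x) ⊞ u
  ⊟-add (a +i b) (c +i d) (e +i f) = cong₂ _+i_ (lem a c e) (lem b d f)
    where
    lem : ∀ a c e → (c + e) - a ≡ (c - a) + e
    lem = solve 3 (λ a c e → (c :+ e) :- a := (c :- a) :+ e) refl

  ‖⊟‖-comm : ∀ x y → ‖ x ⊟ y ‖ ≡ ‖ y ⊟ x ‖
  ‖⊟‖-comm (a +i b) (c +i d) = cong₂ _+_ (∣-∣-comm a c) (∣-∣-comm b d)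

  term-⊟ : ∀ q z w u v → q ⊡ (z ⊠ u) ⊟ q ⊡ (w ⊠ v) ≡ q ⊡ (z ⊠ (u ⊟ v) ⊞ (z ⊟ w) ⊠ v)
  term-⊟ q (a +i b) (a′ +i b′) (c +i d) (c′ +i d′) = cong₂ _+i_ (lem₁ q a b a′ b′ c d c′ d′) (lem₂ q a b a′ b′ c d c′ d′)
    where
    lem₁ : ∀ q a b a′ b′ c d c′ d′ → q * (a * c - b * d) - q * (a′ * c′ - b′ * d′)
      ≡ q * ((a * (c - c′) - b * (d - d′)) + ((a - a′) * c′ - (b - b′) * d′))
    lem₁ = solve 9 (λ q a b a′ b′ c d c′ d′ → q :* (a :* c :- b :* d) :- q :* (a′ :* c′ :- b′ :* d′)
      := q :* ((a :* (c :- c′) :- b :* (d :- d′)) :+ ((a :- a′) :* c′ :- (b :- b′) :* d′))) refl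
    lem₂ : ∀ q a b a′ b′ c d c′ d′ → q * (a * d + b * c) - q * (a′ * d′ + b′ * c′)
      ≡ q * ((a * (d - d′) + b * (c - c′)) + ((a - a′) * d′ + (b - b′) * c′))
    lem₂ = solve 9 (λ q a b a′ b′ c d c′ d′ → q :* (a :* d :+ b :* c) :- q :* (a′ :* d′ :+ b′ :* c′)
      := q :* ((a :* (d :- d′) :+ b :* (c :- c′)) :+ ((a :- a′) :* d′ :+ (b :- b′) :* c′))) refl

module ExpCauchy where

  open ℚ[i]
  open GaussianRationals
  open ExpLemmas

  ι-+ : ∀ m n → ι (m ℕ.+ n) ≡ ι m + ι n
  ι-+ zero    n = sym (ℚ.+-identityˡ (ι n))
  ι-+ (suc m) n = begin
    ι (suc (m ℕ.+ n))  ≡⟨ ι-suc (m ℕ.+ n) ⟩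
    1ℚ + ι (m ℕ.+ n)   ≡⟨ cong (λ z → 1ℚ + z) (ι-+ m n) ⟩
    1ℚ + (ι m + ι n)   ≡⟨ ℚ.+-assoc 1ℚ (ι m) (ι n) ⟨
    1ℚ + ι m + ι n     ≡⟨ cong (_+ ι n) (ι-suc m) ⟨
    ι (suc m) + ι n    ∎
    where open ≡-Reasoning

  recip*ι : ∀ k x → recip k * (ι (suc k) * x) ≡ x
  recip*ι k x = begin
    recip k * (ι (suc k) * x)  ≡⟨ ℚ.*-assoc (recip k) (ι (suc k)) x ⟨
    recip k * ι (suc k) * x    ≡⟨ cong (_* x) (trans (ℚ.*-comm (recip k) (ι (suc k))) (ι*recip k)) ⟩
    1ℚ * x                     ≡⟨ ℚ.*-identityˡ x ⟩
    x                          ∎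
    where open ≡-Reasoning

  module Majorant (K : ℕ) where

    open +-*-Solver using (solve; _:+_; _:*_; _:-_; :-_; con; _:=_)

    b : ℕ → ℚ
    b zero    = 1ℚ
    b (suc k) = recip k * (ι K * b k)

    0≤b : ∀ k → 0ℚ ℚ.≤ b k
    0≤b zero    = 0≤1
    0≤b (suc k) = 0≤* {recip k} {ι K * b k} (0≤recip k) (0≤* {ι K} {b k} (0≤ι K) (0≤b k))

    K*b : ∀ k → ι (suc k) * b (suc k) ≡ ι K * b k
    K*b k = trans (solve 3 (λ i r x → i :* (r :* x) := r :* (i :* x)) refl (ι (suc k)) (recip k) (ι K * b k))
      (recip*ι k (ι K * b k))

    ⊠-bound : ∀ z w {x y} → ‖ z ‖ ℚ.≤ x → ‖ w ‖ ℚ.≤ y → ‖ z ⊠ w ‖ ℚ.≤ x * y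
    ⊠-bound z w {x} {y} hz hw = ℚ.≤-trans (‖⊠‖ z w)
      (*-mono {‖ z ‖} {x} {‖ w ‖} {y} (‖‖-nonNeg z) (‖‖-nonNeg w) hz hw)

    ⊡-bound : ∀ q z {x} → 0ℚ ℚ.≤ q → ‖ z ‖ ℚ.≤ x → ‖ q ⊡ z ‖ ℚ.≤ q * x
    ⊡-bound q z {x} 0≤q hz = subst (ℚ._≤ q * x) (sym (‖⊡‖ q z 0≤q)) (*-monoˡ {q} {‖ z ‖} {x} 0≤q hz)

    ⊞-bound : ∀ z w {x y} → ‖ z ‖ ℚ.≤ x → ‖ w ‖ ℚ.≤ y → ‖ z ⊞ w ‖ ℚ.≤ x + y
    ⊞-bound z w hz hw = ℚ.≤-trans (‖⊞‖ z w) (ℚ.+-mono-≤ hz hw)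

    term-bound : ∀ z k → ‖ z ‖ ℚ.≤ ι K → ‖ expTerm z k ‖ ℚ.≤ b k
    term-bound z zero    hz = ℚ.≤-refl
    term-bound z (suc k) hz = ⊡-bound (recip k) (z ⊠ expTerm z k) (0≤recip k)
      (⊠-bound z (expTerm z k) hz (term-bound z k hz))

    step-bound : ∀ q z w u v {d x y} → 0ℚ ℚ.≤ q → ‖ z ‖ ℚ.≤ ι K → ‖ z ⊟ w ‖ ℚ.≤ d →
      ‖ u ⊟ v ‖ ℚ.≤ x → ‖ v ‖ ℚ.≤ y → ‖ q ⊡ (z ⊠ u) ⊟ q ⊡ (w ⊠ v) ‖ ℚ.≤ q * (ι K * x + d * y)
    step-bound q z w u v {d} {x} {y} 0≤q hz hd hx hy =
      subst (λ t → ‖ t ‖ ℚ.≤ q * (ι K * x + d * y)) (sym (term-⊟ q z w u v))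
        (⊡-bound q (z ⊠ (u ⊟ v) ⊞ (z ⊟ w) ⊠ v) 0≤q
          (⊞-bound (z ⊠ (u ⊟ v)) ((z ⊟ w) ⊠ v) (⊠-bound z (u ⊟ v) hz hx) (⊠-bound (z ⊟ w) v hd hy)))

    term-lipschitz : ∀ z w {d} k → ‖ z ‖ ℚ.≤ ι K → ‖ w ‖ ℚ.≤ ι K → ‖ z ⊟ w ‖ ℚ.≤ d →
      ‖ expTerm z (suc k) ⊟ expTerm w (suc k) ‖ ℚ.≤ b k * d
    term-lipschitz z w {d} zero hz hw hd = subst (‖ expTerm z 1 ⊟ expTerm w 1 ‖ ℚ.≤_)
      (solve 2 (λ K d → con 1ℚ :* (K :* con 0ℚ :+ d :* con 1ℚ) := con 1ℚ :* d) refl (ι K) d)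
      (step-bound (recip 0) z w (1ℚ +i 0ℚ) (1ℚ +i 0ℚ) {d} {0ℚ} {1ℚ} (0≤recip 0) hz hd ℚ.≤-refl ℚ.≤-refl)
    term-lipschitz z w {d} (suc k) hz hw hd = subst (‖ expTerm z (suc (suc k)) ⊟ expTerm w (suc (suc k)) ‖ ℚ.≤_)
      value
      (step-bound (recip (suc k)) z w (expTerm z (suc k)) (expTerm w (suc k)) {d} {b k * d} {b (suc k)}
        (0≤recip (suc k)) hz hd (term-lipschitz z w k hz hw hd) (term-bound w (suc k) hw))
      where
      open ≡-Reasoning
      value : recip (suc k) * (ι K * (b k * d) + d * b (suc k)) ≡ b (suc k) * d
      value = begin
        recip (suc k) * (ι K * (b k * d) + d * b (suc k))
          ≡⟨ cong (λ x → recip (suc k) * (x + d * b (suc k))) (ℚ.*-assoc (ι K) (b k) d) ⟨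
        recip (suc k) * (ι K * b k * d + d * b (suc k))
          ≡⟨ cong (λ x → recip (suc k) * (x * d + d * b (suc k))) (K*b k) ⟨
        recip (suc k) * (ι (suc k) * b (suc k) * d + d * b (suc k))
          ≡⟨ cong (recip (suc k) *_) (solve 3 (λ i x d → i :* x :* d :+ d :* x := (con 1ℚ :+ i) :* (x :* d)) refl (ι (suc k)) (b (suc k)) d) ⟩
        recip (suc k) * ((1ℚ + ι (suc k)) * (b (suc k) * d))
          ≡⟨ cong (λ x → recip (suc k) * (x * (b (suc k) * d))) (ι-suc (suc k)) ⟨
        recip (suc k) * (ι (suc (suc k)) * (b (suc k) * d))
          ≡⟨ recip*ι (suc k) (b (suc k) * d) ⟩
        b (suc k) * d ∎

    total : ℕ → ℚ
    total zero    = 0ℚ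
    total (suc n) = total n + b n

    tail : ℕ → ℕ → ℚ
    tail m zero    = 0ℚ
    tail m (suc j) = tail m j + b (j ℕ.+ m)

    total-+ : ∀ m j → total (j ℕ.+ m) ≡ total m + tail m j
    total-+ m zero    = sym (ℚ.+-identityʳ (total m))
    total-+ m (suc j) = trans (cong (_+ b (j ℕ.+ m)) (total-+ m j)) (ℚ.+-assoc (total m) (tail m j) (b (j ℕ.+ m)))

    sum-lipschitz : ∀ z w {d} n → ‖ z ‖ ℚ.≤ ι K → ‖ w ‖ ℚ.≤ ι K → ‖ z ⊟ w ‖ ℚ.≤ d →
      ‖ expSum z (suc n) ⊟ expSum w (suc n) ‖ ℚ.≤ total n * d
    sum-lipschitz z w {d} zero hz hw hd = ℚ.≤-reflexive (sym (ℚ.*-zeroˡ d))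
    sum-lipschitz z w {d} (suc n) hz hw hd = subst₂ ℚ._≤_
      (sym (cong ‖_‖ (⊞-⊟ (expSum z (suc n)) (expTerm z (suc n)) (expSum w (suc n)) (expTerm w (suc n)))))
      (sym (ℚ.*-distribʳ-+ d (total n) (b n)))
      (⊞-bound (expSum z (suc n) ⊟ expSum w (suc n)) (expTerm z (suc n) ⊟ expTerm w (suc n))
        (sum-lipschitz z w n hz hw hd) (term-lipschitz z w n hz hw hd))

    sum-tail : ∀ z m j → ‖ z ‖ ℚ.≤ ι K → ‖ expSum z (j ℕ.+ m) ⊟ expSum z m ‖ ℚ.≤ tail m j
    sum-tail z m zero    hz = ℚ.≤-reflexive (cong ‖_‖ {expSum z m ⊟ expSum z m} {0ℚ +i 0ℚ} (⊟-self (expSum z m)))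
    sum-tail z m (suc j) hz = subst (λ t → ‖ t ‖ ℚ.≤ tail m (suc j))
      (sym (⊟-add (expSum z m) (expSum z (j ℕ.+ m)) (expTerm z (j ℕ.+ m))))
      (⊞-bound (expSum z (j ℕ.+ m) ⊟ expSum z m) (expTerm z (j ℕ.+ m))
        (sum-tail z m j hz) (term-bound z (j ℕ.+ m) hz))

    halving : ∀ k → K ℕ.+ K ≤ k → b (suc k) + b (suc k) ℚ.≤ b k
    halving k 2K≤k = begin
      b (suc k) + b (suc k)              ≡⟨ solve 3 (λ r x y → r :* (x :* y) :+ r :* (x :* y) := r :* ((x :+ x) :* y)) refl (recip k) (ι K) (b k) ⟩
      recip k * ((ι K + ι K) * b k)      ≡⟨ cong (λ x → recip k * (x * b k)) (ι-+ K K) ⟨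
      recip k * (ι (K ℕ.+ K) * b k)      ≤⟨ *-monoˡ {recip k} (0≤recip k) (*-monoʳ {b k} (0≤b k) (ι-mono (ℕ.m≤n⇒m≤1+n 2K≤k))) ⟩
      recip k * (ι (suc k) * b k)        ≡⟨ recip*ι k (b k) ⟩
      b k                                ∎
      where open ℚ.≤-Reasoning

    tail-bound′ : ∀ m j → K ℕ.+ K ≤ m → tail m j + (b (j ℕ.+ m) + b (j ℕ.+ m)) ℚ.≤ b m + b m
    tail-bound′ m zero    hm = ℚ.≤-reflexive (ℚ.+-identityˡ (b m + b m))
    tail-bound′ m (suc j) hm = begin
      tail m j + b k + (b (suc k) + b (suc k))  ≤⟨ ℚ.+-monoʳ-≤ (tail m j + b k) (halving k (ℕ.≤-trans hm (ℕ.m≤n+m m j))) ⟩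
      tail m j + b k + b k                      ≡⟨ ℚ.+-assoc (tail m j) (b k) (b k) ⟩
      tail m j + (b k + b k)                    ≤⟨ tail-bound′ m j hm ⟩
      b m + b m                                 ∎
      where
      open ℚ.≤-Reasoning
      k = j ℕ.+ m

    tail-bound : ∀ m j → K ℕ.+ K ≤ m → tail m j ℚ.≤ b m + b m
    tail-bound m j hm = ℚ.≤-trans
      (≤-add {tail m j} {b (j ℕ.+ m) + b (j ℕ.+ m)} (0≤+ {b (j ℕ.+ m)} {b (j ℕ.+ m)} (0≤b (j ℕ.+ m)) (0≤b (j ℕ.+ m))))
      (tail-bound′ m j hm)

    M : ℕ
    M = K ℕ.+ K

    B : ℚ
    B = total M + (b M + b M)

    0≤total : ∀ n → 0ℚ ℚ.≤ total n
    0≤total zero    = ℚ.≤-refl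
    0≤total (suc n) = 0≤+ {total n} {b n} (0≤total n) (0≤b n)

    0≤B : 0ℚ ℚ.≤ B
    0≤B = 0≤+ {total M} {b M + b M} (0≤total M) (0≤+ {b M} {b M} (0≤b M) (0≤b M))

    total-bound : ∀ n → M ≤ n → total n ℚ.≤ B
    total-bound n M≤n = subst (λ k → total k ℚ.≤ B) (ℕ.m∸n+n≡m M≤n)
      (subst (ℚ._≤ B) (sym (total-+ M (n ℕ.∸ M))) (ℚ.+-monoʳ-≤ (total M) (tail-bound M (n ℕ.∸ M) ℕ.≤-refl)))

    b-decreasing : ∀ j → b (j ℕ.+ M) ℚ.≤ b M
    b-decreasing zero    = ℚ.≤-refl
    b-decreasing (suc j) = ℚ.≤-trans
      (≤-add {b (suc (j ℕ.+ M))} {b (suc (j ℕ.+ M))} (0≤b (suc (j ℕ.+ M))))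
      (ℚ.≤-trans (halving (j ℕ.+ M) (ℕ.m≤n+m M j)) (b-decreasing j))

    b-small : ∀ ε → 0ℚ ℚ.< ε → Σ ℕ λ N → ∀ m → N ≤ m → b m ℚ.≤ ε
    b-small ε 0<ε = suc (M ℕ.+ N) , go
      where
      small = scaled-recip-small {ι K * b M} {ε} (0≤* {ι K} {b M} (0≤ι K) (0≤b M)) 0<ε
      N = proj₁ small
      go : ∀ m → suc (M ℕ.+ N) ≤ m → b m ℚ.≤ ε
      go (suc m) (ℕ.s≤s le) = ℚ.≤-trans
        (*-monoˡ {recip m} (0≤recip m) (*-monoˡ {ι K} (0≤ι K)
          (subst (λ k → b k ℚ.≤ b M) (ℕ.m∸n+n≡m (ℕ.m+n≤o⇒m≤o M le)) (b-decreasing (m ℕ.∸ M)))))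
        (proj₂ small m (ℕ.m+n≤o⇒n≤o M le))

    sum-close : ∀ z w {d} m n → ‖ z ‖ ℚ.≤ ι K → ‖ w ‖ ℚ.≤ ι K → ‖ z ⊟ w ‖ ℚ.≤ d → 0ℚ ℚ.≤ d → suc M ≤ m → m ≤ n →
      ‖ expSum z m ⊟ expSum w n ‖ ℚ.≤ B * d + (b m + b m)
    sum-close z w {d} (suc m) n hz hw hd 0≤d (ℕ.s≤s M≤m) m≤n =
      subst (λ t → ‖ t ‖ ℚ.≤ B * d + (b (suc m) + b (suc m))) (sym (⊟-split (expSum z (suc m)) (expSum w (suc m)) (expSum w n)))
        (⊞-bound (expSum z (suc m) ⊟ expSum w (suc m)) (expSum w (suc m) ⊟ expSum w n)
          (ℚ.≤-trans (sum-lipschitz z w m hz hw hd) (*-monoʳ {d} 0≤d (total-bound m M≤m)))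
          (subst (ℚ._≤ b (suc m) + b (suc m)) (‖⊟‖-comm (expSum w n) (expSum w (suc m)))
            (subst (λ k → ‖ expSum w k ⊟ expSum w (suc m) ‖ ℚ.≤ b (suc m) + b (suc m)) (ℕ.m∸n+n≡m m≤n)
              (ℚ.≤-trans (sum-tail w (suc m) (n ℕ.∸ suc m) hw)
                (tail-bound (suc m) (n ℕ.∸ suc m) (ℕ.m≤n⇒m≤1+n M≤m))))))

  exp-cauchy : ∀ s t → IsCauchy s → IsCauchy t → ∀ ε → 0ℚ ℚ.< ε →
    Σ ℕ λ N → ∀ m n → N ≤ m → N ≤ n → ‖ expSum (s m +i t m) m ⊟ expSum (s n +i t n) n ‖ ℚ.≤ ε
  exp-cauchy s t cs ct ε 0<ε = Z , λ m n m≥ n≥ → either m n m≥ n≥ (ℕ.≤-total m n)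
    where
    z : ℕ → ℚ[i]
    z n = s n +i t n
    bounded-s = eventually-bounded s cs
    bounded-t = eventually-bounded t ct
    P = proj₁ bounded-s
    Q = proj₁ bounded-t
    K = ℤ.∣ ℚ.↥ (P + Q) ∣
    open Majorant K
    δ : Σ ℚ λ d → 0ℚ ℚ.< d × (1ℚ + B) * d ≡ ½ * ε
    δ = scale-down {1ℚ + B} {½ * ε} (0<1+ {B} 0≤B) (0<½* {ε} 0<ε)
    d = proj₁ δ
    0<d : 0ℚ ℚ.< d
    0<d = proj₁ (proj₂ δ)
    hs = cs (½ * d) (0<½* {d} 0<d)
    ht = ct (½ * d) (0<½* {d} 0<d)
    hb = b-small (½ * (½ * ε)) (0<½* {½ * ε} (0<½* {ε} 0<ε))
    N₁ N₂ N₃ N₄ N₅ Z₄ Z₃ Z₂ Z₁ Z : ℕ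
    N₁ = proj₁ (proj₂ (proj₂ bounded-s))
    N₂ = proj₁ (proj₂ (proj₂ bounded-t))
    N₃ = proj₁ hs
    N₄ = proj₁ ht
    N₅ = proj₁ hb
    Z₄ = N₄ ℕ.⊔ N₅
    Z₃ = N₃ ℕ.⊔ Z₄
    Z₂ = N₂ ℕ.⊔ Z₃
    Z₁ = N₁ ℕ.⊔ Z₂
    Z = suc M ℕ.⊔ Z₁
    ≥₁ : ∀ {n} → Z ≤ n → Z₁ ≤ n
    ≥₁ = ℕ.m⊔n≤o⇒n≤o (suc M) Z₁
    ≥₂ : ∀ {n} → Z ≤ n → Z₂ ≤ n
    ≥₂ n≥ = ℕ.m⊔n≤o⇒n≤o N₁ Z₂ (≥₁ n≥)
    ≥₃ : ∀ {n} → Z ≤ n → Z₃ ≤ n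
    ≥₃ n≥ = ℕ.m⊔n≤o⇒n≤o N₂ Z₃ (≥₂ n≥)
    ≥₄ : ∀ {n} → Z ≤ n → Z₄ ≤ n
    ≥₄ n≥ = ℕ.m⊔n≤o⇒n≤o N₃ Z₄ (≥₃ n≥)
    bounded : ∀ n → Z ≤ n → ‖ z n ‖ ℚ.≤ ι K
    bounded n n≥ = ℚ.≤-trans {‖ z n ‖} {P + Q} {ι K}
      (ℚ.+-mono-≤ (proj₂ (proj₂ (proj₂ bounded-s)) n (ℕ.m⊔n≤o⇒m≤o N₁ Z₂ (≥₁ n≥)))
                  (proj₂ (proj₂ (proj₂ bounded-t)) n (ℕ.m⊔n≤o⇒m≤o N₂ Z₃ (≥₂ n≥))))
      (archimedean (P + Q))
    close : ∀ m n → Z ≤ m → Z ≤ n → ‖ z m ⊟ z n ‖ ℚ.≤ d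
    close m n m≥ n≥ = subst (‖ z m ⊟ z n ‖ ℚ.≤_) (halves d)
      (ℚ.+-mono-≤ (proj₂ hs m n (ℕ.m⊔n≤o⇒m≤o N₃ Z₄ (≥₃ m≥)) (ℕ.m⊔n≤o⇒m≤o N₃ Z₄ (≥₃ n≥)))
                  (proj₂ ht m n (ℕ.m⊔n≤o⇒m≤o N₄ N₅ (≥₄ m≥)) (ℕ.m⊔n≤o⇒m≤o N₄ N₅ (≥₄ n≥))))
    small : ∀ m → Z ≤ m → b m + b m ℚ.≤ ½ * ε
    small m m≥ = subst (b m + b m ℚ.≤_) (halves (½ * ε)) (ℚ.+-mono-≤ bm bm)
      where bm = proj₂ hb m (ℕ.m⊔n≤o⇒n≤o N₄ N₅ (≥₄ m≥))
    B*d≤ : B * d ℚ.≤ ½ * ε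
    B*d≤ = subst (B * d ℚ.≤_) (proj₂ (proj₂ δ)) (*-monoʳ {d} {B} {1ℚ + B} (ℚ.<⇒≤ 0<d) (≤1+ B))
    ordered : ∀ m n → Z ≤ m → Z ≤ n → m ≤ n → ‖ expSum (z m) m ⊟ expSum (z n) n ‖ ℚ.≤ ε
    ordered m n m≥ n≥ m≤n = ℚ.≤-trans
      (sum-close (z m) (z n) {d} m n (bounded m m≥) (bounded n n≥) (close m n m≥ n≥) (ℚ.<⇒≤ 0<d)
        (ℕ.m⊔n≤o⇒m≤o (suc M) Z₁ m≥) m≤n)
      (subst (B * d + (b m + b m) ℚ.≤_) (halves ε) (ℚ.+-mono-≤ B*d≤ (small m m≥)))
    either : ∀ m n → Z ≤ m → Z ≤ n → m ≤ n ⊎ n ≤ m → ‖ expSum (z m) m ⊟ expSum (z n) n ‖ ℚ.≤ ε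
    either m n m≥ n≥ (inj₁ m≤n) = ordered m n m≥ n≥ m≤n
    either m n m≥ n≥ (inj₂ n≤m) = subst (ℚ._≤ ε) (‖⊟‖-comm (expSum (z n) n) (expSum (z m) m)) (ordered n m n≥ m≥ n≤m)

  exp-cauchy-re : ∀ s t → IsCauchy s → IsCauchy t → IsCauchy (λ n → re (expSum (s n +i t n) n))
  exp-cauchy-re s t cs ct ε 0<ε = proj₁ h , λ m n m≥ n≥ → ℚ.≤-trans
    (re≤‖‖ (expSum (s m +i t m) m ⊟ expSum (s n +i t n) n)) (proj₂ h m n m≥ n≥)
    where h = exp-cauchy s t cs ct ε 0<ε

  exp-cauchy-im : ∀ s t → IsCauchy s → IsCauchy t → IsCauchy (λ n → im (expSum (s n +i t n) n))
  exp-cauchy-im s t cs ct ε 0<ε = proj₁ h , λ m n m≥ n≥ → ℚ.≤-trans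
    (im≤‖‖ (expSum (s m +i t m) m ⊟ expSum (s n +i t n) n)) (proj₂ h m n m≥ n≥)
    where h = exp-cauchy s t cs ct ε 0<ε

-- The n-th approximant of exp z is the n-th partial sum of the exponential series at the n-th approximant of z.
exp : ℂ → ℂ
exp (x +i y) =
     mkℝ (λ n → ℚ[i].re (expSum (seq x n +i seq y n) n)) (exp-cauchy-re (seq x) (seq y) (cauchy x) (cauchy y))
  +i mkℝ (λ n → ℚ[i].im (expSum (seq x n +i seq y n) n)) (exp-cauchy-im (seq x) (seq y) (cauchy x) (cauchy y))
  where
  open GaussianRationals
  open ExpCauchy

-- The first k terms of 1/(2m+1) − 1/(2m+3) + 1/(2m+5) − ⋯
leibniz : ℕ → ℕ → ℚ
leibniz m zero    = 0ℚ
leibniz m (suc k) = + 1 / suc (m ℕ.+ m) - leibniz (suc m) k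

module LeibnizLemmas where

  open +-*-Solver using (solve; _:+_; _:*_; _:-_; :-_; _:=_)

  recip-antitone : ∀ {m n} → m ≤ n → recip n ℚ.≤ recip m
  recip-antitone {m} {n} m≤n = subst₂ ℚ._≤_
    (trans (cong (recip n *_) (ι*recip m)) (ℚ.*-identityʳ (recip n)))
    (trans (solve 3 (λ r i x → r :* (i :* x) := i :* r :* x) refl (recip n) (ι (suc n)) (recip m))
      (trans (cong (_* recip m) (ι*recip n)) (ℚ.*-identityˡ (recip m))))
    (*-monoˡ {recip n} (0≤recip n) (*-monoʳ {recip m} (0≤recip m) (ι-mono (ℕ.s≤s m≤n))))

  mutual
    leibniz-lower : ∀ m k → 0ℚ ℚ.≤ leibniz m k
    leibniz-lower m zero    = ℚ.≤-refl
    leibniz-lower m (suc k) = subst (ℚ._≤ leibniz m (suc k)) (ℚ.+-inverseʳ (leibniz (suc m) k))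
      (ℚ.+-monoˡ-≤ (- leibniz (suc m) k) (ℚ.≤-trans (leibniz-upper (suc m) k)
        (recip-antitone (ℕ.+-mono-≤ (ℕ.n≤1+n m) (ℕ.n≤1+n m)))))

    leibniz-upper : ∀ m k → leibniz m k ℚ.≤ recip (m ℕ.+ m)
    leibniz-upper m zero    = 0≤recip (m ℕ.+ m)
    leibniz-upper m (suc k) = subst (leibniz m (suc k) ℚ.≤_) (ℚ.+-identityʳ (recip (m ℕ.+ m)))
      (ℚ.+-monoʳ-≤ (recip (m ℕ.+ m)) (ℚ.neg-antimono-≤ (leibniz-lower (suc m) k)))

  leibniz-tail : ∀ m n k → ∣ leibniz m (n ℕ.+ k) - leibniz m n ∣ ℚ.≤ recip ((n ℕ.+ m) ℕ.+ (n ℕ.+ m))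
  leibniz-tail m zero k = subst (λ x → ∣ x ∣ ℚ.≤ recip (m ℕ.+ m)) (sym (ℚ.+-identityʳ (leibniz m k)))
    (subst (ℚ._≤ recip (m ℕ.+ m)) (sym (ℚ.0≤p⇒∣p∣≡p (leibniz-lower m k))) (leibniz-upper m k))
  leibniz-tail m (suc n) k = subst₂ ℚ._≤_
    (trans (∣-∣-comm x y) (cong ∣_∣ (solve 3 (λ r x y → y :- x := (r :- x) :- (r :- y)) refl (recip (m ℕ.+ m)) x y)))
    (cong (λ j → recip (j ℕ.+ j)) (ℕ.+-suc n m))
    (leibniz-tail (suc m) n k)
    where
    x = leibniz (suc m) (n ℕ.+ k)
    y = leibniz (suc m) n

  leibniz-cauchy : IsCauchy (leibniz 0)
  leibniz-cauchy ε 0<ε = N , λ m n m≥ n≥ → either m n m≥ n≥ (ℕ.≤-total m n)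
    where
    small = recip-small {ε} 0<ε
    N = proj₁ small
    ordered : ∀ m n → N ≤ m → m ≤ n → ∣ leibniz 0 n - leibniz 0 m ∣ ℚ.≤ ε
    ordered m n m≥ m≤n = subst (λ k → ∣ leibniz 0 k - leibniz 0 m ∣ ℚ.≤ ε) (ℕ.m+[n∸m]≡n m≤n)
      (ℚ.≤-trans (leibniz-tail 0 m (n ℕ.∸ m))
        (proj₂ small ((m ℕ.+ 0) ℕ.+ (m ℕ.+ 0)) (ℕ.≤-trans m≥ (ℕ.≤-trans (ℕ.m≤m+n m 0) (ℕ.m≤m+n (m ℕ.+ 0) (m ℕ.+ 0))))))
    either : ∀ m n → N ≤ m → N ≤ n → m ≤ n ⊎ n ≤ m → ∣ leibniz 0 m - leibniz 0 n ∣ ℚ.≤ ε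
    either m n m≥ n≥ (inj₁ m≤n) = subst (ℚ._≤ ε) (∣-∣-comm (leibniz 0 n) (leibniz 0 m)) (ordered m n m≥ m≤n)
    either m n m≥ n≥ (inj₂ n≤m) = ordered n m n≥ n≤m

-- π = 4 (1 − 1/3 + 1/5 − ⋯)
π : ℝ
π = fromℚ (+ 4 / 1) *ℝ mkℝ (leibniz 0) LeibnizLemmas.leibniz-cauchy

elements : ∀ {p} → Subset p → List (Fin p)
elements {p} X = filter (_∈? X) (allFin p)

∑ : {A : Set} → List A → (A → ℂ) → ℂ
∑ xs f = foldr (λ x s → f x +ℂ s) 0ℂ xs

-- The integers y with S + 1 ≤ y ≤ S + T.
interval : ℤ → ℕ → List ℤ
interval S T = map (λ j → S ℤ.+ + suc j) (upTo T)

-- The list of candidate pairs (x , y) has no repetitions, so its filtered length is a cardinality.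
J₃ : (p : ℕ) → Subset p → ℤ → ℕ → ℕ
J₃ p X S T = length (filter (λ ((x , y) : ℤ × ℤ) → + p ℤ.∣? (x ℤ.- y))
  (cartesianProduct (map (λ x → + toℕ x) (elements X)) (interval S T)))

{-# OPTIONS --safe #-}

-- Write N = |X| and J(S) for the number of solutions with S < y ≤ S + T.  Parseval's identity on ℤ/p gives
-- ∑_{S mod p} (p J(S) − N T)² ≤ p² N² Δ² T, so over h ≤ p consecutive shifts the mean square is at most p² N² Δ² T / h.
-- J(S) lies between its values for intervals shorter or longer by h, at h consecutive shifts; with x³ = T Δ² / p the
-- choice h ≈ p x balances the two errors N h / p and N Δ (T / h)^½, and no smoothing is needed when p x ≤ 1.
--
-- Orthogonality of ζᵏ = exp (2πik/p) does not need ζ ≠ 1: the sum G = ∑_{a<p} ζᵃᵏ satisfies ζᵏ G = G, hence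
-- (∑_{x∈X} ζᵏˣ) G = N G, and the hypothesis with Δ < 1 forces G = 0.  For Δ ≥ 1 the claim is trivial.
--
-- That exp (2πi) = 1 for the Leibniz value of π: if α is a partial sum of the arctangent series, sin α(t) − t cos α(t)
-- satisfies a linear difference equation along a grid of [0, 1] with a source tending to 0, so sin = cos at π/4.
module Submission where

open import Defs
open import Data.Bool.Base using (Bool; true; false; if_then_else_)
open import Data.Fin.Base using (zero; suc; toℕ)
open import Data.Fin.Subset using (Subset; ∣_∣)
open import Data.Fin.Subset.Properties using (_∈?_)
open import Data.Integer.Base as ℤ using (ℤ; +_)
open import Data.Integer.Coprimality using (Coprime)
import Data.Integer.Divisibility.Signed as ℤ
import Data.Integer.Properties as ℤ
import Data.Integer.Solver as ℤ-Solver
open import Data.List.Base using (List; []; _∷_; _++_; map; foldr; length; upTo; filter; allFin; tabulate; cartesianProduct; cartesianProductWith)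
import Data.List.Properties as List
open import Data.Nat.Base as ℕ using (ℕ; zero; suc; NonZero)
import Data.Nat.Divisibility as ℕ
open import Data.Nat.Primality using (Prime; prime⇒irreducible)
import Data.Nat.Properties as ℕ
open import Data.Product.Base using (Σ; _×_; _,_; proj₁; proj₂)
open import Data.Rational.Base as ℚ using (ℚ; 0ℚ; 1ℚ; ½; _+_; _*_; -_; _-_; _/_) renaming (∣_∣ to ∣_∣ℚ)
import Data.Rational.Properties as ℚ
open import Data.Rational.Solver using (module +-*-Solver)
import Data.Rational.Unnormalised.Base as ℚᵘ
import Data.Rational.Unnormalised.Properties as ℚᵘ
open import Data.Sum.Base using (_⊎_; inj₁; inj₂)
open import Data.Vec.Base using ([]; _∷_)
open import Function.Base using (_∘_; id)
open import Relation.Binary.PropositionalEquality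
open import Relation.Nullary using (¬_; Dec; does; yes; no; contradiction)
open RationalLemmas
open CauchyLemmas
open ExpCauchy using (ι-+)
open LeibnizLemmas using (recip-antitone)

module Z = ℤ-Solver.+-*-Solver

module ℚ-Order where

  open +-*-Solver using (solve; _:+_; _:*_; :-_; con; _:=_)

  0≤⇒≤ : ∀ {p q} e → 0ℚ ℚ.≤ e → q ≡ p + e → p ℚ.≤ q
  0≤⇒≤ {p} e 0≤e eq = subst (p ℚ.≤_) (sym eq) (≤-add {p} {e} 0≤e)

  ≤⇒0≤ : ∀ {p q} → p ℚ.≤ q → 0ℚ ℚ.≤ q - p
  ≤⇒0≤ {p} {q} p≤q = subst (ℚ._≤ q - p) (ℚ.+-inverseʳ p) (ℚ.+-monoˡ-≤ (- p) p≤q)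

  0≤² : ∀ p → 0ℚ ℚ.≤ p * p
  0≤² p with ℚ.≤-total 0ℚ p
  ... | inj₁ 0≤p = 0≤* {p} {p} 0≤p 0≤p
  ... | inj₂ p≤0 = subst (0ℚ ℚ.≤_) (solve 1 (λ p → (:- p) :* (:- p) := p :* p) refl p)
    (0≤* { - p} { - p} (ℚ.neg-antimono-≤ p≤0) (ℚ.neg-antimono-≤ p≤0))

  ²-cancel-≤ : ∀ {p q} → 0ℚ ℚ.≤ q → p * p ℚ.≤ q * q → p ℚ.≤ q
  ²-cancel-≤ {p} {q} 0≤q h = ℚ.≮⇒≥ λ q<p → ℚ.<-irrefl {q * q} {q * q} refl (ℚ.<-≤-trans (lt q<p) h)
    where
    lt : q ℚ.< p → q * q ℚ.< p * p
    lt q<p = ℚ.≤-<-trans (*-monoˡ {q} 0≤q (ℚ.<⇒≤ q<p))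
      (ℚ.*-monoˡ-<-pos p {{ℚ.positive (ℚ.≤-<-trans 0≤q q<p)}} q<p)

  *-cancel-≤ : ∀ {r p q} → 0ℚ ℚ.< r → r * p ℚ.≤ r * q → p ℚ.≤ q
  *-cancel-≤ {r} 0<r = ℚ.*-cancelˡ-≤-pos r {{ℚ.positive 0<r}}

  ι-* : ∀ m n → ι (m ℕ.* n) ≡ ι m * ι n
  ι-* zero    n = sym (ℚ.*-zeroˡ (ι n))
  ι-* (suc m) n = trans (ι-+ n (m ℕ.* n)) (trans (cong (λ z → ι n + z) (ι-* m n))
    (trans (solve 2 (λ m n → n :+ m :* n := (con 1ℚ :+ m) :* n) refl (ι m) (ι n)) (cong (_* ι n) (sym (ι-suc m)))))

  0<ι : ∀ n .{{_ : NonZero n}} → 0ℚ ℚ.< ι n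
  0<ι (suc n) = ℚ.<-≤-trans {0ℚ} {1ℚ} 0<1 (ι-mono {1} {suc n} (ℕ.s≤s ℕ.z≤n))

open ℚ-Order

module ListSums where

  open +-*-Solver using (solve; _:+_; _:*_; con; _:=_)

  private variable
    A B : Set

  sumℚ : List A → (A → ℚ) → ℚ
  sumℚ xs f = foldr (λ x s → f x + s) 0ℚ xs

  sum-cong : ∀ (xs : List A) {f g} → (∀ x → f x ≡ g x) → sumℚ xs f ≡ sumℚ xs g
  sum-cong []       eq = refl
  sum-cong (x ∷ xs) eq = cong₂ _+_ (eq x) (sum-cong xs eq)

  sum-mono : ∀ (xs : List A) {f g} → (∀ x → f x ℚ.≤ g x) → sumℚ xs f ℚ.≤ sumℚ xs g
  sum-mono []       le = ℚ.≤-refl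
  sum-mono (x ∷ xs) le = ℚ.+-mono-≤ (le x) (sum-mono xs le)

  sum-nonNeg : ∀ (xs : List A) {f} → (∀ x → 0ℚ ℚ.≤ f x) → 0ℚ ℚ.≤ sumℚ xs f
  sum-nonNeg []       le = ℚ.≤-refl
  sum-nonNeg (x ∷ xs) {f} le = 0≤+ {f x} (le x) (sum-nonNeg xs le)

  sum-+ : ∀ (xs : List A) f g → sumℚ xs (λ x → f x + g x) ≡ sumℚ xs f + sumℚ xs g
  sum-+ []       f g = refl
  sum-+ (x ∷ xs) f g = trans (cong (λ z → f x + g x + z) (sum-+ xs f g))
    (solve 4 (λ a b c d → (a :+ b) :+ (c :+ d) := (a :+ c) :+ (b :+ d)) refl (f x) (g x) (sumℚ xs f) (sumℚ xs g))

  sum-*ˡ : ∀ (xs : List A) c f → sumℚ xs (λ x → c * f x) ≡ c * sumℚ xs f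
  sum-*ˡ []       c f = sym (ℚ.*-zeroʳ c)
  sum-*ˡ (x ∷ xs) c f = trans (cong (λ z → c * f x + z) (sum-*ˡ xs c f)) (sym (ℚ.*-distribˡ-+ c (f x) (sumℚ xs f)))

  sum-*ʳ : ∀ (xs : List A) c f → sumℚ xs (λ x → f x * c) ≡ sumℚ xs f * c
  sum-*ʳ xs c f = trans (sum-cong xs (λ x → ℚ.*-comm (f x) c)) (trans (sum-*ˡ xs c f) (ℚ.*-comm c (sumℚ xs f)))

  sum-0 : ∀ (xs : List A) → sumℚ xs (λ _ → 0ℚ) ≡ 0ℚ
  sum-0 []       = refl
  sum-0 (x ∷ xs) = trans (ℚ.+-identityˡ (sumℚ xs (λ _ → 0ℚ))) (sum-0 xs)

  sum-const : ∀ (xs : List A) c → sumℚ xs (λ _ → c) ≡ ι (length xs) * c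
  sum-const []       c = sym (ℚ.*-zeroˡ c)
  sum-const (x ∷ xs) c = trans (cong (λ z → c + z) (sum-const xs c))
    (trans (solve 2 (λ c n → c :+ n :* c := (con 1ℚ :+ n) :* c) refl c (ι (length xs)))
      (cong (_* c) (sym (ι-suc (length xs)))))

  sum-swap : ∀ (xs : List A) (ys : List B) (f : A → B → ℚ) →
    sumℚ xs (λ x → sumℚ ys (f x)) ≡ sumℚ ys (λ y → sumℚ xs (λ x → f x y))
  sum-swap []       ys f = sym (sum-0 ys)
  sum-swap (x ∷ xs) ys f = trans (cong (λ z → sumℚ ys (f x) + z) (sum-swap xs ys f))
    (sym (sum-+ ys (f x) (λ y → sumℚ xs (λ x → f x y))))

  sum-product : ∀ (xs : List A) (ys : List B) f g →
    sumℚ xs (λ x → sumℚ ys (λ y → f x * g y)) ≡ sumℚ xs f * sumℚ ys g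
  sum-product xs ys f g = trans (sum-cong xs (λ x → sum-*ˡ ys (f x) g)) (sum-*ʳ xs (sumℚ ys g) f)

  sum-++ : ∀ (xs ys : List A) f → sumℚ (xs ++ ys) f ≡ sumℚ xs f + sumℚ ys f
  sum-++ []       ys f = sym (ℚ.+-identityˡ (sumℚ ys f))
  sum-++ (x ∷ xs) ys f = trans (cong (λ z → f x + z) (sum-++ xs ys f)) (sym (ℚ.+-assoc (f x) (sumℚ xs f) (sumℚ ys f)))

  sum-map : ∀ (xs : List A) (g : A → B) f → sumℚ (map g xs) f ≡ sumℚ xs (λ x → f (g x))
  sum-map []       g f = refl
  sum-map (x ∷ xs) g f = cong (λ z → f (g x) + z) (sum-map xs g f)

  sum-cartesian : ∀ {C : Set} (h : A → B → C) (xs : List A) (ys : List B) f →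
    sumℚ (cartesianProductWith h xs ys) f ≡ sumℚ xs (λ x → sumℚ ys (λ y → f (h x y)))
  sum-cartesian h []       ys f = refl
  sum-cartesian h (x ∷ xs) ys f = trans (sum-++ (map (h x) ys) (cartesianProductWith h xs ys) f)
    (cong₂ _+_ (sum-map ys (h x) f) (sum-cartesian h xs ys f))

  sum-upTo-suc : ∀ n f → sumℚ (upTo (suc n)) f ≡ f 0 + sumℚ (upTo n) (f ∘ suc)
  sum-upTo-suc n f = cong (λ z → f 0 + z) (trans (cong (λ l → sumℚ l f) (sym (List.map-applyUpTo id suc n)))
    (sum-map (upTo n) suc f))

  sum-upTo-+ : ∀ m n f → sumℚ (upTo (m ℕ.+ n)) f ≡ sumℚ (upTo m) f + sumℚ (upTo n) (λ j → f (m ℕ.+ j))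
  sum-upTo-+ zero    n f = sym (ℚ.+-identityˡ (sumℚ (upTo n) f))
  sum-upTo-+ (suc m) n f = trans (sum-upTo-suc (m ℕ.+ n) f)
    (trans (cong (λ z → f 0 + z) (sum-upTo-+ m n (f ∘ suc)))
      (trans (sym (ℚ.+-assoc (f 0) (sumℚ (upTo m) (f ∘ suc)) (sumℚ (upTo n) (λ j → f (suc m ℕ.+ j)))))
        (cong (_+ sumℚ (upTo n) (λ j → f (suc m ℕ.+ j))) (sym (sum-upTo-suc m f)))))

  sum-upTo-last : ∀ n f → sumℚ (upTo (suc n)) f ≡ sumℚ (upTo n) f + f n
  sum-upTo-last n f = trans (cong (λ k → sumℚ (upTo k) f) (ℕ.+-comm 1 n))
    (trans (sum-upTo-+ n 1 f) (cong (λ z → sumℚ (upTo n) f + z)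
      (trans (ℚ.+-identityʳ (f (n ℕ.+ 0))) (cong f (ℕ.+-identityʳ n)))))

  sum-upTo-mono : ∀ n {f g} → (∀ j → j ℕ.< n → f j ℚ.≤ g j) → sumℚ (upTo n) f ℚ.≤ sumℚ (upTo n) g
  sum-upTo-mono zero            le = ℚ.≤-refl
  sum-upTo-mono (suc n) {f} {g} le = subst₂ ℚ._≤_ (sym (sum-upTo-suc n f)) (sym (sum-upTo-suc n g))
    (ℚ.+-mono-≤ (le 0 (ℕ.s≤s ℕ.z≤n)) (sum-upTo-mono n (λ j j<n → le (suc j) (ℕ.s≤s j<n))))

  sum-upTo-cong : ∀ n {f g} → (∀ j → j ℕ.< n → f j ≡ g j) → sumℚ (upTo n) f ≡ sumℚ (upTo n) g
  sum-upTo-cong n eq = ℚ.≤-antisym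
    (sum-upTo-mono n (λ j j<n → ℚ.≤-reflexive (eq j j<n)))
    (sum-upTo-mono n (λ j j<n → ℚ.≤-reflexive (sym (eq j j<n))))

  sum-upTo-⊆ : ∀ {m n f} a → a ℕ.+ m ℕ.≤ n → (∀ j → 0ℚ ℚ.≤ f j) →
    sumℚ (upTo m) (λ j → f (a ℕ.+ j)) ℚ.≤ sumℚ (upTo n) f
  sum-upTo-⊆ {m} {n} {f} a le 0≤f = begin
    sumℚ (upTo m) (λ j → f (a ℕ.+ j))
      ≤⟨ subst (ℚ._≤ s + sumℚ (upTo m) (λ j → f (a ℕ.+ j))) (ℚ.+-identityˡ _)
           (ℚ.+-monoˡ-≤ (sumℚ (upTo m) (λ j → f (a ℕ.+ j))) (sum-nonNeg (upTo a) 0≤f)) ⟩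
    s + sumℚ (upTo m) (λ j → f (a ℕ.+ j))
      ≡⟨ sum-upTo-+ a m f ⟨
    sumℚ (upTo (a ℕ.+ m)) f
      ≤⟨ ≤-add {sumℚ (upTo (a ℕ.+ m)) f} (sum-nonNeg (upTo k) (λ j → 0≤f (a ℕ.+ m ℕ.+ j))) ⟩
    sumℚ (upTo (a ℕ.+ m)) f + sumℚ (upTo k) (λ j → f (a ℕ.+ m ℕ.+ j))
      ≡⟨ sum-upTo-+ (a ℕ.+ m) k f ⟨
    sumℚ (upTo (a ℕ.+ m ℕ.+ k)) f
      ≡⟨ cong (λ i → sumℚ (upTo i) f) (ℕ.m+[n∸m]≡n le) ⟩
    sumℚ (upTo n) f ∎
    where
    open ℚ.≤-Reasoning
    s = sumℚ (upTo a) f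
    k = n ℕ.∸ (a ℕ.+ m)

  sum-upTo-⊆₀ : ∀ {m n f} → m ℕ.≤ n → (∀ j → 0ℚ ℚ.≤ f j) → sumℚ (upTo m) f ℚ.≤ sumℚ (upTo n) f
  sum-upTo-⊆₀ = sum-upTo-⊆ 0

open ListSums

module Residues (p : ℕ) .{{_ : NonZero p}} where

  open +-*-Solver using (solve; _:+_; _:*_; _:-_; :-_; _:=_)

  indicator : Bool → ℚ
  indicator b = if b then 1ℚ else 0ℚ

  δ : ℤ → ℚ
  δ k = indicator (does (+ p ℤ.∣? k))

  indicator-yes : ∀ {P : Set} (d : Dec P) → P → indicator (does d) ≡ 1ℚ
  indicator-yes (yes _) h = refl
  indicator-yes (no ¬h) h = contradiction h ¬h

  indicator-no : ∀ {P : Set} (d : Dec P) → ¬ P → indicator (does d) ≡ 0ℚ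
  indicator-no (yes h) ¬h = contradiction h ¬h
  indicator-no (no _)  ¬h = refl

  0≤indicator : ∀ b → 0ℚ ℚ.≤ indicator b
  0≤indicator true  = 0≤1
  0≤indicator false = ℚ.≤-refl

  δ-yes : ∀ k → + p ℤ.∣ k → δ k ≡ 1ℚ
  δ-yes k = indicator-yes (+ p ℤ.∣? k)

  δ-no : ∀ k → ¬ + p ℤ.∣ k → δ k ≡ 0ℚ
  δ-no k = indicator-no (+ p ℤ.∣? k)

  0≤δ : ∀ k → 0ℚ ℚ.≤ δ k
  0≤δ k = 0≤indicator (does (+ p ℤ.∣? k))

  δ-cong : ∀ j k → + p ℤ.∣ j ℤ.- k → δ j ≡ δ k
  δ-cong j k h = go (+ p ℤ.∣? j)
    where
    go : Dec (+ p ℤ.∣ j) → δ j ≡ δ k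
    go (yes p∣j) = trans (δ-yes j p∣j) (sym (δ-yes k
      (subst (+ p ℤ.∣_) (Z.solve 2 (λ j k → j Z.:- (j Z.:- k) Z.:= k) refl j k) (ℤ.∣m∣n⇒∣m-n p∣j h))))
    go (no p∤j)  = trans (δ-no j p∤j) (sym (δ-no k (λ p∣k → p∤j
      (subst (+ p ℤ.∣_) (Z.solve 2 (λ j k → (j Z.:- k) Z.:+ k Z.:= j) refl j k) (ℤ.∣m∣n⇒∣m+n h p∣k)))))

  δ-neg : ∀ k → δ k ≡ δ (ℤ.- k)
  δ-neg k = go (+ p ℤ.∣? k)
    where
    go : Dec (+ p ℤ.∣ k) → δ k ≡ δ (ℤ.- k)
    go (yes p∣k) = trans (δ-yes k p∣k) (sym (δ-yes (ℤ.- k) (ℤ.∣m⇒∣-m p∣k)))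
    go (no p∤k)  = trans (δ-no k p∤k) (sym (δ-no (ℤ.- k) (λ p∣-k → p∤k (subst (+ p ℤ.∣_) (ℤ.neg-involutive k) (ℤ.∣m⇒∣-m p∣-k)))))

  δ-product : ∀ m n s → δ (m ℤ.- s) * δ (n ℤ.- s) ≡ δ (m ℤ.- s) * δ (m ℤ.- n)
  δ-product m n s = go (+ p ℤ.∣? (m ℤ.- s))
    where
    go : Dec (+ p ℤ.∣ (m ℤ.- s)) → δ (m ℤ.- s) * δ (n ℤ.- s) ≡ δ (m ℤ.- s) * δ (m ℤ.- n)
    go (no h)  = trans (cong (_* δ (n ℤ.- s)) (δ-no (m ℤ.- s) h))
      (trans (trans (ℚ.*-zeroˡ (δ (n ℤ.- s))) (sym (ℚ.*-zeroˡ (δ (m ℤ.- n))))) (cong (_* δ (m ℤ.- n)) (sym (δ-no (m ℤ.- s) h))))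
    go (yes h) = cong (δ (m ℤ.- s) *_) (trans (δ-neg (n ℤ.- s)) (δ-cong (ℤ.- (n ℤ.- s)) (m ℤ.- n)
      (subst (+ p ℤ.∣_) (Z.solve 3 (λ m n s → Z.:- (m Z.:- s) Z.:= (Z.:- (n Z.:- s)) Z.:- (m Z.:- n)) refl m n s) (ℤ.∣m⇒∣-m h))))

  residues-from-0 : ∀ k → sumℚ (upTo p) (λ j → δ (k ℤ.- + j)) ≡ 1ℚ
  residues-from-0 = ind
    where
    Φ : ℤ → ℚ
    Φ k = sumℚ (upTo p) (λ j → δ (k ℤ.- + j))
    step : ∀ n .{{_ : NonZero n}} → n ≡ p → ∀ k →
      sumℚ (upTo n) (λ j → δ (k ℤ.+ + 1 ℤ.- + j)) ≡ sumℚ (upTo n) (λ j → δ (k ℤ.- + j))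
    step (suc n) refl k = begin
      sumℚ (upTo (suc n)) (λ j → δ (k ℤ.+ + 1 ℤ.- + j))
        ≡⟨ sum-upTo-suc n (λ j → δ (k ℤ.+ + 1 ℤ.- + j)) ⟩
      δ (k ℤ.+ + 1 ℤ.- + 0) + sumℚ (upTo n) (λ j → δ (k ℤ.+ + 1 ℤ.- + suc j))
        ≡⟨ cong₂ _+_ (δ-cong (k ℤ.+ + 1 ℤ.- + 0) (k ℤ.- + n) (subst (+ p ℤ.∣_) (period k (+ n)) ℤ.∣-refl))
             (sum-cong (upTo n) (λ j → cong δ (shift k (+ j)))) ⟩
      δ (k ℤ.- + n) + sumℚ (upTo n) (λ j → δ (k ℤ.- + j))
        ≡⟨ ℚ.+-comm (δ (k ℤ.- + n)) _ ⟩
      sumℚ (upTo n) (λ j → δ (k ℤ.- + j)) + δ (k ℤ.- + n)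
        ≡⟨ sum-upTo-last n (λ j → δ (k ℤ.- + j)) ⟨
      sumℚ (upTo (suc n)) (λ j → δ (k ℤ.- + j)) ∎
      where
      open ≡-Reasoning
      period : ∀ k n → + 1 ℤ.+ n ≡ (k ℤ.+ + 1 ℤ.- + 0) ℤ.- (k ℤ.- n)
      period = Z.solve 2 (λ k n → Z.con (+ 1) Z.:+ n Z.:= (k Z.:+ Z.con (+ 1) Z.:- Z.con (+ 0)) Z.:- (k Z.:- n)) refl
      shift : ∀ k j → (k ℤ.+ + 1) ℤ.- (+ 1 ℤ.+ j) ≡ k ℤ.- j
      shift = Z.solve 2 (λ k j → (k Z.:+ Z.con (+ 1)) Z.:- (Z.con (+ 1) Z.:+ j) Z.:= k Z.:- j) refl
    base : ∀ n .{{_ : NonZero n}} → n ≡ p → sumℚ (upTo n) (λ j → δ (+ 0 ℤ.- + j)) ≡ 1ℚ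
    base (suc n) refl = begin
      sumℚ (upTo (suc n)) (λ j → δ (+ 0 ℤ.- + j))
        ≡⟨ sum-upTo-suc n (λ j → δ (+ 0 ℤ.- + j)) ⟩
      δ (+ 0) + sumℚ (upTo n) (λ j → δ (+ 0 ℤ.- + suc j))
        ≡⟨ cong₂ _+_ (δ-yes (+ 0) (ℤ.divides (+ 0) refl)) (sum-upTo-cong n (λ j j<n → δ-no (+ 0 ℤ.- + suc j) (λ h →
             ℕ.>⇒∤ (ℕ.s≤s j<n) (ℤ.∣⇒∣ᵤ h)))) ⟩
      1ℚ + sumℚ (upTo n) (λ _ → 0ℚ)
        ≡⟨ cong (λ z → 1ℚ + z) (sum-0 (upTo n)) ⟩
      1ℚ ∎
      where open ≡-Reasoning
    ind : ∀ k → Φ k ≡ 1ℚ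
    ind (+ zero)           = base p refl
    ind (+ suc n)          = trans (cong Φ (cong +_ (ℕ.+-comm 1 n))) (trans (step p refl (+ n)) (ind (+ n)))
    ind ℤ.-[1+ zero ]      = trans (sym (step p refl ℤ.-[1+ 0 ])) (ind (+ 0))
    ind ℤ.-[1+ suc n ]     = trans (sym (step p refl ℤ.-[1+ suc n ])) (ind ℤ.-[1+ n ])

  residues : ∀ k s → sumℚ (upTo p) (λ j → δ (k ℤ.- (s ℤ.+ + j))) ≡ 1ℚ
  residues k s = trans (sum-cong (upTo p) (λ j → cong δ
      (Z.solve 3 (λ k s j → k Z.:- (s Z.:+ j) Z.:= (k Z.:- s) Z.:- j) refl k s (+ j))))
    (residues-from-0 (k ℤ.- s))

  count : List ℤ → ℤ → ℚ
  count ws s = sumℚ ws (λ w → δ (w ℤ.- s))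

  energy : List ℤ → ℚ
  energy ws = sumℚ ws (λ u → sumℚ ws (λ v → δ (u ℤ.- v)))

  ∑-count : ∀ ws s → sumℚ (upTo p) (λ j → count ws (s ℤ.+ + j)) ≡ ι (length ws)
  ∑-count ws s = begin
    sumℚ (upTo p) (λ j → count ws (s ℤ.+ + j))
      ≡⟨ sum-swap (upTo p) ws (λ j w → δ (w ℤ.- (s ℤ.+ + j))) ⟩
    sumℚ ws (λ w → sumℚ (upTo p) (λ j → δ (w ℤ.- (s ℤ.+ + j))))
      ≡⟨ sum-cong ws (λ w → residues w s) ⟩
    sumℚ ws (λ _ → 1ℚ)
      ≡⟨ trans (sum-const ws 1ℚ) (ℚ.*-identityʳ (ι (length ws))) ⟩
    ι (length ws) ∎
    where open ≡-Reasoning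

  ∑-count² : ∀ ws s → sumℚ (upTo p) (λ j → count ws (s ℤ.+ + j) * count ws (s ℤ.+ + j)) ≡ energy ws
  ∑-count² ws s = begin
    sumℚ (upTo p) (λ j → count ws (s ℤ.+ + j) * count ws (s ℤ.+ + j))
      ≡⟨ sum-cong (upTo p) (λ j → trans
           (sym (sum-product ws ws (λ u → δ (u ℤ.- (s ℤ.+ + j))) (λ v → δ (v ℤ.- (s ℤ.+ + j)))))
           (sum-cong ws (λ u → sum-cong ws (λ v → δ-product u v (s ℤ.+ + j))))) ⟩
    sumℚ (upTo p) (λ j → sumℚ ws (λ u → sumℚ ws (λ v → δ (u ℤ.- (s ℤ.+ + j)) * δ (u ℤ.- v))))
      ≡⟨ sum-swap (upTo p) ws (λ j u → sumℚ ws (λ v → δ (u ℤ.- (s ℤ.+ + j)) * δ (u ℤ.- v))) ⟩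
    sumℚ ws (λ u → sumℚ (upTo p) (λ j → sumℚ ws (λ v → δ (u ℤ.- (s ℤ.+ + j)) * δ (u ℤ.- v))))
      ≡⟨ sum-cong ws (λ u → trans (sum-product (upTo p) ws (λ j → δ (u ℤ.- (s ℤ.+ + j))) (λ v → δ (u ℤ.- v)))
           (trans (cong (_* sumℚ ws (λ v → δ (u ℤ.- v))) (residues u s)) (ℚ.*-identityˡ (sumℚ ws (λ v → δ (u ℤ.- v)))))) ⟩
    energy ws ∎
    where open ≡-Reasoning

  variance : ∀ ws s →
    let n = ι (length ws); deviation = λ j → ι p * count ws (s ℤ.+ + j) - n in
    sumℚ (upTo p) (λ j → deviation j * deviation j) ≡ ι p * (ι p * energy ws - n * n)
  variance ws s = begin
    sumℚ (upTo p) (λ j → (P * c j - n) * (P * c j - n))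
      ≡⟨ sum-cong (upTo p) (λ j → expand (c j)) ⟩
    sumℚ (upTo p) (λ j → P * P * (c j * c j) + (- (n + n) * P * c j + n * n))
      ≡⟨ sum-+ (upTo p) (λ j → P * P * (c j * c j)) (λ j → - (n + n) * P * c j + n * n) ⟩
    sumℚ (upTo p) (λ j → P * P * (c j * c j)) + sumℚ (upTo p) (λ j → - (n + n) * P * c j + n * n)
      ≡⟨ cong₂ _+_ (trans (sum-*ˡ (upTo p) (P * P) (λ j → c j * c j)) (cong (P * P *_) (∑-count² ws s)))
           (trans (sum-+ (upTo p) (λ j → - (n + n) * P * c j) (λ _ → n * n)) (cong₂ _+_
             (trans (sum-*ˡ (upTo p) (- (n + n) * P) c) (cong (- (n + n) * P *_) (∑-count ws s)))
             (trans (sum-const (upTo p) (n * n)) (cong (λ k → ι k * (n * n)) (List.length-upTo p))))) ⟩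
    P * P * energy ws + (- (n + n) * P * n + P * (n * n))
      ≡⟨ solve 3 (λ P e n → P :* P :* e :+ (:- (n :+ n) :* P :* n :+ P :* (n :* n)) := P :* (P :* e :- n :* n)) refl P (energy ws) n ⟩
    P * (P * energy ws - n * n) ∎
    where
    open ≡-Reasoning
    P = ι p
    n = ι (length ws)
    c : ℕ → ℚ
    c j = count ws (s ℤ.+ + j)
    expand : ∀ c → (P * c - n) * (P * c - n) ≡ P * P * (c * c) + (- (n + n) * P * c + n * n)
    expand = solve 3 (λ P n c → (P :* c :- n) :* (P :* c :- n) := P :* P :* (c :* c) :+ (:- (n :+ n) :* P :* c :+ n :* n)) refl P n

natural-between : ∀ {r} → 1ℚ ℚ.≤ r → Σ ℕ λ h → NonZero h × r ℚ.≤ ι h × ι h ℚ.≤ r + r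
natural-between {r} 1≤r with search ℤ.∣ ℚ.↥ r ∣ (archimedean r)
  where
  search : ∀ n → r ℚ.≤ ι n → Σ ℕ λ h → r ℚ.≤ ι h × ι h ℚ.≤ r + r
  search zero    r≤ = contradiction (ℚ.≤-trans 1≤r r≤) (λ 1≤0 → ℚ.<-irrefl {0ℚ} {0ℚ} refl (ℚ.<-≤-trans {0ℚ} {1ℚ} {0ℚ} 0<1 1≤0))
  search (suc n) r≤ with r ℚ.≤? ι n
  ... | yes r≤n = search n r≤n
  ... | no r≰n  = suc n , r≤ , subst (ℚ._≤ r + r) (sym (ι-suc n)) (ℚ.+-mono-≤ 1≤r (ℚ.<⇒≤ (ℚ.≰⇒> r≰n)))
... | suc h , r≤ , ≤2r = suc h , _ , r≤ , ≤2r
... | zero  , r≤ , _   = contradiction (ℚ.≤-trans 1≤r r≤) (λ 1≤0 → ℚ.<-irrefl {0ℚ} {0ℚ} refl (ℚ.<-≤-trans {0ℚ} {1ℚ} {0ℚ} 0<1 1≤0))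

≤-root-mean-square : ∀ h .{{_ : NonZero h}} {A B} (a : ℕ → ℚ) → 0ℚ ℚ.≤ B → (∀ j → j ℕ.< h → A ℚ.≤ a j) →
  sumℚ (upTo h) (λ j → a j * a j) ℚ.≤ ι h * (B * B) → A ℚ.≤ B
≤-root-mean-square h {A} {B} a 0≤B A≤ mean with ℚ.≤-total A 0ℚ
... | inj₁ A≤0 = ℚ.≤-trans A≤0 0≤B
... | inj₂ 0≤A = ²-cancel-≤ {A} {B} 0≤B (*-cancel-≤ {ι h} {A * A} {B * B} (0<ι h) (ℚ.≤-trans
  (ℚ.≤-trans (ℚ.≤-reflexive (sym (trans (sum-const (upTo h) (A * A)) (cong (λ k → ι k * (A * A)) (List.length-upTo h)))))
    (sum-upTo-mono h (λ j j<h → *-mono {A} {a j} {A} {a j} 0≤A 0≤A (A≤ j j<h) (A≤ j j<h))))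
  mean))

module Windows (p : ℕ) .{{_ : NonZero p}} (xs : List ℤ) where

  open +-*-Solver using (solve; _:+_; _:*_; _:-_; :-_; con; _:=_)
  open Residues p

  N P : ℚ
  N = ι (length xs)
  P = ι p

  0≤N : 0ℚ ℚ.≤ N
  0≤N = 0≤ι (length xs)

  0<P : 0ℚ ℚ.< P
  0<P = 0<ι p

  hits : ℤ → ℕ → ℚ
  hits s t = sumℚ xs (λ x → sumℚ (upTo t) (λ j → δ (x ℤ.- (s ℤ.+ + suc j))))

  positives : ℕ → List ℤ
  positives t = map (λ j → + suc j) (upTo t)

  differences : ℕ → List ℤ
  differences t = cartesianProductWith ℤ._-_ xs (positives t)

  count-differences : ∀ s t → count (differences t) s ≡ hits s t
  count-differences s t = trans (sum-cartesian ℤ._-_ xs (positives t) (λ w → δ (w ℤ.- s)))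
    (sum-cong xs (λ x → trans (sum-map (upTo t) (λ j → + suc j) (λ y → δ (x ℤ.- y ℤ.- s)))
      (sum-cong (upTo t) (λ j → cong δ
        (Z.solve 3 (λ x y s → x Z.:- y Z.:- s Z.:= x Z.:- (s Z.:+ y)) refl x (+ suc j) s)))))

  length-differences : ∀ t → ι (length (differences t)) ≡ N * ι t
  length-differences t = begin
    ι (length (differences t))
      ≡⟨ sum-1 (differences t) ⟨
    sumℚ (differences t) (λ _ → 1ℚ)
      ≡⟨ sum-cartesian ℤ._-_ xs (positives t) (λ _ → 1ℚ) ⟩
    sumℚ xs (λ _ → sumℚ (positives t) (λ _ → 1ℚ))
      ≡⟨ trans (sum-cong xs (λ _ → sum-1 (positives t))) (sum-const xs (ι (length (positives t)))) ⟩
    N * ι (length (positives t))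
      ≡⟨ cong (λ k → N * ι k) (trans (List.length-map (λ j → + suc j) (upTo t)) (List.length-upTo t)) ⟩
    N * ι t ∎
    where
    open ≡-Reasoning
    sum-1 : ∀ {A : Set} (l : List A) → sumℚ l (λ _ → 1ℚ) ≡ ι (length l)
    sum-1 l = trans (sum-const l 1ℚ) (ℚ.*-identityʳ (ι (length l)))

  hits-mono : ∀ {s s′ t t′} a → s ℤ.+ + a ≡ s′ → a ℕ.+ t′ ℕ.≤ t → hits s′ t′ ℚ.≤ hits s t
  hits-mono {s} {s′} {t} {t′} a refl le = sum-mono xs (λ x → ℚ.≤-trans
    (ℚ.≤-reflexive (sum-cong (upTo t′) (λ j → cong δ (cong (λ z → x ℤ.- z)
      (trans (ℤ.+-assoc s (+ a) (+ suc j)) (cong (λ i → s ℤ.+ + i) (ℕ.+-suc a j)))))))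
    (sum-upTo-⊆ {t′} {t} {λ j → δ (x ℤ.- (s ℤ.+ + suc j))} a le (λ j → 0≤δ (x ℤ.- (s ℤ.+ + suc j)))))

  0≤hits : ∀ s t → 0ℚ ℚ.≤ hits s t
  0≤hits s t = sum-nonNeg xs (λ x → sum-nonNeg (upTo t) (λ j → 0≤δ (x ℤ.- (s ℤ.+ + suc j))))

  window-≤1 : ∀ s t k → t ℕ.≤ p → sumℚ (upTo t) (λ j → δ (k ℤ.- (s ℤ.+ + suc j))) ℚ.≤ 1ℚ
  window-≤1 s t k t≤p = ℚ.≤-trans
    (sum-upTo-⊆₀ {t} {p} {λ j → δ (k ℤ.- (s ℤ.+ + suc j))} t≤p (λ j → 0≤δ (k ℤ.- (s ℤ.+ + suc j))))
    (ℚ.≤-reflexive (trans (sum-cong (upTo p) (λ j → cong δ (cong (λ z → k ℤ.- z) (sym (ℤ.+-assoc s (+ 1) (+ j))))))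
      (residues k (s ℤ.+ + 1))))

  hits-≤ : ∀ s t → t ℕ.≤ p → hits s t ℚ.≤ N
  hits-≤ s t t≤p = ℚ.≤-trans (sum-mono xs (λ x → window-≤1 s t x t≤p))
    (ℚ.≤-reflexive (trans (sum-const xs 1ℚ) (ℚ.*-identityʳ N)))

  energy-positives : ∀ t → t ℕ.≤ p → energy (positives t) ℚ.≤ ι t
  energy-positives t t≤p = ℚ.≤-trans
    (sum-mono (positives t) (λ y → ℚ.≤-trans
      (ℚ.≤-reflexive (trans (sum-map (upTo t) (λ j → + suc j) (λ z → δ (y ℤ.- z)))
        (sum-cong (upTo t) (λ j → cong δ (cong (λ z → y ℤ.- z) (sym (ℤ.+-identityˡ (+ suc j))))))))
      (window-≤1 (+ 0) t y t≤p)))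
    (ℚ.≤-reflexive (trans (sum-const (positives t) 1ℚ) (trans (ℚ.*-identityʳ (ι (length (positives t))))
      (cong ι (trans (List.length-map (λ j → + suc j) (upTo t)) (List.length-upTo t))))))

  deviation : ℤ → ℕ → ℚ
  deviation s t = P * hits s t - N * ι t

  EnergyBound : ℚ → Set
  EnergyBound D = ∀ t → t ℕ.≤ p →
    P * energy (differences t) ℚ.≤ (N * ι t) * (N * ι t) + (N * N * (D * D)) * (P * ι t)

  module _ {D : ℚ} (bound : EnergyBound D) where

    deviation-variance : ∀ s t → t ℕ.≤ p →
      sumℚ (upTo p) (λ j → deviation (s ℤ.+ + j) t * deviation (s ℤ.+ + j) t) ℚ.≤ (P * N) * (P * N) * (D * D * ι t)
    deviation-variance s t t≤p = begin
      sumℚ (upTo p) (λ j → deviation (s ℤ.+ + j) t * deviation (s ℤ.+ + j) t)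
        ≡⟨ sum-cong (upTo p) (λ j → cong (λ z → z * z) (cong₂ (λ c n → P * c - n)
             (sym (count-differences (s ℤ.+ + j) t)) (sym (length-differences t)))) ⟩
      sumℚ (upTo p) (λ j → (P * count ws (s ℤ.+ + j) - n) * (P * count ws (s ℤ.+ + j) - n))
        ≡⟨ variance ws s ⟩
      P * (P * energy ws - n * n)
        ≡⟨ cong (λ m → P * (P * energy ws - m * m)) (length-differences t) ⟩
      P * (P * energy ws - N * ι t * (N * ι t))
        ≤⟨ *-monoˡ {P} (ℚ.<⇒≤ 0<P) (ℚ.+-monoˡ-≤ (- (N * ι t * (N * ι t))) (bound t t≤p)) ⟩
      P * (N * ι t * (N * ι t) + (N * N * (D * D)) * (P * ι t) - N * ι t * (N * ι t))
        ≡⟨ solve 4 (λ P N t D → P :* (N :* t :* (N :* t) :+ (N :* N :* (D :* D)) :* (P :* t) :- N :* t :* (N :* t))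
             := (P :* N) :* (P :* N) :* (D :* D :* t)) refl P N (ι t) D ⟩
      (P * N) * (P * N) * (D * D * ι t) ∎
      where
      open ℚ.≤-Reasoning
      ws = differences t
      n = ι (length ws)

    module _ (0≤D : 0ℚ ℚ.≤ D) {x : ℚ} (0≤x : 0ℚ ℚ.≤ x) (s : ℤ) (t : ℕ) (t≤p : t ℕ.≤ p)
      (x-large : D * D * ι t ℚ.≤ P * (x * (x * x))) where

      0≤PN : 0ℚ ℚ.≤ P * N
      0≤PN = 0≤* {P} {N} (ℚ.<⇒≤ 0<P) 0≤N

      target : ℚ
      target = P * N * (x + x + x + D)

      small-shift : P * x ℚ.≤ 1ℚ → ∣ deviation s t ∣ℚ ℚ.≤ target
      small-shift Px≤1 = ℚ.≤-trans
        (²-cancel-≤ {∣ d ∣ℚ} {P * N * x} (0≤* {P * N} 0≤PN 0≤x) square)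
        (*-monoˡ {P * N} 0≤PN (0≤⇒≤ {x} (x + x + D) (0≤+ {x + x} {D} (0≤+ {x} {x} 0≤x 0≤x) 0≤D)
          (solve 2 (λ x D → x :+ x :+ x :+ D := x :+ (x :+ x :+ D)) refl x D)))
        where
        d = deviation s t
        one-term : d * d ℚ.≤ sumℚ (upTo p) (λ j → deviation (s ℤ.+ + j) t * deviation (s ℤ.+ + j) t)
        one-term = ℚ.≤-trans (ℚ.≤-reflexive (trans (cong (λ z → deviation z t * deviation z t) (sym (ℤ.+-identityʳ s)))
            (sym (ℚ.+-identityʳ _))))
          (sum-upTo-⊆₀ {1} {p} {λ j → deviation (s ℤ.+ + j) t * deviation (s ℤ.+ + j) t}
            (ℕ.>-nonZero⁻¹ p) (λ j → 0≤² (deviation (s ℤ.+ + j) t)))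
        square : ∣ d ∣ℚ * ∣ d ∣ℚ ℚ.≤ P * N * x * (P * N * x)
        square = begin
          ∣ d ∣ℚ * ∣ d ∣ℚ           ≡⟨ trans (sym (ℚ.∣p*q∣≡∣p∣*∣q∣ d d)) (ℚ.0≤p⇒∣p∣≡p (0≤² d)) ⟩
          d * d                     ≤⟨ one-term ⟩
          _                         ≤⟨ deviation-variance s t t≤p ⟩
          (P * N) * (P * N) * (D * D * ι t) ≤⟨ *-monoˡ {(P * N) * (P * N)} (0≤² (P * N)) x-large ⟩
          (P * N) * (P * N) * (P * (x * (x * x)))
            ≡⟨ solve 3 (λ P N x → (P :* N) :* (P :* N) :* (P :* (x :* (x :* x))) := (P :* N) :* (P :* N) :* (x :* x) :* (P :* x)) refl P N x ⟩
          (P * N) * (P * N) * (x * x) * (P * x)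
            ≤⟨ *-monoˡ {(P * N) * (P * N) * (x * x)} (0≤* {(P * N) * (P * N)} (0≤² (P * N)) (0≤² x)) Px≤1 ⟩
          (P * N) * (P * N) * (x * x) * 1ℚ
            ≡⟨ solve 3 (λ P N x → (P :* N) :* (P :* N) :* (x :* x) :* con 1ℚ := P :* N :* x :* (P :* N :* x)) refl P N x ⟩
          P * N * x * (P * N * x)   ∎
          where open ℚ.≤-Reasoning

      module LongShift (h : ℕ) .{{_ : NonZero h}} (Px≤h : P * x ℚ.≤ ι h) (h≤2Px : ι h ℚ.≤ P * x + P * x) where

        Nh≤ : N * ι h ℚ.≤ target
        Nh≤ = ℚ.≤-trans (*-monoˡ {N} 0≤N h≤2Px)
          (0≤⇒≤ {N * (P * x + P * x)} {target} (P * N * (x + D)) (0≤* {P * N} 0≤PN (0≤+ {x} {D} 0≤x 0≤D))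
            (solve 4 (λ P N x D → P :* N :* (x :+ x :+ x :+ D) := N :* (P :* x :+ P :* x) :+ P :* N :* (x :+ D)) refl P N x D))

        -- If t′ ≤ t + h then D²t′ ≤ h (x + D)², because D²t ≤ P x³ ≤ h x².
        mean-square : ∀ s′ t′ → h ℕ.≤ p → t′ ℕ.≤ p → t′ ℕ.≤ t ℕ.+ h →
          sumℚ (upTo h) (λ j → deviation (s′ ℤ.+ + j) t′ * deviation (s′ ℤ.+ + j) t′)
            ℚ.≤ ι h * (P * N * (x + D) * (P * N * (x + D)))
        mean-square s′ t′ h≤p t′≤p t′≤t+h = begin
          sumℚ (upTo h) square
            ≤⟨ sum-upTo-⊆₀ {h} {p} {square} h≤p (λ j → 0≤² (deviation (s′ ℤ.+ + j) t′)) ⟩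
          sumℚ (upTo p) square
            ≤⟨ deviation-variance s′ t′ t′≤p ⟩
          (P * N) * (P * N) * (D * D * ι t′)
            ≤⟨ *-monoˡ {(P * N) * (P * N)} (0≤² (P * N)) short ⟩
          (P * N) * (P * N) * (ι h * ((x + D) * (x + D)))
            ≡⟨ solve 3 (λ a h y → a :* a :* (h :* (y :* y)) := h :* (a :* y :* (a :* y))) refl (P * N) (ι h) (x + D) ⟩
          ι h * (P * N * (x + D) * (P * N * (x + D))) ∎
          where
          open ℚ.≤-Reasoning
          square : ℕ → ℚ
          square j = deviation (s′ ℤ.+ + j) t′ * deviation (s′ ℤ.+ + j) t′
          short : D * D * ι t′ ℚ.≤ ι h * ((x + D) * (x + D))
          short = begin
            D * D * ι t′                             ≤⟨ *-monoˡ {D * D} (0≤² D) (ι-mono t′≤t+h) ⟩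
            D * D * ι (t ℕ.+ h)                      ≡⟨ cong (D * D *_) (ι-+ t h) ⟩
            D * D * (ι t + ι h)                      ≡⟨ ℚ.*-distribˡ-+ (D * D) (ι t) (ι h) ⟩
            D * D * ι t + D * D * ι h                ≤⟨ ℚ.+-monoˡ-≤ (D * D * ι h) x-large ⟩
            P * (x * (x * x)) + D * D * ι h          ≡⟨ cong (_+ D * D * ι h) (ℚ.*-assoc P x (x * x)) ⟨
            P * x * (x * x) + D * D * ι h            ≤⟨ ℚ.+-monoˡ-≤ (D * D * ι h) (*-monoʳ {x * x} (0≤² x) Px≤h) ⟩
            ι h * (x * x) + D * D * ι h              ≤⟨ ≤-add {ι h * (x * x) + D * D * ι h} (0≤* {ι h} (0≤ι h) (0≤* {x + x} {D} (0≤+ {x} {x} 0≤x 0≤x) 0≤D)) ⟩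
            ι h * (x * x) + D * D * ι h + ι h * ((x + x) * D)
              ≡⟨ solve 3 (λ h x D → h :* (x :* x) :+ D :* D :* h :+ h :* ((x :+ x) :* D) := h :* ((x :+ D) :* (x :+ D))) refl (ι h) x D ⟩
            ι h * ((x + D) * (x + D))                ∎

        assemble : ∀ A → A ℚ.≤ P * N * (x + D) → A + N * ι h ℚ.≤ target
        assemble A A≤ = ℚ.≤-trans (ℚ.+-mono-≤ A≤ (*-monoˡ {N} 0≤N h≤2Px))
          (ℚ.≤-reflexive (solve 4 (λ P N x D → P :* N :* (x :+ D) :+ N :* (P :* x :+ P :* x) := P :* N :* (x :+ x :+ x :+ D)) refl P N x D))

        0≤PN[x+D] : 0ℚ ℚ.≤ P * N * (x + D)
        0≤PN[x+D] = 0≤* {P * N} 0≤PN (0≤+ {x} {D} 0≤x 0≤D)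

        upper : deviation s t ℚ.≤ target
        upper with t ℕ.+ h ℕ.≤? p
        ... | no t+h≰p = ℚ.≤-trans (begin
            P * hits s t - N * ι t           ≤⟨ ℚ.+-monoˡ-≤ (- (N * ι t)) (*-monoˡ {P} (ℚ.<⇒≤ 0<P) (hits-≤ s t t≤p)) ⟩
            P * N - N * ι t                  ≤⟨ ℚ.+-monoˡ-≤ (- (N * ι t)) (*-monoʳ {N} 0≤N (ι-mono (ℕ.<⇒≤ (ℕ.≰⇒> t+h≰p)))) ⟩
            ι (t ℕ.+ h) * N - N * ι t        ≡⟨ cong (λ z → z * N - N * ι t) (ι-+ t h) ⟩
            (ι t + ι h) * N - N * ι t        ≡⟨ solve 3 (λ t h N → (t :+ h) :* N :- N :* t := N :* h) refl (ι t) (ι h) N ⟩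
            N * ι h                          ∎) Nh≤
          where open ℚ.≤-Reasoning
        ... | yes t+h≤p = subst (ℚ._≤ target) split
            (assemble (P * hits s t - N * ι (t ℕ.+ h)) (≤-root-mean-square h
              (λ j → deviation (s′ ℤ.+ + j) (t ℕ.+ h)) 0≤PN[x+D]
              (λ j j<h → ℚ.+-monoˡ-≤ (- (N * ι (t ℕ.+ h))) (*-monoˡ {P} (ℚ.<⇒≤ 0<P)
                (hits-mono {s′ ℤ.+ + j} {s} (h ℕ.∸ j) (back j (ℕ.<⇒≤ j<h))
                  (subst (ℕ._≤ t ℕ.+ h) (ℕ.+-comm t (h ℕ.∸ j)) (ℕ.+-monoʳ-≤ t (ℕ.m∸n≤m h j))))))
              (mean-square s′ (t ℕ.+ h) (ℕ.m+n≤o⇒n≤o t t+h≤p) t+h≤p ℕ.≤-refl)))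
          where
          s′ : ℤ
          s′ = s ℤ.- + h
          back : ∀ j → j ℕ.≤ h → s′ ℤ.+ + j ℤ.+ + (h ℕ.∸ j) ≡ s
          back j j≤h = trans (cong (λ z → s′ ℤ.+ + j ℤ.+ z) (trans (sym (ℤ.⊖-≥ j≤h)) (sym (ℤ.m-n≡m⊖n h j))))
            (Z.solve 3 (λ s h j → s Z.:- h Z.:+ j Z.:+ (h Z.:- j) Z.:= s) refl s (+ h) (+ j))
          split : P * hits s t - N * ι (t ℕ.+ h) + N * ι h ≡ deviation s t
          split = trans (cong (λ z → P * hits s t - N * z + N * ι h) (ι-+ t h))
            (solve 4 (λ a N t h → a :- N :* (t :+ h) :+ N :* h := a :- N :* t) refl (P * hits s t) N (ι t) (ι h))

        lower : - deviation s t ℚ.≤ target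
        lower with h ℕ.≤? t
        ... | no h≰t = ℚ.≤-trans (begin
            - (P * hits s t - N * ι t)       ≡⟨ solve 2 (λ a b → :- (a :- b) := b :- a) refl (P * hits s t) (N * ι t) ⟩
            N * ι t - P * hits s t           ≤⟨ ℚ.+-monoʳ-≤ (N * ι t) (ℚ.neg-antimono-≤ (0≤* {P} (ℚ.<⇒≤ 0<P) (0≤hits s t))) ⟩
            N * ι t - 0ℚ                     ≡⟨ ℚ.+-identityʳ (N * ι t) ⟩
            N * ι t                          ≤⟨ *-monoˡ {N} 0≤N (ι-mono (ℕ.<⇒≤ (ℕ.≰⇒> h≰t))) ⟩
            N * ι h                          ∎) Nh≤
          where open ℚ.≤-Reasoning
        ... | yes h≤t = subst (ℚ._≤ target) split
            (assemble (- (P * hits s t - N * ι t′)) (≤-root-mean-square h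
              (λ j → - deviation (s ℤ.+ + j) t′) 0≤PN[x+D]
              (λ j j<h → ℚ.neg-antimono-≤ (ℚ.+-monoˡ-≤ (- (N * ι t′)) (*-monoˡ {P} (ℚ.<⇒≤ 0<P)
                (hits-mono {s} {s ℤ.+ + j} j refl
                  (ℕ.≤-trans (ℕ.+-monoˡ-≤ t′ (ℕ.<⇒≤ j<h)) (ℕ.≤-reflexive (ℕ.m+[n∸m]≡n h≤t)))))))
              (ℚ.≤-trans (ℚ.≤-reflexive (sum-cong (upTo h) (λ j →
                  solve 1 (λ d → :- d :* :- d := d :* d) refl (deviation (s ℤ.+ + j) t′))))
                (mean-square s t′ (ℕ.≤-trans h≤t t≤p) (ℕ.≤-trans (ℕ.m∸n≤m t h) t≤p)
                  (ℕ.≤-trans (ℕ.m∸n≤m t h) (ℕ.m≤m+n t h))))))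
          where
          t′ : ℕ
          t′ = t ℕ.∸ h
          split : - (P * hits s t - N * ι t′) + N * ι h ≡ - deviation s t
          split = trans
            (solve 4 (λ a N t h → :- (a :- N :* t) :+ N :* h := :- (a :- N :* (h :+ t))) refl (P * hits s t) N (ι t′) (ι h))
            (cong (λ z → - (P * hits s t - N * z)) (trans (sym (ι-+ h t′)) (cong ι (ℕ.m+[n∸m]≡n h≤t))))

      deviation-bound : ∣ deviation s t ∣ℚ ℚ.≤ target
      deviation-bound with ℚ.≤-total (P * x) 1ℚ
      ... | inj₁ Px≤1 = small-shift Px≤1
      ... | inj₂ 1≤Px with natural-between {P * x} 1≤Px
      ... | h , nz , Px≤h , h≤2Px = ∣∣≤ {deviation s t} upper lower
        where open LongShift h {{nz}} Px≤h h≤2Px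

module RealAlgebra where

  open +-*-Solver using (solve; _:+_; _:-_; _:=_)

  infixl 6 _⊕_ _⊖_
  infixl 7 _⊗_

  -- Formal sums and products of reals: unlike those of _+ℝ_ and _*ℝ_, their arguments can be inferred.
  data Expr : Set where
    real : ℝ → Expr
    _⊕_ _⊖_ _⊗_ : Expr → Expr → Expr

  value : Expr → ℕ → ℚ
  value (real x) n = seq x n
  value (x ⊕ y) n  = value x n + value y n
  value (x ⊖ y) n  = value x n - value y n
  value (x ⊗ y) n  = value x n * value y n

  value-cauchy : ∀ x → IsCauchy (value x)
  value-cauchy (real x) = cauchy x
  value-cauchy (x ⊕ y)  = +-cauchy (value x) (value y) (value-cauchy x) (value-cauchy y)
  value-cauchy (x ⊖ y)  = +-cauchy (value x) (λ n → - value y n) (value-cauchy x) (neg-cauchy (value y) (value-cauchy y))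
  value-cauchy (x ⊗ y)  = *-cauchy (value x) (value y) (value-cauchy x) (value-cauchy y)

  const : ℚ → Expr
  const q = real (fromℚ q)

  0ᴱ 1ᴱ : Expr
  0ᴱ = const 0ℚ
  1ᴱ = const 1ℚ

  realPart imagPart : ℂ → Expr
  realPart z = real (ℂ.re z)
  imagPart z = real (ℂ.im z)

  infix 4 _≈_

  record _≈_ (x y : Expr) : Set where
    constructor mk≈
    field
      close : ∀ ε → 0ℚ ℚ.< ε → Σ ℕ λ N → ∀ n → N ℕ.≤ n → ∣ value x n - value y n ∣ℚ ℚ.≤ ε
  open _≈_ public

  infix 4 _≗ᴱ_

  _≗ᴱ_ : Expr → Expr → Set
  x ≗ᴱ y = ∀ n → value x n ≡ value y n

  ≗⇒≈ : ∀ {x y} → x ≗ᴱ y → x ≈ y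
  ≗⇒≈ {x} {y} eq = mk≈ λ ε 0<ε → 0 , λ n _ → subst (λ z → ∣ z ∣ℚ ℚ.≤ ε)
    (sym (trans (cong (_- value y n) (eq n)) (ℚ.+-inverseʳ (value y n)))) (ℚ.<⇒≤ 0<ε)

  ≈-refl : ∀ {x} → x ≈ x
  ≈-refl {x} = ≗⇒≈ {x} {x} (λ _ → refl)

  ≡⇒≈ : ∀ {A : Set} (f : A → Expr) {x y} → x ≡ y → f x ≈ f y
  ≡⇒≈ f refl = ≈-refl

  ≈-sym : ∀ {x y} → x ≈ y → y ≈ x
  ≈-sym {x} {y} h = mk≈ λ ε 0<ε → proj₁ (close h ε 0<ε) , λ n n≥ →
    subst (ℚ._≤ ε) (∣-∣-comm (value x n) (value y n)) (proj₂ (close h ε 0<ε) n n≥)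

  private
    both : ∀ {P Q : ℕ → Set} → (Σ ℕ λ N → ∀ n → N ℕ.≤ n → P n) → (Σ ℕ λ N → ∀ n → N ℕ.≤ n → Q n) →
      Σ ℕ λ N → ∀ n → N ℕ.≤ n → P n × Q n
    both (M , f) (N , g) = M ℕ.⊔ N , λ n n≥ → f n (ℕ.m⊔n≤o⇒m≤o M N n≥) , g n (ℕ.m⊔n≤o⇒n≤o M N n≥)

  ≈-trans : ∀ {x y z} → x ≈ y → y ≈ z → x ≈ z
  ≈-trans {x} {y} {z} h k = mk≈ λ ε 0<ε →
    let N , f = both (close h (½ * ε) (0<½* {ε} 0<ε)) (close k (½ * ε) (0<½* {ε} 0<ε))
    in N , λ n n≥ → ℚ.≤-trans (triangle (value x n) (value y n) (value z n))
      (ℚ.≤-trans (ℚ.+-mono-≤ (proj₁ (f n n≥)) (proj₂ (f n n≥))) (ℚ.≤-reflexive (halves ε)))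

  +-cong : ∀ {x x′ y y′} → x ≈ x′ → y ≈ y′ → x ⊕ y ≈ x′ ⊕ y′
  +-cong {x} {x′} {y} {y′} h k = mk≈ λ ε 0<ε →
    let N , f = both (close h (½ * ε) (0<½* {ε} 0<ε)) (close k (½ * ε) (0<½* {ε} 0<ε))
    in N , λ n n≥ → subst (λ z → ∣ z ∣ℚ ℚ.≤ ε) (interchange (value x n) (value x′ n) (value y n) (value y′ n))
      (ℚ.≤-trans (ℚ.∣p+q∣≤∣p∣+∣q∣ (value x n - value x′ n) (value y n - value y′ n))
        (ℚ.≤-trans (ℚ.+-mono-≤ (proj₁ (f n n≥)) (proj₂ (f n n≥))) (ℚ.≤-reflexive (halves ε))))
    where
    interchange : ∀ a a′ b b′ → (a - a′) + (b - b′) ≡ (a + b) - (a′ + b′)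
    interchange = solve 4 (λ a a′ b b′ → (a :- a′) :+ (b :- b′) := (a :+ b) :- (a′ :+ b′)) refl

  -‿cong : ∀ {x x′ y y′} → x ≈ x′ → y ≈ y′ → x ⊖ y ≈ x′ ⊖ y′
  -‿cong {x} {x′} {y} {y′} h k = mk≈ λ ε 0<ε →
    let N , f = both (close h (½ * ε) (0<½* {ε} 0<ε)) (close (≈-sym k) (½ * ε) (0<½* {ε} 0<ε))
    in N , λ n n≥ → subst (λ z → ∣ z ∣ℚ ℚ.≤ ε) (interchange (value x n) (value x′ n) (value y n) (value y′ n))
      (ℚ.≤-trans (ℚ.∣p+q∣≤∣p∣+∣q∣ (value x n - value x′ n) (value y′ n - value y n))
        (ℚ.≤-trans (ℚ.+-mono-≤ (proj₁ (f n n≥)) (proj₂ (f n n≥))) (ℚ.≤-reflexive (halves ε))))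
    where
    interchange : ∀ a a′ b b′ → (a - a′) + (b′ - b) ≡ (a - b) - (a′ - b′)
    interchange = solve 4 (λ a a′ b b′ → (a :- a′) :+ (b′ :- b) := (a :- b) :- (a′ :- b′)) refl

  *-cong : ∀ {x x′ y y′} → x ≈ x′ → y ≈ y′ → x ⊗ y ≈ x′ ⊗ y′
  *-cong {x} {x′} {y} {y′} h k = mk≈ λ ε 0<ε →
    let K , 0<K , bx = eventually-bounded (value x) (value-cauchy x)
        L , 0<L , by = eventually-bounded (value y′) (value-cauchy y′)
        d , 0<d , Kd = scale-down {K} {½ * ε} 0<K (0<½* {ε} 0<ε)
        e , 0<e , Le = scale-down {L} {½ * ε} 0<L (0<½* {ε} 0<ε)
        N , f = both (both bx by) (both (close k d 0<d) (close h e 0<e))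
    in N , λ n n≥ → subst (∣ value x n * value y n - value x′ n * value y′ n ∣ℚ ℚ.≤_)
      (trans (cong₂ _+_ Kd Le) (halves ε))
      (*-diff-bound (value x n) (value x′ n) (value y n) (value y′ n)
        (proj₁ (proj₁ (f n n≥))) (proj₂ (proj₁ (f n n≥))) (proj₁ (proj₂ (f n n≥))) (proj₂ (proj₂ (f n n≥))))

  module ≈-Reasoning where

    infix  1 begin_
    infixr 2 step-≈ step-≗
    infix  3 _∎

    begin_ : ∀ {x y} → x ≈ y → x ≈ y
    begin h = h

    step-≈ : ∀ x {y z} → y ≈ z → x ≈ y → x ≈ z
    step-≈ x k h = ≈-trans h k

    step-≗ : ∀ x {y z} → y ≈ z → x ≗ᴱ y → x ≈ z
    step-≗ x {y} k h = ≈-trans (≗⇒≈ {x} {y} h) k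

    syntax step-≈ x y≈z x≈y = x ≈⟨ x≈y ⟩ y≈z
    syntax step-≗ x y≈z x≗y = x ≗⟨ x≗y ⟩ y≈z

    _∎ : ∀ x → x ≈ x
    x ∎ = ≈-refl

  Eventually≤ : Expr → Expr → Set
  Eventually≤ x y = Σ ℕ λ N → ∀ n → N ℕ.≤ n → value x n ℚ.≤ value y n

  const-cancel-≤ : ∀ {p q x y} → x ≈ const p → y ≈ const q → Eventually≤ x y → p ℚ.≤ q
  const-cancel-≤ {p} {q} {x} {y} hx hy le = ℚ.≮⇒≥ λ q<p →
    let ε = p - q
        0<ε : 0ℚ ℚ.< ε
        0<ε = subst (ℚ._< ε) (ℚ.+-inverseʳ q) (ℚ.+-monoˡ-< (- q) q<p)
        e = ½ * (½ * ε)
        0<e = 0<½* {½ * ε} (0<½* {ε} 0<ε)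
        N , f = both (both (close (≈-sym hx) e 0<e) (close hy e 0<e)) le
        fN = f N ℕ.≤-refl
        p≤ : p ℚ.≤ value x N + e
        p≤ = ≤-from-diff (proj₁ (proj₁ fN))
        y≤ : value y N ℚ.≤ q + e
        y≤ = ≤-from-diff (proj₂ (proj₁ fN))
        p≤q : p ℚ.≤ q + ½ * ε
        p≤q = ℚ.≤-trans p≤ (ℚ.≤-trans (ℚ.+-monoˡ-≤ e (ℚ.≤-trans (proj₂ fN) y≤))
          (ℚ.≤-reflexive (trans (ℚ.+-assoc q e e) (cong (λ z → q + z) (halves (½ * ε))))))
        0<½ε = 0<½* {ε} 0<ε
        q+½ε<p : q + ½ * ε ℚ.< p
        q+½ε<p = subst₂ ℚ._<_ (ℚ.+-identityʳ (q + ½ * ε))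
          (trans (ℚ.+-assoc q (½ * ε) (½ * ε)) (trans (cong (λ z → q + z) (halves ε))
            (solve 2 (λ p q → q :+ (p :- q) := p) refl p q)))
          (ℚ.+-monoʳ-< (q + ½ * ε) 0<½ε)
    in ℚ.<-irrefl {p} {p} refl (ℚ.≤-<-trans p≤q q+½ε<p)

  private variable
    A : Set

  sumᴱ : List A → (A → Expr) → Expr
  sumᴱ []       f = 0ᴱ
  sumᴱ (x ∷ xs) f = f x ⊕ sumᴱ xs f

  seq-sum : ∀ (xs : List A) f n → value (sumᴱ xs f) n ≡ sumℚ xs (λ x → value (f x) n)
  seq-sum []       f n = refl
  seq-sum (x ∷ xs) f n = cong (λ z → value (f x) n + z) (seq-sum xs f n)

  sumᴱ-cong : ∀ (xs : List A) (f g : A → Expr) → (∀ x → f x ≈ g x) → sumᴱ xs f ≈ sumᴱ xs g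
  sumᴱ-cong []       f g eq = ≈-refl {0ᴱ}
  sumᴱ-cong (x ∷ xs) f g eq = +-cong {f x} {g x} {sumᴱ xs f} {sumᴱ xs g} (eq x) (sumᴱ-cong xs f g eq)

open RealAlgebra

eventually-all : ∀ {Q : ℕ → ℕ → Set} m → (∀ a → a ℕ.< m → Σ ℕ λ N → ∀ n → N ℕ.≤ n → Q a n) →
  Σ ℕ λ N → ∀ n → N ℕ.≤ n → ∀ a → a ℕ.< m → Q a n
eventually-all zero    h = 0 , λ _ _ _ ()
eventually-all {Q} (suc m) h with eventually-all {Q} m (λ a a<m → h a (ℕ.m≤n⇒m≤1+n a<m)) | h m (ℕ.n<1+n m)
... | N , f | M , g = N ℕ.⊔ M , λ n n≥ a a<1+m → go n n≥ a (ℕ.m≤n⇒m<n∨m≡n (ℕ.≤-pred a<1+m))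
  where
  go : ∀ n → N ℕ.⊔ M ℕ.≤ n → ∀ a → a ℕ.< m ⊎ a ≡ m → Q a n
  go n n≥ a (inj₁ a<m)  = f n (ℕ.m⊔n≤o⇒m≤o N M n≥) a a<m
  go n n≥ a (inj₂ refl) = g n (ℕ.m⊔n≤o⇒n≤o N M n≥)

module Fourier
  (p : ℕ) .{{_ : NonZero p}} (c s : ℤ → Expr)
  (c-sub : ∀ j k → c (j ℤ.- k) ≈ c j ⊗ c k ⊕ s j ⊗ s k)
  (s-sub : ∀ j k → s (j ℤ.- k) ≈ s j ⊗ c k ⊖ c j ⊗ s k)
  (c-add : ∀ j k → c (j ℤ.+ k) ≈ c j ⊗ c k ⊖ s j ⊗ s k)
  (s-add : ∀ j k → s (j ℤ.+ k) ≈ s j ⊗ c k ⊕ c j ⊗ s k)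
  (c-period : ∀ k → c (k ℤ.* + p) ≈ 1ᴱ) (s-period : ∀ k → s (k ℤ.* + p) ≈ 0ᴱ)
  (ns : List ℕ) .{{_ : NonZero (length ns)}} where

  open +-*-Solver using (solve; _:+_; _:*_; _:-_; :-_; con; _:=_)
  open Residues p
  open ≈-Reasoning

  xs : List ℤ
  xs = map +_ ns

  N P : ℚ
  N = ι (length ns)
  P = ι p

  c-0 : c (+ 0) ≈ 1ᴱ
  c-0 = c-period (+ 0)

  s-0 : s (+ 0) ≈ 0ᴱ
  s-0 = s-period (+ 0)

  cosSum sinSum normSquared : List ℤ → ℤ → Expr
  cosSum us a = sumᴱ us (λ u → c (a ℤ.* u))
  sinSum us a = sumᴱ us (λ u → s (a ℤ.* u))
  normSquared us a = cosSum us a ⊗ cosSum us a ⊕ sinSum us a ⊗ sinSum us a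

  0≤normSquared : ∀ us a n → 0ℚ ℚ.≤ value (normSquared us a) n
  0≤normSquared us a n = 0≤+ {value (cosSum us a) n * value (cosSum us a) n}
    (0≤² (value (cosSum us a) n)) (0≤² (value (sinSum us a) n))

  seq-double-sum : ∀ {A B : Set} (us : List A) (vs : List B) (f : A → B → Expr) n →
    value (sumᴱ us (λ u → sumᴱ vs (f u))) n ≡ sumℚ us (λ u → sumℚ vs (λ v → value (f u v) n))
  seq-double-sum us vs f n = trans (seq-sum us (λ u → sumᴱ vs (f u)) n) (sum-cong us (λ u → seq-sum vs (f u) n))

  double-sum-cong : ∀ {A B : Set} (us : List A) (vs : List B) (f g : A → B → Expr) → (∀ u v → f u v ≈ g u v) →
    sumᴱ us (λ u → sumᴱ vs (f u)) ≈ sumᴱ us (λ u → sumᴱ vs (g u))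
  double-sum-cong us vs f g eq = sumᴱ-cong us (λ u → sumᴱ vs (f u)) (λ u → sumᴱ vs (g u)) (λ u → sumᴱ-cong vs (f u) (g u) (eq u))

  *-sum-product : ∀ {A B : Set} (us : List A) (vs : List B) (f : A → Expr) (g : B → Expr) n →
    sumℚ us (λ u → sumℚ vs (λ v → value (f u) n * value (g v) n)) ≡ value (sumᴱ us f) n * value (sumᴱ vs g) n
  *-sum-product us vs f g n = trans (sum-product us vs (λ u → value (f u) n) (λ v → value (g v) n))
    (sym (cong₂ _*_ (seq-sum us f n) (seq-sum vs g n)))

  double-sum-+ : ∀ {A B : Set} (us : List A) (vs : List B) (f g : A → B → ℚ) →
    sumℚ us (λ u → sumℚ vs (λ v → f u v + g u v)) ≡ sumℚ us (λ u → sumℚ vs (f u)) + sumℚ us (λ u → sumℚ vs (g u))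
  double-sum-+ us vs f g = trans (sum-cong us (λ u → sum-+ vs (f u) (g u)))
    (sum-+ us (λ u → sumℚ vs (f u)) (λ u → sumℚ vs (g u)))

  double-sum-neg : ∀ {A B : Set} (us : List A) (vs : List B) (f : A → B → ℚ) →
    sumℚ us (λ u → sumℚ vs (λ v → - f u v)) ≡ - sumℚ us (λ u → sumℚ vs (f u))
  double-sum-neg us vs f = trans (sum-cong us (λ u → neg vs (f u))) (neg us (λ u → sumℚ vs (f u)))
    where
    neg : ∀ {A : Set} (us : List A) (f : A → ℚ) → sumℚ us (λ u → - f u) ≡ - sumℚ us f
    neg []       f = refl
    neg (u ∷ us) f = trans (cong (λ z → - f u + z) (neg us f)) (sym (ℚ.neg-distrib-+ (f u) (sumℚ us f)))

  cos-double-sum : ∀ us vs a → sumᴱ us (λ u → sumᴱ vs (λ v → c (a ℤ.* (u ℤ.- v))))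
    ≈ cosSum us a ⊗ cosSum vs a ⊕ sinSum us a ⊗ sinSum vs a
  cos-double-sum us vs a = begin
    sumᴱ us (λ u → sumᴱ vs (λ v → c (a ℤ.* (u ℤ.- v))))
      ≈⟨ double-sum-cong us vs _ product (λ u v → ≈-trans (≡⇒≈ c (a*[u-v] u v)) (c-sub (a ℤ.* u) (a ℤ.* v))) ⟩
    sumᴱ us (λ u → sumᴱ vs (product u))
      ≗⟨ (λ n → trans (seq-double-sum us vs product n)
           (trans (double-sum-+ us vs (λ u v → value (cos u ⊗ cos v) n) (λ u v → value (sin u ⊗ sin v) n))
             (cong₂ _+_ (*-sum-product us vs cos cos n) (*-sum-product us vs sin sin n)))) ⟩
    cosSum us a ⊗ cosSum vs a ⊕ sinSum us a ⊗ sinSum vs a ∎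
    where
    cos sin : ℤ → Expr
    cos u = c (a ℤ.* u)
    sin u = s (a ℤ.* u)
    product : ℤ → ℤ → Expr
    product u v = cos u ⊗ cos v ⊕ sin u ⊗ sin v
    a*[u-v] : ∀ u v → a ℤ.* (u ℤ.- v) ≡ a ℤ.* u ℤ.- a ℤ.* v
    a*[u-v] = Z.solve 3 (λ a u v → a Z.:* (u Z.:- v) Z.:= a Z.:* u Z.:- a Z.:* v) refl a

  sin-double-sum : ∀ us vs a → sumᴱ us (λ u → sumᴱ vs (λ v → s (a ℤ.* (u ℤ.- v))))
    ≈ sinSum us a ⊗ cosSum vs a ⊖ cosSum us a ⊗ sinSum vs a
  sin-double-sum us vs a = begin
    sumᴱ us (λ u → sumᴱ vs (λ v → s (a ℤ.* (u ℤ.- v))))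
      ≈⟨ double-sum-cong us vs _ product (λ u v → ≈-trans (≡⇒≈ s (a*[u-v] u v)) (s-sub (a ℤ.* u) (a ℤ.* v))) ⟩
    sumᴱ us (λ u → sumᴱ vs (product u))
      ≗⟨ (λ n → trans (seq-double-sum us vs product n)
           (trans (double-sum-+ us vs (λ u v → value (sin u ⊗ cos v) n) (λ u v → - value (cos u ⊗ sin v) n))
             (cong₂ _+_ (*-sum-product us vs sin cos n)
               (trans (double-sum-neg us vs (λ u v → value (cos u ⊗ sin v) n)) (cong -_ (*-sum-product us vs cos sin n)))))) ⟩
    sinSum us a ⊗ cosSum vs a ⊖ cosSum us a ⊗ sinSum vs a ∎
    where
    cos sin : ℤ → Expr
    cos u = c (a ℤ.* u)
    sin u = s (a ℤ.* u)
    product : ℤ → ℤ → Expr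
    product u v = sin u ⊗ cos v ⊖ cos u ⊗ sin v
    a*[u-v] : ∀ u v → a ℤ.* (u ℤ.- v) ≡ a ℤ.* u ℤ.- a ℤ.* v
    a*[u-v] = Z.solve 3 (λ a u v → a Z.:* (u Z.:- v) Z.:= a Z.:* u Z.:- a Z.:* v) refl a

  sum-difference : ∀ (f : ℤ → Expr) us vs →
    sumᴱ (cartesianProductWith ℤ._-_ us vs) f ≗ᴱ sumᴱ us (λ u → sumᴱ vs (λ v → f (u ℤ.- v)))
  sum-difference f us vs n = trans (seq-sum (cartesianProductWith ℤ._-_ us vs) f n)
    (trans (sum-cartesian ℤ._-_ us vs (λ w → value (f w) n)) (sym (seq-double-sum us vs (λ u v → f (u ℤ.- v)) n)))

  normSquared-difference : ∀ us vs a →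
    normSquared (cartesianProductWith ℤ._-_ us vs) a ≈ normSquared us a ⊗ normSquared vs a
  normSquared-difference us vs a = begin
    cosSum ws a ⊗ cosSum ws a ⊕ sinSum ws a ⊗ sinSum ws a
      ≈⟨ +-cong (*-cong cos≈ cos≈) (*-cong sin≈ sin≈) ⟩
    (C ⊗ C′ ⊕ S ⊗ S′) ⊗ (C ⊗ C′ ⊕ S ⊗ S′) ⊕ (S ⊗ C′ ⊖ C ⊗ S′) ⊗ (S ⊗ C′ ⊖ C ⊗ S′)
      ≗⟨ (λ n → solve 4 (λ C S C′ S′ → (C :* C′ :+ S :* S′) :* (C :* C′ :+ S :* S′) :+ (S :* C′ :- C :* S′) :* (S :* C′ :- C :* S′)
           := (C :* C :+ S :* S) :* (C′ :* C′ :+ S′ :* S′)) refl (value C n) (value S n) (value C′ n) (value S′ n)) ⟩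
    normSquared us a ⊗ normSquared vs a ∎
    where
    ws : List ℤ
    ws = cartesianProductWith ℤ._-_ us vs
    C S C′ S′ : Expr
    C  = cosSum us a
    S  = sinSum us a
    C′ = cosSum vs a
    S′ = sinSum vs a
    cos≈ : cosSum ws a ≈ C ⊗ C′ ⊕ S ⊗ S′
    cos≈ = ≈-trans (≗⇒≈ (sum-difference (λ w → c (a ℤ.* w)) us vs)) (cos-double-sum us vs a)
    sin≈ : sinSum ws a ≈ S ⊗ C′ ⊖ C ⊗ S′
    sin≈ = ≈-trans (≗⇒≈ (sum-difference (λ w → s (a ℤ.* w)) us vs)) (sin-double-sum us vs a)

  normSquared-0 : ∀ us → normSquared us (+ 0) ≈ const (ι (length us) * ι (length us))
  normSquared-0 us = begin
    normSquared us (+ 0)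
      ≈⟨ +-cong (*-cong cos≈ cos≈) (*-cong sin≈ sin≈) ⟩
    const (ι (length us)) ⊗ const (ι (length us)) ⊕ 0ᴱ ⊗ 0ᴱ
      ≗⟨ (λ n → ℚ.+-identityʳ (ι (length us) * ι (length us))) ⟩
    const (ι (length us) * ι (length us)) ∎
    where
    cos≈ : cosSum us (+ 0) ≈ const (ι (length us))
    cos≈ = ≈-trans (sumᴱ-cong us (λ u → c (+ 0 ℤ.* u)) (λ _ → 1ᴱ) (λ u → ≈-trans (≡⇒≈ c (ℤ.*-zeroˡ u)) c-0))
      (≗⇒≈ (λ n → trans (seq-sum us (λ _ → 1ᴱ) n) (trans (sum-const us 1ℚ) (ℚ.*-identityʳ (ι (length us))))))
    sin≈ : sinSum us (+ 0) ≈ 0ᴱ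
    sin≈ = ≈-trans (sumᴱ-cong us (λ u → s (+ 0 ℤ.* u)) (λ _ → 0ᴱ) (λ u → ≈-trans (≡⇒≈ s (ℤ.*-zeroˡ u)) s-0))
      (≗⇒≈ (λ n → trans (seq-sum us (λ _ → 0ᴱ) n) (sum-0 us)))

  module Orthogonality {D : ℚ} (0≤D : 0ℚ ℚ.≤ D) (D<1 : D ℚ.< 1ℚ)
    (small : ∀ k → ¬ + p ℤ.∣ k → Eventually≤ (normSquared xs k) (const (N * N * (D * D)))) where

    sum-shift : ∀ f → f p ≈ f 0 → sumᴱ (upTo p) (f ∘ suc) ≈ sumᴱ (upTo p) f
    sum-shift f fp≈f0 = begin
      sumᴱ (upTo p) (f ∘ suc)
        ≗⟨ (λ n → trans (seq-sum (upTo p) (f ∘ suc) n) (shift n)) ⟩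
      sumᴱ (upTo p) f ⊕ (f p ⊖ f 0)
        ≈⟨ +-cong (≈-refl {sumᴱ (upTo p) f}) (-‿cong fp≈f0 (≈-refl {f 0})) ⟩
      sumᴱ (upTo p) f ⊕ (f 0 ⊖ f 0)
        ≗⟨ (λ n → solve 2 (λ a b → a :+ (b :- b) := a) refl (value (sumᴱ (upTo p) f) n) (value (f 0) n)) ⟩
      sumᴱ (upTo p) f ∎
      where
      shift : ∀ n → sumℚ (upTo p) (λ a → value (f (suc a)) n) ≡ value (sumᴱ (upTo p) f) n + (value (f p) n - value (f 0) n)
      shift n = trans (solve 2 (λ a b → a := (b :+ a) :- b) refl Σ′ (F 0))
        (trans (cong (_- F 0) (trans (sym (sum-upTo-suc p F)) (sum-upTo-last p F)))
          (trans (solve 3 (λ a b c → (a :+ b) :- c := a :+ (b :- c)) refl (sumℚ (upTo p) F) (F p) (F 0))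
            (cong (_+ (F p - F 0)) (sym (seq-sum (upTo p) f n)))))
        where
        F : ℕ → ℚ
        F a = value (f a) n
        Σ′ = sumℚ (upTo p) (F ∘ suc)

    module _ (k : ℤ) (p∤k : ¬ + p ℤ.∣ k) where

      Gc Gs G² : Expr
      Gc = sumᴱ (upTo p) (λ a → c (+ a ℤ.* k))
      Gs = sumᴱ (upTo p) (λ a → s (+ a ℤ.* k))
      G² = Gc ⊗ Gc ⊕ Gs ⊗ Gs

      rotateᶜ rotateˢ : ℤ → Expr
      rotateᶜ m = c m ⊗ Gc ⊖ s m ⊗ Gs
      rotateˢ m = s m ⊗ Gc ⊕ c m ⊗ Gs

      ends : ∀ f → (∀ m → f (m ℤ.* + p) ≈ f (+ 0)) → f (+ p ℤ.* k) ≈ f (+ 0 ℤ.* k)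
      ends f periodic = ≈-trans (≡⇒≈ f (ℤ.*-comm (+ p) k)) (≈-trans (periodic k) (≡⇒≈ f (sym (ℤ.*-zeroˡ k))))

      suc-* : ∀ a → + a ℤ.* k ℤ.+ k ≡ + suc a ℤ.* k
      suc-* a = Z.solve 2 (λ a k → a Z.:* k Z.:+ k Z.:= (Z.con (+ 1) Z.:+ a) Z.:* k) refl (+ a) k

      sum-linear : ∀ (x y : Expr) (f g : ℕ → Expr) n →
        value (x ⊗ sumᴱ (upTo p) f) n + value (y ⊗ sumᴱ (upTo p) g) n ≡ sumℚ (upTo p) (λ a → value x n * value (f a) n + value y n * value (g a) n)
      sum-linear x y f g n = sym (trans (sum-+ (upTo p) (λ a → value x n * value (f a) n) (λ a → value y n * value (g a) n)) (cong₂ _+_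
        (trans (sum-*ˡ (upTo p) (value x n) (λ a → value (f a) n)) (cong (value x n *_) (sym (seq-sum (upTo p) f n))))
        (trans (sum-*ˡ (upTo p) (value y n) (λ a → value (g a) n)) (cong (value y n *_) (sym (seq-sum (upTo p) g n))))))

      rotateᶜ-k : rotateᶜ k ≈ Gc
      rotateᶜ-k = begin
        c k ⊗ Gc ⊖ s k ⊗ Gs
          ≗⟨ (λ n → trans (solve 4 (λ x a y b → x :* a :- y :* b := x :* a :+ (con 0ℚ :- y) :* b) refl (value (c k) n) (value Gc n) (value (s k) n) (value Gs n))
               (trans (sum-linear (c k) (0ᴱ ⊖ s k) (λ a → c (+ a ℤ.* k)) (λ a → s (+ a ℤ.* k)) n)
                 (trans (sum-cong (upTo p) (λ a → solve 4 (λ x a y b → x :* a :+ (con 0ℚ :- y) :* b := a :* x :- b :* y) refl (value (c k) n) (value (c (+ a ℤ.* k)) n) (value (s k) n) (value (s (+ a ℤ.* k)) n)))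
                   (sym (seq-sum (upTo p) (λ a → c (+ a ℤ.* k) ⊗ c k ⊖ s (+ a ℤ.* k) ⊗ s k) n))))) ⟩
        sumᴱ (upTo p) (λ a → c (+ a ℤ.* k) ⊗ c k ⊖ s (+ a ℤ.* k) ⊗ s k)
          ≈⟨ sumᴱ-cong (upTo p) _ (λ a → c (+ suc a ℤ.* k)) (λ a → ≈-trans (≈-sym (c-add (+ a ℤ.* k) k)) (≡⇒≈ c (suc-* a))) ⟩
        sumᴱ (upTo p) (λ a → c (+ suc a ℤ.* k))
          ≈⟨ sum-shift (λ a → c (+ a ℤ.* k)) (ends c (λ m → ≈-trans (c-period m) (≈-sym c-0))) ⟩
        Gc ∎

      rotateˢ-k : rotateˢ k ≈ Gs
      rotateˢ-k = begin
        s k ⊗ Gc ⊕ c k ⊗ Gs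
          ≗⟨ (λ n → trans (sum-linear (s k) (c k) (λ a → c (+ a ℤ.* k)) (λ a → s (+ a ℤ.* k)) n)
                 (trans (sum-cong (upTo p) (λ a → solve 4 (λ x a y b → x :* a :+ y :* b := b :* y :+ a :* x) refl (value (s k) n) (value (c (+ a ℤ.* k)) n) (value (c k) n) (value (s (+ a ℤ.* k)) n)))
                   (sym (seq-sum (upTo p) (λ a → s (+ a ℤ.* k) ⊗ c k ⊕ c (+ a ℤ.* k) ⊗ s k) n)))) ⟩
        sumᴱ (upTo p) (λ a → s (+ a ℤ.* k) ⊗ c k ⊕ c (+ a ℤ.* k) ⊗ s k)
          ≈⟨ sumᴱ-cong (upTo p) _ (λ a → s (+ suc a ℤ.* k)) (λ a → ≈-trans (≈-sym (s-add (+ a ℤ.* k) k)) (≡⇒≈ s (suc-* a))) ⟩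
        sumᴱ (upTo p) (λ a → s (+ suc a ℤ.* k))
          ≈⟨ sum-shift (λ a → s (+ a ℤ.* k)) (ends s (λ m → ≈-trans (s-period m) (≈-sym s-0))) ⟩
        Gs ∎

      rotate : ∀ m → rotateᶜ (k ℤ.* + m) ≈ Gc × rotateˢ (k ℤ.* + m) ≈ Gs
      rotate zero = (begin
          rotateᶜ (k ℤ.* + 0)    ≈⟨ ≡⇒≈ rotateᶜ (ℤ.*-zeroʳ k) ⟩
          rotateᶜ (+ 0)          ≈⟨ -‿cong (*-cong c-0 (≈-refl {Gc})) (*-cong s-0 (≈-refl {Gs})) ⟩
          1ᴱ ⊗ Gc ⊖ 0ᴱ ⊗ Gs   ≗⟨ (λ n → solve 2 (λ a b → con 1ℚ :* a :- con 0ℚ :* b := a) refl (value Gc n) (value Gs n)) ⟩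
          Gc                     ∎)
        , (begin
          rotateˢ (k ℤ.* + 0)    ≈⟨ ≡⇒≈ rotateˢ (ℤ.*-zeroʳ k) ⟩
          rotateˢ (+ 0)          ≈⟨ +-cong (*-cong s-0 (≈-refl {Gc})) (*-cong c-0 (≈-refl {Gs})) ⟩
          0ᴱ ⊗ Gc ⊕ 1ᴱ ⊗ Gs   ≗⟨ (λ n → solve 2 (λ a b → con 0ℚ :* a :+ con 1ℚ :* b := b) refl (value Gc n) (value Gs n)) ⟩
          Gs                     ∎)
      rotate (suc m) = (begin
          rotateᶜ (k ℤ.* + suc m)  ≈⟨ ≡⇒≈ rotateᶜ k*[1+m] ⟩
          rotateᶜ (x ℤ.+ k)        ≈⟨ -‿cong (*-cong (c-add x k) (≈-refl {Gc})) (*-cong (s-add x k) (≈-refl {Gs})) ⟩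
          (c x ⊗ c k ⊖ s x ⊗ s k) ⊗ Gc ⊖ (s x ⊗ c k ⊕ c x ⊗ s k) ⊗ Gs
            ≗⟨ (λ n → solve 6 (λ a b a′ b′ g h → (a :* a′ :- b :* b′) :* g :- (b :* a′ :+ a :* b′) :* h
                 := a :* (a′ :* g :- b′ :* h) :- b :* (b′ :* g :+ a′ :* h)) refl
                 (value (c x) n) (value (s x) n) (value (c k) n) (value (s k) n) (value Gc n) (value Gs n)) ⟩
          c x ⊗ rotateᶜ k ⊖ s x ⊗ rotateˢ k
            ≈⟨ -‿cong (*-cong (≈-refl {c x}) rotateᶜ-k) (*-cong (≈-refl {s x}) rotateˢ-k) ⟩
          rotateᶜ x                ≈⟨ proj₁ (rotate m) ⟩
          Gc                       ∎)
        , (begin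
          rotateˢ (k ℤ.* + suc m)  ≈⟨ ≡⇒≈ rotateˢ k*[1+m] ⟩
          rotateˢ (x ℤ.+ k)        ≈⟨ +-cong (*-cong (s-add x k) (≈-refl {Gc})) (*-cong (c-add x k) (≈-refl {Gs})) ⟩
          (s x ⊗ c k ⊕ c x ⊗ s k) ⊗ Gc ⊕ (c x ⊗ c k ⊖ s x ⊗ s k) ⊗ Gs
            ≗⟨ (λ n → solve 6 (λ a b a′ b′ g h → (b :* a′ :+ a :* b′) :* g :+ (a :* a′ :- b :* b′) :* h
                 := b :* (a′ :* g :- b′ :* h) :+ a :* (b′ :* g :+ a′ :* h)) refl
                 (value (c x) n) (value (s x) n) (value (c k) n) (value (s k) n) (value Gc n) (value Gs n)) ⟩
          s x ⊗ rotateᶜ k ⊕ c x ⊗ rotateˢ k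
            ≈⟨ +-cong (*-cong (≈-refl {s x}) rotateᶜ-k) (*-cong (≈-refl {c x}) rotateˢ-k) ⟩
          rotateˢ x                ≈⟨ proj₂ (rotate m) ⟩
          Gs                       ∎)
        where
        x : ℤ
        x = k ℤ.* + m
        k*[1+m] : k ℤ.* + suc m ≡ x ℤ.+ k
        k*[1+m] = Z.solve 2 (λ k m → k Z.:* (Z.con (+ 1) Z.:+ m) Z.:= k Z.:* m Z.:+ k) refl k (+ m)

      seq-xs : ∀ f n → value (sumᴱ xs f) n ≡ sumℚ ns (λ m → value (f (+ m)) n)
      seq-xs f n = trans (seq-sum xs f n) (sum-map ns +_ (λ x → value (f x) n))

      -- ζᵏᵐ G = G for every m, hence (∑_{x∈X} ζᵏˣ) G = N G.
      averageᶜ : cosSum xs k ⊗ Gc ⊖ sinSum xs k ⊗ Gs ≈ const N ⊗ Gc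
      averageᶜ = begin
        cosSum xs k ⊗ Gc ⊖ sinSum xs k ⊗ Gs
          ≗⟨ (λ n → trans (cong₂ (λ a b → a * value Gc n - b * value Gs n) (seq-xs (λ x → c (k ℤ.* x)) n) (seq-xs (λ x → s (k ℤ.* x)) n))
               (trans (collect (λ m → value (c (k ℤ.* + m)) n) (λ m → value (s (k ℤ.* + m)) n) (value Gc n) (value Gs n))
                 (sym (seq-sum ns (λ m → rotateᶜ (k ℤ.* + m)) n)))) ⟩
        sumᴱ ns (λ m → rotateᶜ (k ℤ.* + m))
          ≈⟨ sumᴱ-cong ns _ (λ _ → Gc) (λ m → proj₁ (rotate m)) ⟩
        sumᴱ ns (λ _ → Gc)
          ≗⟨ (λ n → trans (seq-sum ns (λ _ → Gc) n) (sum-const ns (value Gc n))) ⟩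
        const N ⊗ Gc ∎
        where
        collect : ∀ (f g : ℕ → ℚ) a b → sumℚ ns f * a - sumℚ ns g * b ≡ sumℚ ns (λ m → f m * a - g m * b)
        collect f g a b = sym (trans (sum-cong ns (λ m → solve 3 (λ x g b → x :- g :* b := x :+ g :* (:- b)) refl (f m * a) (g m) b))
          (trans (sum-+ ns (λ m → f m * a) (λ m → g m * - b)) (trans (cong₂ _+_ (sum-*ʳ ns a f) (sum-*ʳ ns (- b) g))
            (solve 3 (λ x g b → x :+ g :* (:- b) := x :- g :* b) refl (sumℚ ns f * a) (sumℚ ns g) b))))

      averageˢ : sinSum xs k ⊗ Gc ⊕ cosSum xs k ⊗ Gs ≈ const N ⊗ Gs
      averageˢ = begin
        sinSum xs k ⊗ Gc ⊕ cosSum xs k ⊗ Gs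
          ≗⟨ (λ n → trans (cong₂ (λ a b → a * value Gc n + b * value Gs n) (seq-xs (λ x → s (k ℤ.* x)) n) (seq-xs (λ x → c (k ℤ.* x)) n))
               (trans (collect (λ m → value (s (k ℤ.* + m)) n) (λ m → value (c (k ℤ.* + m)) n) (value Gc n) (value Gs n))
                 (sym (seq-sum ns (λ m → rotateˢ (k ℤ.* + m)) n)))) ⟩
        sumᴱ ns (λ m → rotateˢ (k ℤ.* + m))
          ≈⟨ sumᴱ-cong ns _ (λ _ → Gs) (λ m → proj₂ (rotate m)) ⟩
        sumᴱ ns (λ _ → Gs)
          ≗⟨ (λ n → trans (seq-sum ns (λ _ → Gs) n) (sum-const ns (value Gs n))) ⟩
        const N ⊗ Gs ∎
        where
        collect : ∀ (f g : ℕ → ℚ) a b → sumℚ ns f * a + sumℚ ns g * b ≡ sumℚ ns (λ m → f m * a + g m * b)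
        collect f g a b = sym (trans (sum-+ ns (λ m → f m * a) (λ m → g m * b)) (cong₂ _+_ (sum-*ʳ ns a f) (sum-*ʳ ns b g)))

      norm-average : normSquared xs k ⊗ G² ≈ const (N * N) ⊗ G²
      norm-average = begin
        normSquared xs k ⊗ G²
          ≗⟨ (λ n → solve 4 (λ C S g h → (C :* C :+ S :* S) :* (g :* g :+ h :* h)
               := (C :* g :- S :* h) :* (C :* g :- S :* h) :+ (S :* g :+ C :* h) :* (S :* g :+ C :* h)) refl
               (value (cosSum xs k) n) (value (sinSum xs k) n) (value Gc n) (value Gs n)) ⟩
        (C ⊗ Gc ⊖ S ⊗ Gs) ⊗ (C ⊗ Gc ⊖ S ⊗ Gs) ⊕ (S ⊗ Gc ⊕ C ⊗ Gs) ⊗ (S ⊗ Gc ⊕ C ⊗ Gs)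
          ≈⟨ +-cong (*-cong averageᶜ averageᶜ) (*-cong averageˢ averageˢ) ⟩
        (const N ⊗ Gc) ⊗ (const N ⊗ Gc) ⊕ (const N ⊗ Gs) ⊗ (const N ⊗ Gs)
          ≗⟨ (λ n → solve 3 (λ N g h → (N :* g) :* (N :* g) :+ (N :* h) :* (N :* h) := N :* N :* (g :* g :+ h :* h)) refl N (value Gc n) (value Gs n)) ⟩
        const (N * N) ⊗ G² ∎
        where
        C S : Expr
        C = cosSum xs k
        S = sinSum xs k

      0<gap : 0ℚ ℚ.< N * N * (1ℚ - D * D)
      0<gap = 0<* {N * N} {1ℚ - D * D} (0<* {N} {N} (0<ι (length ns)) (0<ι (length ns)))
        (subst (ℚ._< 1ℚ - D * D) (ℚ.+-inverseʳ (D * D)) (ℚ.+-monoˡ-< (- (D * D)) D²<1))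
        where
        D²<1 : D * D ℚ.< 1ℚ
        D²<1 = ℚ.≤-<-trans (*-monoˡ {D} 0≤D (ℚ.<⇒≤ D<1)) (subst (ℚ._< 1ℚ) (sym (ℚ.*-identityʳ D)) D<1)

      Gc≈0 : Gc ≈ 0ᴱ
      Gc≈0 = mk≈ λ ε 0<ε →
        let gap = N * N * (1ℚ - D * D)
            M , f = close norm-average (gap * (ε * ε)) (0<* {gap} 0<gap (0<* {ε} {ε} 0<ε 0<ε))
            M′ , f′ = small k p∤k
        in M ℕ.⊔ M′ , λ n n≥ →
          let g = value G² n
              x = value Gc n
              y = value Gs n
              0≤g : 0ℚ ℚ.≤ g
              0≤g = 0≤+ {x * x} {y * y} (0≤² x) (0≤² y)
              N²g≤ : N * N * g ℚ.≤ value (normSquared xs k) n * g + gap * (ε * ε)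
              N²g≤ = ≤-from-diff {N * N * g} {value (normSquared xs k) n * g} (subst (ℚ._≤ gap * (ε * ε))
                (∣-∣-comm (value (normSquared xs k) n * g) (N * N * g)) (f n (ℕ.m⊔n≤o⇒m≤o M M′ n≥)))
              N²g≤′ : N * N * g ℚ.≤ N * N * (D * D) * g + gap * (ε * ε)
              N²g≤′ = ℚ.≤-trans N²g≤ (ℚ.+-monoˡ-≤ (gap * (ε * ε)) (*-monoʳ {g} 0≤g (f′ n (ℕ.m⊔n≤o⇒n≤o M M′ n≥))))
              gap*g≤ : gap * g ℚ.≤ gap * (ε * ε)
              gap*g≤ = subst₂ ℚ._≤_
                (solve 3 (λ N D g → N :* N :* g :- N :* N :* (D :* D) :* g := N :* N :* (con 1ℚ :- D :* D) :* g) refl N D g)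
                (solve 2 (λ a b → (a :+ b) :- a := b) refl (N * N * (D * D) * g) (gap * (ε * ε)))
                (ℚ.+-monoˡ-≤ (- (N * N * (D * D) * g)) N²g≤′)
              g≤ε² : g ℚ.≤ ε * ε
              g≤ε² = *-cancel-≤ {gap} 0<gap gap*g≤
              x²≤ε² : ∣ x ∣ℚ * ∣ x ∣ℚ ℚ.≤ ε * ε
              x²≤ε² = subst (ℚ._≤ ε * ε) (trans (sym (ℚ.0≤p⇒∣p∣≡p (0≤² x))) (ℚ.∣p*q∣≡∣p∣*∣q∣ x x))
                (ℚ.≤-trans (≤-add {x * x} {y * y} (0≤² y)) g≤ε²)
          in subst (λ z → ∣ z ∣ℚ ℚ.≤ ε) (sym (ℚ.+-identityʳ x)) (²-cancel-≤ {∣ x ∣ℚ} {ε} (ℚ.<⇒≤ 0<ε) x²≤ε²)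

    kernel : ∀ k → sumᴱ (upTo p) (λ a → c (+ a ℤ.* k)) ≈ const (P * δ k)
    kernel k = go (+ p ℤ.∣? k)
      where
      go : Dec (+ p ℤ.∣ k) → sumᴱ (upTo p) (λ a → c (+ a ℤ.* k)) ≈ const (P * δ k)
      go (no p∤k)  = ≈-trans (Gc≈0 k p∤k) (≗⇒≈ {0ᴱ} {const (P * δ k)} (λ n → sym (trans (cong (P *_) (δ-no k p∤k)) (ℚ.*-zeroʳ P))))
      go (yes p∣k) = ≈-trans (sumᴱ-cong (upTo p) _ (λ _ → 1ᴱ) (λ a → ≈-trans (≡⇒≈ c (factor a p∣k)) (c-period (+ a ℤ.* ℤ.quotient p∣k))))
        (≗⇒≈ {sumᴱ (upTo p) (λ _ → 1ᴱ)} {const (P * δ k)} (λ n → trans (seq-sum (upTo p) (λ _ → 1ᴱ) n) (trans (sum-const (upTo p) 1ℚ)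
          (cong₂ (λ m d → ι m * d) (List.length-upTo p) (sym (δ-yes k p∣k))))))
        where
        factor : ∀ a → (d : + p ℤ.∣ k) → + a ℤ.* k ≡ + a ℤ.* ℤ.quotient d ℤ.* + p
        factor a (ℤ.divides q eq) = trans (cong (λ z → + a ℤ.* z) eq) (sym (ℤ.*-assoc (+ a) q (+ p)))

    parseval : ∀ us → sumᴱ (upTo p) (λ a → normSquared us (+ a)) ≈ const (P * energy us)
    parseval us = begin
      sumᴱ (upTo p) (λ a → normSquared us (+ a))
        ≈⟨ sumᴱ-cong (upTo p) _ (λ a → sumᴱ us (λ u → sumᴱ us (λ v → c (+ a ℤ.* (u ℤ.- v))))) (λ a → ≈-sym (cos-double-sum us us (+ a))) ⟩
      sumᴱ (upTo p) (λ a → sumᴱ us (λ u → sumᴱ us (λ v → c (+ a ℤ.* (u ℤ.- v)))))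
        ≗⟨ swap ⟩
      sumᴱ us (λ u → sumᴱ us (λ v → sumᴱ (upTo p) (λ a → c (+ a ℤ.* (u ℤ.- v)))))
        ≈⟨ double-sum-cong us us _ (λ u v → const (P * δ (u ℤ.- v))) (λ u v → kernel (u ℤ.- v)) ⟩
      sumᴱ us (λ u → sumᴱ us (λ v → const (P * δ (u ℤ.- v))))
        ≗⟨ (λ n → trans (seq-double-sum us us (λ u v → const (P * δ (u ℤ.- v))) n)
             (trans (sum-cong us (λ u → sum-*ˡ us P (λ v → δ (u ℤ.- v)))) (sum-*ˡ us P (λ u → sumℚ us (λ v → δ (u ℤ.- v)))))) ⟩
      const (P * energy us) ∎
      where
      swap : ∀ n → _
      swap n = trans (seq-sum (upTo p) _ n) (trans
        (sum-cong (upTo p) (λ a → seq-double-sum us us (λ u v → c (+ a ℤ.* (u ℤ.- v))) n))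
        (trans (sum-swap (upTo p) us (λ a u → sumℚ us (λ v → F a u v)))
          (trans (sum-cong us (λ u → sum-swap (upTo p) us (λ a v → F a u v)))
            (sym (trans (seq-double-sum us us (λ u v → sumᴱ (upTo p) (λ a → c (+ a ℤ.* (u ℤ.- v)))) n)
              (sum-cong us (λ u → sum-cong us (λ v → seq-sum (upTo p) (λ a → c (+ a ℤ.* (u ℤ.- v))) n))))))))
        where
        F : ℕ → ℤ → ℤ → ℚ
        F a u v = value (c (+ a ℤ.* (u ℤ.- v))) n

    energy-difference : ∀ vs → P * energy (cartesianProductWith ℤ._-_ xs vs)
      ℚ.≤ (N * N) * (ι (length vs) * ι (length vs)) + N * N * (D * D) * (P * energy vs)
    energy-difference vs = const-cancel-≤ lhs rhs eventually
      where
      ws : List ℤ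
      ws = cartesianProductWith ℤ._-_ xs vs
      X Y : ℕ → Expr
      X a = normSquared xs (+ a)
      Y a = normSquared vs (+ a)
      M : ℚ
      M = N * N * (D * D)
      lhs : sumᴱ (upTo p) (λ a → X a ⊗ Y a) ≈ const (P * energy ws)
      lhs = ≈-trans (sumᴱ-cong (upTo p) (λ a → X a ⊗ Y a) (λ a → normSquared ws (+ a))
        (λ a → ≈-sym (normSquared-difference xs vs (+ a)))) (parseval ws)
      rhs : X 0 ⊗ Y 0 ⊕ const M ⊗ sumᴱ (upTo p) Y
        ≈ const ((N * N) * (ι (length vs) * ι (length vs)) + M * (P * energy vs))
      rhs = begin
        X 0 ⊗ Y 0 ⊕ const M ⊗ sumᴱ (upTo p) Y
          ≈⟨ +-cong (*-cong (normSquared-0 xs) (normSquared-0 vs)) (*-cong (≈-refl {const M}) (parseval vs)) ⟩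
        const (ι (length xs) * ι (length xs)) ⊗ const (ι (length vs) * ι (length vs)) ⊕ const M ⊗ const (P * energy vs)
          ≗⟨ (λ n → cong (λ l → ι l * ι l * (ι (length vs) * ι (length vs)) + M * (P * energy vs)) (List.length-map +_ ns)) ⟩
        const ((N * N) * (ι (length vs) * ι (length vs)) + M * (P * energy vs)) ∎
      0≤M : 0ℚ ℚ.≤ M
      0≤M = 0≤* {N * N} {D * D} (0≤² N) (0≤² D)
      bounded : Σ ℕ λ n₀ → ∀ n → n₀ ℕ.≤ n → ∀ a → a ℕ.< p → NonZero a → value (X a) n ℚ.≤ M
      bounded = eventually-all {λ a n → NonZero a → value (X a) n ℚ.≤ M} p bounded-at
        where
        bounded-at : ∀ a → a ℕ.< p → Σ ℕ λ n₀ → ∀ n → n₀ ℕ.≤ n → NonZero a → value (X a) n ℚ.≤ M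
        bounded-at zero    _   = 0 , λ _ _ ()
        bounded-at (suc a) a<p = proj₁ (small (+ suc a) not-multiple) , λ n n≥ _ → proj₂ (small (+ suc a) not-multiple) n n≥
          where
          not-multiple : ¬ + p ℤ.∣ + suc a
          not-multiple h = ℕ.>⇒∤ a<p (ℤ.∣⇒∣ᵤ h)
      eventually : Eventually≤ (sumᴱ (upTo p) (λ a → X a ⊗ Y a)) (X 0 ⊗ Y 0 ⊕ const M ⊗ sumᴱ (upTo p) Y)
      eventually = proj₁ bounded , λ n n≥ → subst₂ ℚ._≤_
        (sym (seq-sum (upTo p) (λ a → X a ⊗ Y a) n))
        (cong (λ z → value (X 0) n * value (Y 0) n + M * z) (sym (seq-sum (upTo p) Y n)))
        (split-zero p (λ a → value (X a) n) (λ a → value (Y a) n) (λ a → 0≤normSquared vs (+ a) n) (proj₂ bounded n n≥))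
        where
        split-zero : ∀ m .{{_ : NonZero m}} (x y : ℕ → ℚ) → (∀ a → 0ℚ ℚ.≤ y a) → (∀ a → a ℕ.< m → NonZero a → x a ℚ.≤ M) →
          sumℚ (upTo m) (λ a → x a * y a) ℚ.≤ x 0 * y 0 + M * sumℚ (upTo m) y
        split-zero (suc m) x y 0≤y x≤M = ℚ.≤-trans (ℚ.≤-reflexive (sum-upTo-suc m (λ a → x a * y a)))
          (ℚ.+-monoʳ-≤ (x 0 * y 0) (ℚ.≤-trans
            (ℚ.≤-trans (sum-upTo-mono m (λ a a<m → *-monoʳ {y (suc a)} (0≤y (suc a)) (x≤M (suc a) (ℕ.s≤s a<m) _)))
              (ℚ.≤-reflexive (sum-*ˡ (upTo m) M (y ∘ suc))))
            (*-monoˡ {M} 0≤M (sum-upTo-⊆ {m} {suc m} {y} 1 ℕ.≤-refl 0≤y))))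

module Oscillation where

  open +-*-Solver using (solve; _:+_; _:*_; _:-_; :-_; con; _:=_)
  open ℚ[i]
  open GaussianRationals

  abs-+ : ∀ a b {x y} → ∣ a ∣ℚ ℚ.≤ x → ∣ b ∣ℚ ℚ.≤ y → ∣ a + b ∣ℚ ℚ.≤ x + y
  abs-+ a b ha hb = ℚ.≤-trans (ℚ.∣p+q∣≤∣p∣+∣q∣ a b) (ℚ.+-mono-≤ ha hb)

  abs-neg : ∀ a {x} → ∣ a ∣ℚ ℚ.≤ x → ∣ - a ∣ℚ ℚ.≤ x
  abs-neg a {x} = subst (ℚ._≤ x) (sym (ℚ.∣-p∣≡∣p∣ a))

  recip≤1 : ∀ k → recip k ℚ.≤ 1ℚ
  recip≤1 k = recip-antitone {0} {k} ℕ.z≤n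

  abs-recip : ∀ k a {x} → ∣ a ∣ℚ ℚ.≤ x → ∣ recip k * a ∣ℚ ℚ.≤ recip k * x
  abs-recip k a {x} ha = ∣*∣≤ (recip k) a (ℚ.≤-reflexive (ℚ.0≤p⇒∣p∣≡p (0≤recip k))) ha

  -- re (iʲ)
  unit : ℕ → ℚ
  unit zero          = 1ℚ
  unit (suc zero)    = 0ℚ
  unit (suc (suc j)) = - unit j

  -- re (iʲ (iθ)ᵏ / k!)
  term : ℚ → ℕ → ℕ → ℚ
  term θ j zero    = unit j
  term θ j (suc k) = recip k * (θ * term θ (suc j) k)

  -- re (iʲ exp (iθ)), up to truncation; differentiation in θ raises j by one.
  osc : ℕ → ℕ → ℚ → ℚ
  osc zero    j θ = 0ℚ
  osc (suc n) j θ = osc n j θ + term θ j n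

  term-2 : ∀ θ j k → term θ (suc (suc j)) k ≡ - term θ j k
  term-2 θ j zero    = refl
  term-2 θ j (suc k) = trans (cong (λ z → recip k * (θ * z)) (term-2 θ (suc j) k))
    (solve 3 (λ r θ x → r :* (θ :* :- x) := :- (r :* (θ :* x))) refl (recip k) θ (term θ (suc j) k))

  osc-2 : ∀ n j θ → osc n (suc (suc j)) θ ≡ - osc n j θ
  osc-2 zero    j θ = refl
  osc-2 (suc n) j θ = trans (cong₂ _+_ (osc-2 n j θ) (term-2 θ j n)) (sym (ℚ.neg-distrib-+ (osc n j θ) (term θ j n)))

  term-0 : ∀ j k → term 0ℚ j (suc k) ≡ 0ℚ
  term-0 j k = trans (cong (recip k *_) (ℚ.*-zeroˡ (term 0ℚ (suc j) k))) (ℚ.*-zeroʳ (recip k))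

  osc-0 : ∀ n j → osc (suc n) j 0ℚ ≡ unit j
  osc-0 zero    j = ℚ.+-identityˡ (unit j)
  osc-0 (suc n) j = trans (cong₂ _+_ (osc-0 n j) (term-0 j n)) (ℚ.+-identityʳ (unit j))

  expTerm≡ : ∀ θ k → expTerm (0ℚ +i θ) k ≡ term θ 0 k +i (- term θ 1 k)
  expTerm≡ θ zero    = refl
  expTerm≡ θ (suc k) = trans (cong (λ z → recip k ⊡ ((0ℚ +i θ) ⊠ z)) (expTerm≡ θ k)) (cong₂ _+i_
    (solve 4 (λ r θ a b → r :* (con 0ℚ :* a :- θ :* (:- b)) := r :* (θ :* b)) refl (recip k) θ (term θ 0 k) (term θ 1 k))
    (trans (solve 4 (λ r θ a b → r :* (con 0ℚ :* (:- b) :+ θ :* a) := :- (r :* (θ :* (:- a)))) refl (recip k) θ (term θ 0 k) (term θ 1 k))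
      (cong (λ z → - (recip k * (θ * z))) (sym (term-2 θ 0 k)))))

  expSum≡ : ∀ θ n → expSum (0ℚ +i θ) n ≡ osc n 0 θ +i (- osc n 1 θ)
  expSum≡ θ zero    = refl
  expSum≡ θ (suc n) = trans (cong₂ _⊞_ (expSum≡ θ n) (expTerm≡ θ n))
    (cong (λ z → (osc n 0 θ + term θ 0 n) +i z) (sym (ℚ.neg-distrib-+ (osc n 1 θ) (term θ 1 n))))

  module Bounds (K : ℕ) where

    open ExpCauchy.Majorant K using (b; 0≤b; K*b; total; 0≤total)

    term-bound : ∀ {θ} j k → ∣ θ ∣ℚ ℚ.≤ ι K → ∣ term θ j k ∣ℚ ℚ.≤ b k
    term-bound j zero hθ = unit-bound j
      where
      unit-bound : ∀ j → ∣ unit j ∣ℚ ℚ.≤ 1ℚ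
      unit-bound zero          = ℚ.≤-refl
      unit-bound (suc zero)    = 0≤1
      unit-bound (suc (suc j)) = abs-neg (unit j) (unit-bound j)
    term-bound {θ} j (suc k) hθ = abs-recip k (θ * term θ (suc j) k) (∣*∣≤ θ (term θ (suc j) k) hθ (term-bound (suc j) k hθ))

    osc-bound : ∀ {θ} n j → ∣ θ ∣ℚ ℚ.≤ ι K → ∣ osc n j θ ∣ℚ ℚ.≤ total n
    osc-bound zero    j hθ = ℚ.≤-refl
    osc-bound {θ} (suc n) j hθ = abs-+ (osc n j θ) (term θ j n) (osc-bound n j hθ) (term-bound j n hθ)

    remainder : ℚ → ℚ → ℕ → ℕ → ℚ
    remainder θ δ j k = term (θ + δ) j (suc k) - term θ j (suc k) - δ * term θ (suc j) k

    remainder-0 : ∀ θ δ j → remainder θ δ j 0 ≡ 0ℚ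
    remainder-0 θ δ j = solve 3 (λ θ δ u → con 1ℚ :* ((θ :+ δ) :* u) :- con 1ℚ :* (θ :* u) :- δ :* u := con 0ℚ) refl θ δ (unit (suc j))

    remainder-suc : ∀ θ δ j k → remainder θ δ j (suc k) ≡ recip (suc k) * ((θ + δ) * remainder θ δ (suc j) k + δ * δ * term θ (suc (suc j)) k)
    remainder-suc θ δ j k = begin
      r * ((θ + δ) * A) - r * (θ * T) - δ * T
        ≡⟨ solve 6 (λ r θ δ A T C → r :* ((θ :+ δ) :* A) :- r :* (θ :* T) :- δ :* T
             := r :* ((θ :+ δ) :* (A :- T :- δ :* C) :+ δ :* δ :* C) :+ δ :* (r :* (T :+ θ :* C) :- T)) refl r θ δ A T C ⟩
      r * ((θ + δ) * (A - T - δ * C) + δ * δ * C) + δ * (r * (T + θ * C) - T)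
        ≡⟨ cong (λ z → r * ((θ + δ) * (A - T - δ * C) + δ * δ * C) + δ * (z - T)) collect ⟩
      r * ((θ + δ) * (A - T - δ * C) + δ * δ * C) + δ * (T - T)
        ≡⟨ solve 3 (λ x δ T → x :+ δ :* (T :- T) := x) refl (r * ((θ + δ) * (A - T - δ * C) + δ * δ * C)) δ T ⟩
      r * ((θ + δ) * (A - T - δ * C) + δ * δ * C) ∎
      where
      open ≡-Reasoning
      r = recip (suc k)
      A = term (θ + δ) (suc j) (suc k)
      T = term θ (suc j) (suc k)
      C = term θ (suc (suc j)) k
      θC : θ * C ≡ ι (suc k) * T
      θC = sym (trans (solve 3 (λ i r x → i :* (r :* x) := r :* (i :* x)) refl (ι (suc k)) (recip k) (θ * C)) (ExpCauchy.recip*ι k (θ * C)))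
      collect : r * (T + θ * C) ≡ T
      collect = trans (cong (λ z → r * (T + z)) θC)
        (trans (cong (r *_) (trans (solve 2 (λ i T → T :+ i :* T := (con 1ℚ :+ i) :* T) refl (ι (suc k)) T) (cong (_* T) (sym (ι-suc (suc k))))))
          (ExpCauchy.recip*ι (suc k) T))

    module _ {θ δ : ℚ} (hθ : ∣ θ ∣ℚ ℚ.≤ ι K) (hθ+δ : ∣ θ + δ ∣ℚ ℚ.≤ ι K) where

      q : ℚ
      q = δ * δ

      0≤q : 0ℚ ℚ.≤ q
      0≤q = 0≤² δ

      remainder-bound : ∀ j k → ∣ remainder θ δ j (suc k) ∣ℚ ℚ.≤ q * b k
      remainder-bound j k = begin
        ∣ remainder θ δ j (suc k) ∣ℚ
          ≡⟨ cong ∣_∣ℚ (remainder-suc θ δ j k) ⟩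
        ∣ recip (suc k) * ((θ + δ) * remainder θ δ (suc j) k + q * term θ (suc (suc j)) k) ∣ℚ
          ≤⟨ abs-recip (suc k) ((θ + δ) * remainder θ δ (suc j) k + q * term θ (suc (suc j)) k)
               (abs-+ ((θ + δ) * remainder θ δ (suc j) k) (q * term θ (suc (suc j)) k) (previous k)
                 (∣*∣≤ q (term θ (suc (suc j)) k) (ℚ.≤-reflexive (ℚ.0≤p⇒∣p∣≡p 0≤q)) (term-bound (suc (suc j)) k hθ))) ⟩
        recip (suc k) * (ι k * (q * b k) + q * b k)
          ≡⟨ cong (recip (suc k) *_) (trans (solve 2 (λ i x → i :* x :+ x := (con 1ℚ :+ i) :* x) refl (ι k) (q * b k))
               (cong (_* (q * b k)) (sym (ι-suc k)))) ⟩
        recip (suc k) * (ι (suc k) * (q * b k))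
          ≤⟨ *-monoʳ {ι (suc k) * (q * b k)} (0≤* {ι (suc k)} (0≤ι (suc k)) 0≤qb) (recip-antitone (ℕ.n≤1+n k)) ⟩
        recip k * (ι (suc k) * (q * b k))
          ≡⟨ ExpCauchy.recip*ι k (q * b k) ⟩
        q * b k ∎
        where
        open ℚ.≤-Reasoning
        0≤qb : 0ℚ ℚ.≤ q * b k
        0≤qb = 0≤* {q} {b k} 0≤q (0≤b k)
        previous : ∀ k → ∣ (θ + δ) * remainder θ δ (suc j) k ∣ℚ ℚ.≤ ι k * (q * b k)
        previous zero    = ℚ.≤-reflexive (trans (cong (λ z → ∣ (θ + δ) * z ∣ℚ) (remainder-0 θ δ (suc j)))
          (trans (cong ∣_∣ℚ (ℚ.*-zeroʳ (θ + δ))) (sym (ℚ.*-zeroˡ (q * 1ℚ)))))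
        previous (suc k) = ℚ.≤-trans (∣*∣≤ (θ + δ) (remainder θ δ (suc j) (suc k)) hθ+δ (remainder-bound (suc j) k))
          (ℚ.≤-reflexive (trans (solve 3 (λ K q b → K :* (q :* b) := q :* (K :* b)) refl (ι K) q (b k))
            (trans (cong (q *_) (sym (K*b k))) (solve 3 (λ q i b → q :* (i :* b) := i :* (q :* b)) refl q (ι (suc k)) (b (suc k))))))

      taylor : ∀ n j → ∣ osc (suc (suc n)) j (θ + δ) - osc (suc (suc n)) j θ - δ * osc (suc n) (suc j) θ ∣ℚ ℚ.≤ q * total n
      taylor zero    j = ℚ.≤-reflexive (trans (cong ∣_∣ℚ
        (solve 4 (λ θ δ u v → (con 0ℚ :+ u :+ con 1ℚ :* ((θ :+ δ) :* v)) :- (con 0ℚ :+ u :+ con 1ℚ :* (θ :* v)) :- δ :* (con 0ℚ :+ v) := con 0ℚ)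
          refl θ δ (unit j) (unit (suc j)))) (sym (ℚ.*-zeroʳ q)))
      taylor (suc n) j = subst₂ ℚ._≤_ (cong ∣_∣ℚ
          (solve 7 (λ x y z x′ y′ z′ δ → (x :- y :- δ :* z) :+ (x′ :- y′ :- δ :* z′) := (x :+ x′) :- (y :+ y′) :- δ :* (z :+ z′)) refl
            (osc (suc (suc n)) j (θ + δ)) (osc (suc (suc n)) j θ) (osc (suc n) (suc j) θ)
            (term (θ + δ) j (suc (suc n))) (term θ j (suc (suc n))) (term θ (suc j) (suc n)) δ))
        (sym (ℚ.*-distribˡ-+ q (total n) (b n)))
        (abs-+ (osc (suc (suc n)) j (θ + δ) - osc (suc (suc n)) j θ - δ * osc (suc n) (suc j) θ) (remainder θ δ j (suc n))
          (taylor n j) (remainder-bound j n))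

      increment : ∀ n j → ∣ osc (suc (suc n)) j (θ + δ) - osc (suc (suc n)) j θ - δ * osc (suc (suc n)) (suc j) θ ∣ℚ
        ℚ.≤ q * total n + ∣ δ ∣ℚ * b (suc n)
      increment n j = subst (ℚ._≤ q * total n + ∣ δ ∣ℚ * b (suc n))
        (cong ∣_∣ℚ (solve 5 (λ x y δ z t → (x :- y :- δ :* z) :+ :- (δ :* t) := x :- y :- δ :* (z :+ t)) refl
          (osc (suc (suc n)) j (θ + δ)) (osc (suc (suc n)) j θ) δ (osc (suc n) (suc j) θ) (term θ (suc j) (suc n))))
        (abs-+ (osc (suc (suc n)) j (θ + δ) - osc (suc (suc n)) j θ - δ * osc (suc n) (suc j) θ) (- (δ * term θ (suc j) (suc n)))
          (taylor n j) (abs-neg (δ * term θ (suc j) (suc n)) (∣*∣≤ δ (term θ (suc j) (suc n)) ℚ.≤-refl (term-bound (suc j) (suc n) hθ))))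

open Oscillation

module Limits where

  open +-*-Solver using (solve; _:+_; _:*_; _:-_; con; _:=_)

  limit-≤ : ∀ {x y A} → 0ℚ ℚ.≤ A → (∀ n → x ℚ.≤ recip n * A + y) → x ℚ.≤ y
  limit-≤ {x} {y} {A} 0≤A h = ℚ.≮⇒≥ λ y<x →
    let ε = x - y
        0<ε : 0ℚ ℚ.< ε
        0<ε = subst (ℚ._< ε) (ℚ.+-inverseʳ y) (ℚ.+-monoˡ-< (- y) y<x)
        N , f = scaled-recip-small {A} {½ * ε} 0≤A (0<½* {ε} 0<ε)
        x≤ : x ℚ.≤ ½ * ε + y
        x≤ = ℚ.≤-trans (h N) (ℚ.+-monoˡ-≤ y (f N ℕ.≤-refl))
        lt : ½ * ε + y ℚ.< x
        lt = subst₂ ℚ._<_ (ℚ.+-identityʳ (½ * ε + y))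
          (trans (solve 2 (λ a y → a :+ y :+ a := (a :+ a) :+ y) refl (½ * ε) y) (trans (cong (_+ y) (halves ε))
            (solve 2 (λ x y → (x :- y) :+ y := x) refl x y)))
          (ℚ.+-monoʳ-< (½ * ε + y) (0<½* {ε} 0<ε))
    in ℚ.<-irrefl {x} {x} refl (ℚ.≤-<-trans x≤ lt)

  drift : ∀ L (h : ℕ → ℚ) {e} → (∀ i → i ℕ.< L → ∣ h (suc i) - h i ∣ℚ ℚ.≤ e) → ∣ h L - h 0 ∣ℚ ℚ.≤ ι L * e
  drift zero    h {e} le = ℚ.≤-reflexive (trans (cong ∣_∣ℚ (ℚ.+-inverseʳ (h 0))) (sym (ℚ.*-zeroˡ e)))
  drift (suc L) h {e} le = subst₂ ℚ._≤_
    (cong ∣_∣ℚ (solve 3 (λ a b c → (a :- b) :+ (b :- c) := a :- c) refl (h (suc L)) (h L) (h 0)))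
    (trans (solve 2 (λ n e → e :+ n :* e := (con 1ℚ :+ n) :* e) refl (ι L) e) (cong (_* e) (sym (ι-suc L))))
    (abs-+ (h (suc L) - h L) (h L - h 0) (le L (ℕ.n<1+n L)) (drift L h (λ i i<L → le i (ℕ.m≤n⇒m≤1+n i<L))))

  ι*recip≤1 : ∀ {i} l → i ℕ.≤ suc l → ι i * recip l ℚ.≤ 1ℚ
  ι*recip≤1 {i} l i≤ = subst (ι i * recip l ℚ.≤_) (ι*recip l) (*-monoʳ {recip l} (0≤recip l) (ι-mono i≤))

  0≤ι*recip : ∀ i l → 0ℚ ℚ.≤ ι i * recip l
  0≤ι*recip i l = 0≤* {ι i} {recip l} (0≤ι i) (0≤recip l)

  ι-suc*recip : ∀ i l → ι (suc i) * recip l ≡ ι i * recip l + recip l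
  ι-suc*recip i l = trans (cong (_* recip l) (ι-suc i))
    (solve 2 (λ i r → (con 1ℚ :+ i) :* r := i :* r :+ r) refl (ι i) (recip l))

open Limits

module Subtraction
  (F : ℕ → ℚ → ℚ) (κ B η : ℚ) (0≤η : 0ℚ ℚ.≤ η)
  (F-2 : ∀ j θ → F (suc (suc j)) θ ≡ - F j θ)
  (F-bound : ∀ j θ → ∣ θ ∣ℚ ℚ.≤ κ → ∣ F j θ ∣ℚ ℚ.≤ B)
  (F-increment : ∀ j θ δ → ∣ θ ∣ℚ ℚ.≤ κ → ∣ θ + δ ∣ℚ ℚ.≤ κ →
    ∣ F j (θ + δ) - F j θ - δ * F (suc j) θ ∣ℚ ℚ.≤ δ * δ * B + ∣ δ ∣ℚ * η)
  (F-0 : F 0 0ℚ ≡ 1ℚ) (F-1 : F 1 0ℚ ≡ 0ℚ) where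

  open +-*-Solver using (solve; _:+_; _:*_; _:-_; :-_; con; _:=_)

  F-increment′ : ∀ j θ δ → ∣ θ ∣ℚ ℚ.≤ κ → ∣ θ + δ ∣ℚ ℚ.≤ κ →
    ∣ F (suc j) (θ + δ) - F (suc j) θ + δ * F j θ ∣ℚ ℚ.≤ δ * δ * B + ∣ δ ∣ℚ * η
  F-increment′ j θ δ h h′ = subst (λ z → ∣ z ∣ℚ ℚ.≤ δ * δ * B + ∣ δ ∣ℚ * η)
    (trans (cong (λ z → F (suc j) (θ + δ) - F (suc j) θ - δ * z) (F-2 j θ))
      (solve 4 (λ x y δ z → x :- y :- δ :* (:- z) := x :- y :+ δ :* z) refl (F (suc j) (θ + δ)) (F (suc j) θ) δ (F j θ)))
    (F-increment (suc j) θ δ h h′)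

  module _ (j : ℕ) (w θ : ℚ) (w+θ≤κ : ∣ w ∣ℚ + ∣ θ ∣ℚ ℚ.≤ κ) where

    t y E₁ A : ℚ
    t = ∣ θ ∣ℚ
    y = (B + B + B + B) * (t * η)
    E₁ = t * t * B + t * η
    A = (t * t * (B * B + B * B) + (B + B + B + B) * (t * t * B)) + (E₁ * E₁ + E₁ * E₁)

    0≤t : 0ℚ ℚ.≤ t
    0≤t = ℚ.0≤∣p∣ θ

    0≤B : 0ℚ ℚ.≤ B
    0≤B = ℚ.≤-trans (ℚ.0≤∣p∣ (F 0 w)) (F-bound 0 w (ℚ.≤-trans (≤-add {∣ w ∣ℚ} 0≤t) w+θ≤κ))

    0≤ttB : 0ℚ ℚ.≤ t * t * B
    0≤ttB = 0≤* {t * t} (0≤² t) 0≤B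

    0≤4B : 0ℚ ℚ.≤ B + B + B + B
    0≤4B = 0≤+ {B + B + B} (0≤+ {B + B} (0≤+ {B} 0≤B 0≤B) 0≤B) 0≤B

    0≤A : 0ℚ ℚ.≤ A
    0≤A = 0≤+ {t * t * (B * B + B * B) + (B + B + B + B) * (t * t * B)}
      (0≤+ {t * t * (B * B + B * B)} (0≤* {t * t} (0≤² t) (0≤+ {B * B} (0≤² B) (0≤² B))) (0≤* {B + B + B + B} 0≤4B 0≤ttB))
      (0≤+ {E₁ * E₁} (0≤² E₁) (0≤² E₁))

    path : ℚ → ℚ
    path φ = F j (w + φ) * F 0 φ + F (suc j) (w + φ) * F 1 φ

    path-0 : path 0ℚ ≡ F j w
    path-0 = trans (cong₂ (λ x y → F j (w + 0ℚ) * x + F (suc j) (w + 0ℚ) * y) F-0 F-1)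
      (trans (solve 2 (λ a b → a :* con 1ℚ :+ b :* con 0ℚ := a) refl (F j (w + 0ℚ)) (F (suc j) (w + 0ℚ)))
        (cong (F j) (ℚ.+-identityʳ w)))

    module Step (l : ℕ) (i : ℕ) (i<L : i ℕ.< suc l) where

      r δ φ E a b c d a⁺ b⁺ c⁺ d⁺ e₁ e₂ e₃ e₄ : ℚ
      r = recip l
      δ = θ * r
      φ = θ * (ι i * r)
      E = δ * δ * B + ∣ δ ∣ℚ * η
      a = F j (w + φ)
      b = F (suc j) (w + φ)
      c = F 0 φ
      d = F 1 φ
      a⁺ = F j (w + φ + δ)
      b⁺ = F (suc j) (w + φ + δ)
      c⁺ = F 0 (φ + δ)
      d⁺ = F 1 (φ + δ)
      e₁ = a⁺ - a - δ * b
      e₂ = b⁺ - b + δ * a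
      e₃ = c⁺ - c - δ * d
      e₄ = d⁺ - d + δ * c

      φ+δ : φ + δ ≡ θ * (ι (suc i) * r)
      φ+δ = trans (solve 3 (λ θ x r → θ :* x :+ θ :* r := θ :* (x :+ r)) refl θ (ι i * r) r) (cong (θ *_) (sym (ι-suc*recip i l)))

      on-path : ∀ k → k ℕ.≤ suc l → ∣ θ * (ι k * r) ∣ℚ ℚ.≤ t
      on-path k k≤ = ℚ.≤-trans (∣*∣≤ θ (ι k * r) {t} {1ℚ} ℚ.≤-refl
          (ℚ.≤-trans (ℚ.≤-reflexive (ℚ.0≤p⇒∣p∣≡p (0≤ι*recip k l))) (ι*recip≤1 l k≤)))
        (ℚ.≤-reflexive (ℚ.*-identityʳ t))

      t≤κ : t ℚ.≤ κ
      t≤κ = ℚ.≤-trans (subst (t ℚ.≤_) (ℚ.+-comm t (∣ w ∣ℚ)) (≤-add {t} (ℚ.0≤∣p∣ w))) w+θ≤κ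

      w+ : ∀ x → ∣ x ∣ℚ ℚ.≤ t → ∣ w + x ∣ℚ ℚ.≤ κ
      w+ x hx = ℚ.≤-trans (abs-+ w x ℚ.≤-refl hx) w+θ≤κ

      hφ : ∣ φ ∣ℚ ℚ.≤ t
      hφ = on-path i (ℕ.<⇒≤ i<L)

      hφ⁺ : ∣ φ + δ ∣ℚ ℚ.≤ t
      hφ⁺ = subst (λ z → ∣ z ∣ℚ ℚ.≤ t) (sym φ+δ) (on-path (suc i) i<L)

      hw⁺ : ∣ w + φ + δ ∣ℚ ℚ.≤ κ
      hw⁺ = subst (λ z → ∣ z ∣ℚ ℚ.≤ κ) (sym (ℚ.+-assoc w φ δ)) (w+ (φ + δ) hφ⁺)

      he₁ : ∣ e₁ ∣ℚ ℚ.≤ E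
      he₁ = F-increment j (w + φ) δ (w+ φ hφ) hw⁺
      he₂ : ∣ e₂ ∣ℚ ℚ.≤ E
      he₂ = F-increment′ j (w + φ) δ (w+ φ hφ) hw⁺
      he₃ : ∣ e₃ ∣ℚ ℚ.≤ E
      he₃ = F-increment 0 φ δ (ℚ.≤-trans hφ t≤κ) (ℚ.≤-trans hφ⁺ t≤κ)
      he₄ : ∣ e₄ ∣ℚ ℚ.≤ E
      he₄ = F-increment′ 0 φ δ (ℚ.≤-trans hφ t≤κ) (ℚ.≤-trans hφ⁺ t≤κ)

      ha : ∣ a ∣ℚ ℚ.≤ B
      ha = F-bound j (w + φ) (w+ φ hφ)
      hb : ∣ b ∣ℚ ℚ.≤ B
      hb = F-bound (suc j) (w + φ) (w+ φ hφ)
      hc : ∣ c ∣ℚ ℚ.≤ B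
      hc = F-bound 0 φ (ℚ.≤-trans hφ t≤κ)
      hd : ∣ d ∣ℚ ℚ.≤ B
      hd = F-bound 1 φ (ℚ.≤-trans hφ t≤κ)
      ha⁺ : ∣ a⁺ ∣ℚ ℚ.≤ B
      ha⁺ = F-bound j (w + φ + δ) hw⁺
      hb⁺ : ∣ b⁺ ∣ℚ ℚ.≤ B
      hb⁺ = F-bound (suc j) (w + φ + δ) hw⁺
      hc⁺ : ∣ c⁺ ∣ℚ ℚ.≤ B
      hc⁺ = F-bound 0 (φ + δ) (ℚ.≤-trans hφ⁺ t≤κ)
      hd⁺ : ∣ d⁺ ∣ℚ ℚ.≤ B
      hd⁺ = F-bound 1 (φ + δ) (ℚ.≤-trans hφ⁺ t≤κ)

      expand : a⁺ * c⁺ + b⁺ * d⁺ - (a * c + b * d)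
        ≡ δ * δ * (a * c + b * d) + ((e₁ * c⁺ + (a⁺ - e₁) * e₃) + (e₂ * d⁺ + (b⁺ - e₂) * e₄))
      expand = solve 9 (λ a b c d a⁺ b⁺ c⁺ d⁺ δ → a⁺ :* c⁺ :+ b⁺ :* d⁺ :- (a :* c :+ b :* d)
        := δ :* δ :* (a :* c :+ b :* d) :+ (((a⁺ :- a :- δ :* b) :* c⁺ :+ (a⁺ :- (a⁺ :- a :- δ :* b)) :* (c⁺ :- c :- δ :* d))
             :+ ((b⁺ :- b :+ δ :* a) :* d⁺ :+ (b⁺ :- (b⁺ :- b :+ δ :* a)) :* (d⁺ :- d :+ δ :* c)))) refl a b c d a⁺ b⁺ c⁺ d⁺ δ

      error : ℚ
      error = δ * δ * (B * B + B * B) + ((E * B + (B + E) * E) + (E * B + (B + E) * E))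

      raw : ∣ a⁺ * c⁺ + b⁺ * d⁺ - (a * c + b * d) ∣ℚ ℚ.≤ error
      raw = subst (λ z → ∣ z ∣ℚ ℚ.≤ error) (sym expand)
        (abs-+ (δ * δ * (a * c + b * d)) ((e₁ * c⁺ + (a⁺ - e₁) * e₃) + (e₂ * d⁺ + (b⁺ - e₂) * e₄))
          (∣*∣≤ (δ * δ) (a * c + b * d) (ℚ.≤-reflexive (ℚ.0≤p⇒∣p∣≡p (0≤² δ)))
            (abs-+ (a * c) (b * d) (∣*∣≤ a c ha hc) (∣*∣≤ b d hb hd)))
          (abs-+ (e₁ * c⁺ + (a⁺ - e₁) * e₃) (e₂ * d⁺ + (b⁺ - e₂) * e₄)
            (abs-+ (e₁ * c⁺) ((a⁺ - e₁) * e₃) (∣*∣≤ e₁ c⁺ he₁ hc⁺) (∣*∣≤ (a⁺ - e₁) e₃ (abs-+ a⁺ (- e₁) ha⁺ (abs-neg e₁ he₁)) he₃))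
            (abs-+ (e₂ * d⁺) ((b⁺ - e₂) * e₄) (∣*∣≤ e₂ d⁺ he₂ hd⁺) (∣*∣≤ (b⁺ - e₂) e₄ (abs-+ b⁺ (- e₂) hb⁺ (abs-neg e₂ he₂)) he₄))))

      E′ : ℚ
      E′ = r * (t * t * B) + t * η

      E≡ : E ≡ r * E′
      E≡ = trans (cong₂ (λ x y → x * B + y * η) δδ ∣δ∣)
        (solve 4 (λ t r B η → t :* t :* (r :* r) :* B :+ t :* r :* η := r :* (r :* (t :* t :* B) :+ t :* η)) refl t r B η)
        where
        ∣δ∣ : ∣ δ ∣ℚ ≡ t * r
        ∣δ∣ = trans (ℚ.∣p*q∣≡∣p∣*∣q∣ θ r) (cong (t *_) (ℚ.0≤p⇒∣p∣≡p (0≤recip l)))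
        δδ : δ * δ ≡ t * t * (r * r)
        δδ = trans (sym (ℚ.0≤p⇒∣p∣≡p (0≤² δ))) (trans (ℚ.∣p*q∣≡∣p∣*∣q∣ δ δ) (trans (cong₂ _*_ ∣δ∣ ∣δ∣)
          (solve 2 (λ t r → t :* r :* (t :* r) := t :* t :* (r :* r)) refl t r)))

      δδ≡ : δ * δ ≡ r * (r * (t * t))
      δδ≡ = trans (solve 2 (λ θ r → θ :* r :* (θ :* r) := r :* (r :* (θ :* θ))) refl θ r)
        (cong (λ z → r * (r * z)) (trans (sym (ℚ.0≤p⇒∣p∣≡p (0≤² θ))) (ℚ.∣p*q∣≡∣p∣*∣q∣ θ θ)))

      E′≤E₁ : E′ ℚ.≤ E₁
      E′≤E₁ = ℚ.+-monoˡ-≤ (t * η) (ℚ.≤-trans (*-monoʳ {t * t * B} 0≤ttB (recip≤1 l)) (ℚ.≤-reflexive (ℚ.*-identityˡ (t * t * B))))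

      0≤E′ : 0ℚ ℚ.≤ E′
      0≤E′ = 0≤+ {r * (t * t * B)} (0≤* {r} (0≤recip l) 0≤ttB) (0≤* {t} 0≤t 0≤η)

      error≤ : error ℚ.≤ r * (r * A + y)
      error≤ = begin
        error
          ≡⟨ cong₂ (λ x z → x * (B * B + B * B) + ((z * B + (B + z) * z) + (z * B + (B + z) * z))) δδ≡ E≡ ⟩
        r * (r * (t * t)) * (B * B + B * B) + ((r * E′ * B + (B + r * E′) * (r * E′)) + (r * E′ * B + (B + r * E′) * (r * E′)))
          ≡⟨ solve 5 (λ r t B e h → r :* (r :* (t :* t)) :* (B :* B :+ B :* B)
               :+ ((r :* (r :* (t :* t :* B) :+ h) :* B :+ (B :+ r :* e) :* (r :* e)) :+ (r :* e :* B :+ (B :+ r :* e) :* (r :* (r :* (t :* t :* B) :+ h))))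
               := r :* (r :* (t :* t :* (B :* B :+ B :* B)) :+ ((r :* (t :* t :* B) :+ h) :* B :+ (B :+ r :* e) :* e :+ (e :* B :+ (B :+ r :* e) :* (r :* (t :* t :* B) :+ h))))) refl r t B E′ (t * η) ⟩
        r * (r * (t * t * (B * B + B * B)) + (E′ * B + (B + r * E′) * E′ + (E′ * B + (B + r * E′) * E′)))
          ≡⟨ cong (r *_) (solve 5 (λ r t B e h → r :* (t :* t :* (B :* B :+ B :* B)) :+ (e :* B :+ (B :+ r :* e) :* e :+ (e :* B :+ (B :+ r :* e) :* e))
               := (r :* (t :* t :* (B :* B :+ B :* B)) :+ r :* (e :* e :+ e :* e)) :+ (B :+ B :+ B :+ B) :* e) refl r t B E′ (t * η)) ⟩
        r * ((r * (t * t * (B * B + B * B)) + r * (E′ * E′ + E′ * E′)) + (B + B + B + B) * E′)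
          ≤⟨ *-monoˡ {r} (0≤recip l) (ℚ.+-monoˡ-≤ ((B + B + B + B) * E′) (ℚ.+-monoʳ-≤ (r * (t * t * (B * B + B * B)))
               (*-monoˡ {r} (0≤recip l) (ℚ.+-mono-≤ E′² E′²)))) ⟩
        r * ((r * (t * t * (B * B + B * B)) + r * (E₁ * E₁ + E₁ * E₁)) + (B + B + B + B) * E′)
          ≡⟨ solve 5 (λ r t B e h → r :* ((r :* (t :* t :* (B :* B :+ B :* B)) :+ r :* e) :+ (B :+ B :+ B :+ B) :* (r :* (t :* t :* B) :+ h))
               := r :* (r :* ((t :* t :* (B :* B :+ B :* B) :+ (B :+ B :+ B :+ B) :* (t :* t :* B)) :+ e) :+ (B :+ B :+ B :+ B) :* h)) refl r t B (E₁ * E₁ + E₁ * E₁) (t * η) ⟩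
        r * (r * A + y) ∎
        where
        open ℚ.≤-Reasoning
        E′² : E′ * E′ ℚ.≤ E₁ * E₁
        E′² = *-mono {E′} {E₁} {E′} {E₁} 0≤E′ 0≤E′ E′≤E₁ E′≤E₁

      step : ∣ path (θ * (ι (suc i) * r)) - path (θ * (ι i * r)) ∣ℚ ℚ.≤ r * (r * A + y)
      step = subst (λ z → ∣ z - path φ ∣ℚ ℚ.≤ r * (r * A + y))
        (trans (cong (λ z → F j z * c⁺ + F (suc j) z * d⁺) (ℚ.+-assoc w φ δ)) (cong path φ+δ))
        (ℚ.≤-trans raw error≤)

    subtraction : ∣ path θ - F j w ∣ℚ ℚ.≤ y
    subtraction = limit-≤ {∣ path θ - F j w ∣ℚ} {y} {A} 0≤A λ l → subst₂ ℚ._≤_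
      (cong ∣_∣ℚ (cong₂ _-_ (cong path (trans (cong (θ *_) (ι*recip l)) (ℚ.*-identityʳ θ)))
        (trans (cong path (trans (cong (θ *_) (ℚ.*-zeroˡ (recip l))) (ℚ.*-zeroʳ θ))) path-0)))
      (trans (sym (ℚ.*-assoc (ι (suc l)) (recip l) (recip l * A + y))) (trans (cong (_* (recip l * A + y)) (ι*recip l)) (ℚ.*-identityˡ (recip l * A + y))))
      (drift (suc l) (λ i → path (θ * (ι i * recip l))) (λ i i<L → Step.step l i i<L))

module Arctangent where

  open +-*-Solver using (solve; _:+_; _:*_; _:-_; :-_; con; _:=_)

  powerRemainder : ℕ → ℚ → ℚ → ℚ
  powerRemainder k t τ = (t + τ) ^ℚ suc k - t ^ℚ suc k - ι (suc k) * (τ * t ^ℚ k)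

  powerRemainder-suc : ∀ k t τ → powerRemainder (suc k) t τ ≡ (t + τ) * powerRemainder k t τ + ι (suc k) * (τ * τ * t ^ℚ k)
  powerRemainder-suc k t τ = trans (cong (λ z → (t + τ) ^ℚ suc (suc k) - t ^ℚ suc (suc k) - z * (τ * t ^ℚ suc k)) (ι-suc (suc k)))
    (solve 5 (λ t τ x y n → (t :+ τ) :* x :- t :* (t :* y) :- (con 1ℚ :+ n) :* (τ :* (t :* y))
      := (t :+ τ) :* (x :- t :* y :- n :* (τ :* y)) :+ n :* (τ :* τ :* y)) refl t τ ((t + τ) ^ℚ suc k) (t ^ℚ k) (ι (suc k)))

  powerRemainder-0 : ∀ t τ → powerRemainder 0 t τ ≡ 0ℚ
  powerRemainder-0 = solve 2 (λ t τ → (t :+ τ) :* con 1ℚ :- t :* con 1ℚ :- con 1ℚ :* (τ :* con 1ℚ) := con 0ℚ) refl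

  triangular : ℕ → ℚ
  triangular zero    = 0ℚ
  triangular (suc k) = triangular k + ι (suc k)

  ^-≤1 : ∀ {t} k → 0ℚ ℚ.≤ t → t ℚ.≤ 1ℚ → t ^ℚ k ℚ.≤ 1ℚ
  ^-≤1 zero        0≤t t≤1 = ℚ.≤-refl
  ^-≤1 {t} (suc k) 0≤t t≤1 = ℚ.≤-trans (*-mono {t} {1ℚ} {t ^ℚ k} {1ℚ} 0≤t (^-nonNeg k 0≤t) t≤1 (^-≤1 k 0≤t t≤1)) (ℚ.≤-reflexive refl)

  module _ {t τ : ℚ} (0≤t : 0ℚ ℚ.≤ t) (0≤τ : 0ℚ ℚ.≤ τ) (t+τ≤1 : t + τ ℚ.≤ 1ℚ) where

    0≤t+τ : 0ℚ ℚ.≤ t + τ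
    0≤t+τ = 0≤+ {t} 0≤t 0≤τ

    t≤1 : t ℚ.≤ 1ℚ
    t≤1 = ℚ.≤-trans (≤-add {t} 0≤τ) t+τ≤1

    0≤powerRemainder : ∀ k → 0ℚ ℚ.≤ powerRemainder k t τ
    0≤powerRemainder zero    = ℚ.≤-reflexive (sym (powerRemainder-0 t τ))
    0≤powerRemainder (suc k) = subst (0ℚ ℚ.≤_) (sym (powerRemainder-suc k t τ))
      (0≤+ {(t + τ) * powerRemainder k t τ} (0≤* {t + τ} 0≤t+τ (0≤powerRemainder k))
        (0≤* {ι (suc k)} (0≤ι (suc k)) (0≤* {τ * τ} (0≤² τ) (^-nonNeg k 0≤t))))

    powerRemainder-≤ : ∀ k → powerRemainder k t τ ℚ.≤ triangular k * (τ * τ)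
    powerRemainder-≤ zero    = ℚ.≤-reflexive (trans (powerRemainder-0 t τ) (sym (ℚ.*-zeroˡ (τ * τ))))
    powerRemainder-≤ (suc k) = begin
      powerRemainder (suc k) t τ
        ≡⟨ powerRemainder-suc k t τ ⟩
      (t + τ) * powerRemainder k t τ + ι (suc k) * (τ * τ * t ^ℚ k)
        ≤⟨ ℚ.+-mono-≤ (*-monoʳ {powerRemainder k t τ} (0≤powerRemainder k) t+τ≤1)
             (*-monoˡ {ι (suc k)} (0≤ι (suc k)) (*-monoˡ {τ * τ} (0≤² τ) (^-≤1 k 0≤t t≤1))) ⟩
      1ℚ * powerRemainder k t τ + ι (suc k) * (τ * τ * 1ℚ)
        ≤⟨ ℚ.+-monoˡ-≤ (ι (suc k) * (τ * τ * 1ℚ)) (*-monoˡ {1ℚ} 0≤1 (powerRemainder-≤ k)) ⟩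
      1ℚ * (triangular k * (τ * τ)) + ι (suc k) * (τ * τ * 1ℚ)
        ≡⟨ solve 3 (λ c n q → con 1ℚ :* (c :* q) :+ n :* (q :* con 1ℚ) := (c :+ n) :* q) refl (triangular k) (ι (suc k)) (τ * τ) ⟩
      triangular (suc k) * (τ * τ) ∎
      where open ℚ.≤-Reasoning

  -- arctan e k t is the sum of k terms of tᵉ⁺¹/(e+1) − tᵉ⁺³/(e+3) + ⋯, and slope e k t is its derivative.
  arctan slope : ℕ → ℕ → ℚ → ℚ
  arctan e zero    t = 0ℚ
  arctan e (suc k) t = recip e * t ^ℚ suc e - arctan (suc (suc e)) k t
  slope e zero    t = 0ℚ
  slope e (suc k) t = t ^ℚ e - slope (suc (suc e)) k t

  1^ : ∀ k → 1ℚ ^ℚ k ≡ 1ℚ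
  1^ zero    = refl
  1^ (suc k) = trans (ℚ.*-identityˡ (1ℚ ^ℚ k)) (1^ k)

  arctan-1 : ∀ m k → arctan (m ℕ.+ m) k 1ℚ ≡ leibniz m k
  arctan-1 m zero    = refl
  arctan-1 m (suc k) = cong₂ _-_ (trans (cong (recip (m ℕ.+ m) *_) (1^ (suc (m ℕ.+ m)))) (ℚ.*-identityʳ (recip (m ℕ.+ m))))
    (trans (cong (λ e → arctan (suc e) k 1ℚ) (sym (ℕ.+-suc m m))) (arctan-1 (suc m) k))

  arctan-0 : ∀ e k → arctan e k 0ℚ ≡ 0ℚ
  arctan-0 e zero    = refl
  arctan-0 e (suc k) = trans (cong₂ _-_ (trans (cong (recip e *_) (ℚ.*-zeroˡ (0ℚ ^ℚ e))) (ℚ.*-zeroʳ (recip e))) (arctan-0 (suc (suc e)) k)) refl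

  curvature : ℕ → ℕ → ℚ
  curvature e zero    = 0ℚ
  curvature e (suc k) = triangular e + curvature (suc (suc e)) k

  0≤curvature : ∀ e k → 0ℚ ℚ.≤ curvature e k
  0≤curvature e zero    = ℚ.≤-refl
  0≤curvature e (suc k) = 0≤+ {triangular e} (0≤triangular e) (0≤curvature (suc (suc e)) k)
    where
    0≤triangular : ∀ k → 0ℚ ℚ.≤ triangular k
    0≤triangular zero    = ℚ.≤-refl
    0≤triangular (suc k) = 0≤+ {triangular k} (0≤triangular k) (0≤ι (suc k))

  arctan-increment : ∀ {t τ} → 0ℚ ℚ.≤ t → 0ℚ ℚ.≤ τ → t + τ ℚ.≤ 1ℚ → ∀ e k →
    ∣ arctan e k (t + τ) - arctan e k t - τ * slope e k t ∣ℚ ℚ.≤ curvature e k * (τ * τ)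
  arctan-increment {t} {τ} 0≤t 0≤τ t+τ≤1 e zero = ℚ.≤-reflexive (trans
    (cong ∣_∣ℚ (solve 1 (λ τ → con 0ℚ :- con 0ℚ :- τ :* con 0ℚ := con 0ℚ) refl τ)) (sym (ℚ.*-zeroˡ (τ * τ))))
  arctan-increment {t} {τ} 0≤t 0≤τ t+τ≤1 e (suc k) = subst₂ ℚ._≤_ (cong ∣_∣ℚ eq)
    (sym (ℚ.*-distribʳ-+ (τ * τ) (triangular e) (curvature (suc (suc e)) k)))
    (abs-+ (recip e * Q) (- next) (begin
      ∣ recip e * Q ∣ℚ           ≡⟨ ℚ.0≤p⇒∣p∣≡p (0≤* {recip e} (0≤recip e) (0≤powerRemainder 0≤t 0≤τ t+τ≤1 e)) ⟩
      recip e * Q                ≤⟨ *-monoʳ {Q} (0≤powerRemainder 0≤t 0≤τ t+τ≤1 e) (recip≤1 e) ⟩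
      1ℚ * Q                     ≡⟨ ℚ.*-identityˡ Q ⟩
      Q                          ≤⟨ powerRemainder-≤ 0≤t 0≤τ t+τ≤1 e ⟩
      triangular e * (τ * τ)     ∎)
      (abs-neg next (arctan-increment 0≤t 0≤τ t+τ≤1 (suc (suc e)) k)))
    where
    open ℚ.≤-Reasoning
    Q next a a⁺ : ℚ
    Q = powerRemainder e t τ
    a = arctan (suc (suc e)) k t
    a⁺ = arctan (suc (suc e)) k (t + τ)
    next = a⁺ - a - τ * slope (suc (suc e)) k t
    eq : recip e * Q - next ≡ (recip e * (t + τ) ^ℚ suc e - a⁺) - (recip e * t ^ℚ suc e - a) - τ * (t ^ℚ e - slope (suc (suc e)) k t)
    eq = trans (solve 9 (λ r x y n τ p a⁺ a s → r :* (x :- y :- n :* (τ :* p)) :- (a⁺ :- a :- τ :* s)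
        := (r :* x :- a⁺) :- (r :* y :- a) :- (r :* (n :* (τ :* p)) :- τ :* s)) refl
        (recip e) ((t + τ) ^ℚ suc e) (t ^ℚ suc e) (ι (suc e)) τ (t ^ℚ e) a⁺ a (slope (suc (suc e)) k t))
      (cong (λ z → (recip e * (t + τ) ^ℚ suc e - a⁺) - (recip e * t ^ℚ suc e - a) - z)
        (trans (cong (_- τ * slope (suc (suc e)) k t) (ExpCauchy.recip*ι e (τ * t ^ℚ e)))
          (solve 3 (λ τ p s → τ :* p :- τ :* s := τ :* (p :- s)) refl τ (t ^ℚ e) (slope (suc (suc e)) k t))))

  module _ {t : ℚ} (0≤t : 0ℚ ℚ.≤ t) (t≤1 : t ℚ.≤ 1ℚ) where

    ^-decreasing : ∀ e → t ^ℚ suc (suc e) ℚ.≤ t ^ℚ e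
    ^-decreasing e = ℚ.≤-trans (drop (suc e)) (drop e)
      where
      drop : ∀ e → t ^ℚ suc e ℚ.≤ t ^ℚ e
      drop e = ℚ.≤-trans (*-monoʳ {t ^ℚ e} (^-nonNeg e 0≤t) t≤1) (ℚ.≤-reflexive (ℚ.*-identityˡ (t ^ℚ e)))

    alternating : ∀ {x y z} → 0ℚ ℚ.≤ y → y ℚ.≤ z → z ℚ.≤ x → 0ℚ ℚ.≤ x - y × x - y ℚ.≤ x
    alternating {x} {y} 0≤y y≤z z≤x = ≤⇒0≤ (ℚ.≤-trans y≤z z≤x)
      , subst (x - y ℚ.≤_) (ℚ.+-identityʳ x) (ℚ.+-monoʳ-≤ x (ℚ.neg-antimono-≤ 0≤y))

    slope-bounds : ∀ e k → 0ℚ ℚ.≤ slope e k t × slope e k t ℚ.≤ t ^ℚ e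
    slope-bounds e zero    = ℚ.≤-refl , ^-nonNeg e 0≤t
    slope-bounds e (suc k) = alternating (proj₁ ih) (proj₂ ih) (^-decreasing e)
      where ih = slope-bounds (suc (suc e)) k

    arctan-bounds : ∀ e k → 0ℚ ℚ.≤ arctan e k t × arctan e k t ℚ.≤ recip e * t ^ℚ suc e
    arctan-bounds e zero    = ℚ.≤-refl , 0≤* {recip e} (0≤recip e) (^-nonNeg (suc e) 0≤t)
    arctan-bounds e (suc k) = alternating (proj₁ ih) (proj₂ ih)
      (*-mono {recip (suc (suc e))} {recip e} {t ^ℚ suc (suc (suc e))} {t ^ℚ suc e} (0≤recip (suc (suc e))) (^-nonNeg (suc (suc (suc e))) 0≤t)
        (recip-antitone (ℕ.≤-trans (ℕ.n≤1+n e) (ℕ.n≤1+n (suc e)))) (^-decreasing (suc e)))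
      where ih = arctan-bounds (suc (suc e)) k

    -- (1 + t²) times the derivative of arctan telescopes.
    slope-defect : ∀ e k → ∣ t ^ℚ e - (1ℚ + t * t) * slope e k t ∣ℚ ℚ.≤ t ^ℚ (e ℕ.+ (k ℕ.+ k))
    slope-defect e zero    = ℚ.≤-reflexive (trans (cong ∣_∣ℚ (solve 2 (λ x y → x :- y :* con 0ℚ := x) refl (t ^ℚ e) (1ℚ + t * t)))
      (trans (ℚ.0≤p⇒∣p∣≡p (^-nonNeg e 0≤t)) (cong (t ^ℚ_) (sym (ℕ.+-identityʳ e)))))
    slope-defect e (suc k) = subst₂ ℚ._≤_
      (trans (sym (ℚ.∣-p∣≡∣p∣ _)) (cong ∣_∣ℚ (solve 3 (λ t x s → :- (t :* (t :* x) :- (con 1ℚ :+ t :* t) :* s) := x :- (con 1ℚ :+ t :* t) :* (x :- s)) refl t (t ^ℚ e) (slope (suc (suc e)) k t))))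
      (cong (t ^ℚ_) (sym (trans (ℕ.+-suc e (k ℕ.+ suc k)) (cong suc (trans (cong (e ℕ.+_) (ℕ.+-suc k k)) (ℕ.+-suc e (k ℕ.+ k)))))))
      (slope-defect (suc (suc e)) k)

module QuarterTurn
  (F : ℕ → ℚ → ℚ) (κ B η : ℚ) (1≤κ : 1ℚ ℚ.≤ κ) (0≤η : 0ℚ ℚ.≤ η) (η≤1 : η ℚ.≤ 1ℚ)
  (F-2 : ∀ j θ → F (suc (suc j)) θ ≡ - F j θ)
  (F-bound : ∀ j θ → ∣ θ ∣ℚ ℚ.≤ κ → ∣ F j θ ∣ℚ ℚ.≤ B)
  (F-increment : ∀ j θ δ → ∣ θ ∣ℚ ℚ.≤ κ → ∣ θ + δ ∣ℚ ℚ.≤ κ →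
    ∣ F j (θ + δ) - F j θ - δ * F (suc j) θ ∣ℚ ℚ.≤ δ * δ * B + ∣ δ ∣ℚ * η)
  (F-0 : F 0 0ℚ ≡ 1ℚ) (F-1 : F 1 0ℚ ≡ 0ℚ) (m : ℕ) where

  open +-*-Solver using (solve; _:+_; _:*_; _:-_; con; _:=_)
  open Arctangent
  open Subtraction F κ B η 0≤η F-2 F-bound F-increment F-0 F-1 using (F-increment′)

  α β : ℚ → ℚ
  α = arctan 0 m
  β = slope 0 m

  R R′ A : ℚ
  R = curvature 0 m
  R′ = 1ℚ + R
  A = R * (B + B) + R′ * B + ((R′ * R′ * B + R) + (R′ * R′ * B + R))

  e : ℕ
  e = m ℕ.+ m

  0≤R : 0ℚ ℚ.≤ R
  0≤R = 0≤curvature 0 m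

  0≤R′ : 0ℚ ℚ.≤ R′
  0≤R′ = 0≤+ {1ℚ} 0≤1 0≤R

  ∣0∣≤κ : ∣ 0ℚ ∣ℚ ℚ.≤ κ
  ∣0∣≤κ = ℚ.≤-trans {∣ 0ℚ ∣ℚ} {1ℚ} 0≤1 1≤κ

  0≤B : 0ℚ ℚ.≤ B
  0≤B = ℚ.≤-trans (ℚ.0≤∣p∣ (F 0 0ℚ)) (F-bound 0 0ℚ ∣0∣≤κ)

  0≤A : 0ℚ ℚ.≤ A
  0≤A = 0≤+ {R * (B + B) + R′ * B} (0≤+ {R * (B + B)} (0≤* {R} 0≤R (0≤+ {B} 0≤B 0≤B)) (0≤* {R′} 0≤R′ 0≤B)) (0≤+ {R′ * R′ * B + R} h h)
    where h = 0≤+ {R′ * R′ * B} (0≤* {R′ * R′} (0≤² R′) 0≤B) 0≤R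

  α-bound : ∀ {t} → 0ℚ ℚ.≤ t → t ℚ.≤ 1ℚ → ∣ α t ∣ℚ ℚ.≤ κ
  α-bound {t} 0≤t t≤1 = ℚ.≤-trans (ℚ.≤-reflexive (ℚ.0≤p⇒∣p∣≡p (proj₁ bounds)))
    (ℚ.≤-trans (proj₂ bounds) (ℚ.≤-trans (ℚ.≤-reflexive (ℚ.*-identityˡ (t ^ℚ 1))) (ℚ.≤-trans (^-≤1 1 0≤t t≤1) 1≤κ)))
    where bounds = arctan-bounds 0≤t t≤1 0 m

  -- Vanishes where tan (α t) = t.
  defect : ℚ → ℚ
  defect t = F 1 (α t) + t * F 0 (α t)

  module Step {t τ : ℚ} (0≤t : 0ℚ ℚ.≤ t) (0≤τ : 0ℚ ℚ.≤ τ) (t+τ≤1 : t + τ ℚ.≤ 1ℚ) where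

    t≤1′ : t ℚ.≤ 1ℚ
    t≤1′ = ℚ.≤-trans (≤-add {t} 0≤τ) t+τ≤1

    τ≤1 : τ ℚ.≤ 1ℚ
    τ≤1 = ℚ.≤-trans (subst (τ ℚ.≤_) (ℚ.+-comm τ t) (≤-add {τ} 0≤t)) t+τ≤1

    δ ρ σ C S C⁺ S⁺ e₀ e₁ E : ℚ
    δ = α (t + τ) - α t
    ρ = δ - τ * β t
    σ = 1ℚ - (1ℚ + t * t) * β t
    C = F 0 (α t)
    S = F 1 (α t)
    C⁺ = F 0 (α t + δ)
    S⁺ = F 1 (α t + δ)
    e₀ = C⁺ - C - δ * S
    e₁ = S⁺ - S + δ * C
    E = τ * τ * (R′ * R′ * B + R) + τ * η

    α+δ : α t + δ ≡ α (t + τ)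
    α+δ = solve 2 (λ a b → a :+ (b :- a) := b) refl (α t) (α (t + τ))

    hα : ∣ α t ∣ℚ ℚ.≤ κ
    hα = α-bound 0≤t t≤1′

    hα⁺ : ∣ α t + δ ∣ℚ ℚ.≤ κ
    hα⁺ = subst (λ z → ∣ z ∣ℚ ℚ.≤ κ) (sym α+δ) (α-bound (0≤+ {t} 0≤t 0≤τ) t+τ≤1)

    hρ : ∣ ρ ∣ℚ ℚ.≤ R * (τ * τ)
    hρ = arctan-increment 0≤t 0≤τ t+τ≤1 0 m

    hβ : ∣ β t ∣ℚ ℚ.≤ 1ℚ
    hβ = ℚ.≤-trans (ℚ.≤-reflexive (ℚ.0≤p⇒∣p∣≡p (proj₁ (slope-bounds 0≤t t≤1′ 0 m)))) (proj₂ (slope-bounds 0≤t t≤1′ 0 m))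

    ∣τ∣ : ∣ τ ∣ℚ ℚ.≤ τ
    ∣τ∣ = ℚ.≤-reflexive (ℚ.0≤p⇒∣p∣≡p 0≤τ)

    ∣t∣ : ∣ t ∣ℚ ℚ.≤ t
    ∣t∣ = ℚ.≤-reflexive (ℚ.0≤p⇒∣p∣≡p 0≤t)

    hδ : ∣ δ ∣ℚ ℚ.≤ τ + R * (τ * τ)
    hδ = subst₂ (λ x y → ∣ x ∣ℚ ℚ.≤ y + R * (τ * τ)) (solve 2 (λ x y → x :+ (y :- x) := y) refl (τ * β t) δ) (ℚ.*-identityʳ τ)
      (abs-+ (τ * β t) ρ (∣*∣≤ τ (β t) ∣τ∣ hβ) hρ)

    hδ′ : ∣ δ ∣ℚ ℚ.≤ τ * R′
    hδ′ = ℚ.≤-trans hδ (ℚ.≤-trans (ℚ.+-monoʳ-≤ τ (*-monoˡ {R} 0≤R (*-monoˡ {τ} 0≤τ τ≤1)))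
      (ℚ.≤-reflexive (solve 2 (λ τ R → τ :+ R :* (τ :* con 1ℚ) := τ :* (con 1ℚ :+ R)) refl τ R)))

    increment≤E : δ * δ * B + ∣ δ ∣ℚ * η ℚ.≤ E
    increment≤E = begin
      δ * δ * B + ∣ δ ∣ℚ * η
        ≤⟨ ℚ.+-mono-≤ (*-monoʳ {B} 0≤B δδ≤) (*-monoʳ {η} 0≤η hδ) ⟩
      τ * R′ * (τ * R′) * B + (τ + R * (τ * τ)) * η
        ≡⟨ solve 5 (λ τ r R η B → τ :* r :* (τ :* r) :* B :+ (τ :+ R :* (τ :* τ)) :* η
             := τ :* τ :* (r :* r :* B) :+ τ :* η :+ R :* (τ :* τ) :* η) refl τ R′ R η B ⟩
      τ * τ * (R′ * R′ * B) + τ * η + R * (τ * τ) * η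
        ≤⟨ ℚ.+-monoʳ-≤ (τ * τ * (R′ * R′ * B) + τ * η) (*-monoˡ {R * (τ * τ)} (0≤* {R} 0≤R (0≤² τ)) η≤1) ⟩
      τ * τ * (R′ * R′ * B) + τ * η + R * (τ * τ) * 1ℚ
        ≡⟨ solve 4 (λ τ x R η → τ :* τ :* x :+ τ :* η :+ R :* (τ :* τ) :* con 1ℚ := τ :* τ :* (x :+ R) :+ τ :* η) refl τ (R′ * R′ * B) R η ⟩
      E ∎
      where
      open ℚ.≤-Reasoning
      δδ≤ : δ * δ ℚ.≤ τ * R′ * (τ * R′)
      δδ≤ = ℚ.≤-trans (ℚ.≤-reflexive (trans (sym (ℚ.0≤p⇒∣p∣≡p (0≤² δ))) (ℚ.∣p*q∣≡∣p∣*∣q∣ δ δ)))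
        (*-mono {∣ δ ∣ℚ} {τ * R′} {∣ δ ∣ℚ} {τ * R′} (ℚ.0≤∣p∣ δ) (ℚ.0≤∣p∣ δ) hδ′ hδ′)

    he₀ : ∣ e₀ ∣ℚ ℚ.≤ E
    he₀ = ℚ.≤-trans (F-increment 0 (α t) δ hα hα⁺) increment≤E

    he₁ : ∣ e₁ ∣ℚ ℚ.≤ E
    he₁ = ℚ.≤-trans (F-increment′ 0 (α t) δ hα hα⁺) increment≤E

    hC : ∣ C ∣ℚ ℚ.≤ B
    hC = F-bound 0 (α t) hα

    hS : ∣ S ∣ℚ ℚ.≤ B
    hS = F-bound 1 (α t) hα

    -- The linearised equation for tan α − t has growth rate t α′ ≤ t and source C (1 − (1 + t²) α′).
    expand : S⁺ + (t + τ) * C⁺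
      ≡ (S + t * C) + τ * t * β t * (S + t * C) + (τ * (σ * C) + (ρ * (t * S - C) + (τ * (δ * S) + (e₁ + (t + τ) * e₀))))
    expand = solve 8 (λ t τ δ b C S C⁺ S⁺ → S⁺ :+ (t :+ τ) :* C⁺
      := (S :+ t :* C) :+ τ :* t :* b :* (S :+ t :* C) :+ (τ :* ((con 1ℚ :- (con 1ℚ :+ t :* t) :* b) :* C)
           :+ ((δ :- τ :* b) :* (t :* S :- C) :+ (τ :* (δ :* S) :+ ((S⁺ :- S :+ δ :* C) :+ (t :+ τ) :* (C⁺ :- C :- δ :* S))))))
      refl t τ δ (β t) C S C⁺ S⁺

    source : ℚ
    source = τ * (t ^ℚ e * B) + (R * (τ * τ) * (B + B) + (τ * (τ * R′ * B) + (E + E)))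

    source≡ : source ≡ τ * (t ^ℚ e * B) + τ * ((η + η) + τ * A)
    source≡ = solve 6 (λ τ x R r B η → τ :* (x :* B) :+ (R :* (τ :* τ) :* (B :+ B) :+ (τ :* (τ :* r :* B)
        :+ ((τ :* τ :* (r :* r :* B :+ R) :+ τ :* η) :+ (τ :* τ :* (r :* r :* B :+ R) :+ τ :* η))))
      := τ :* (x :* B) :+ τ :* ((η :+ η) :+ τ :* (R :* (B :+ B) :+ r :* B :+ ((r :* r :* B :+ R) :+ (r :* r :* B :+ R))))) refl τ (t ^ℚ e) R R′ B η

    0≤source : 0ℚ ℚ.≤ source
    0≤source = subst (0ℚ ℚ.≤_) (sym source≡) (0≤+ {τ * (t ^ℚ e * B)}
      (0≤* {τ} 0≤τ (0≤* {t ^ℚ e} (^-nonNeg e 0≤t) 0≤B))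
      (0≤* {τ} 0≤τ (0≤+ {η + η} (0≤+ {η} 0≤η 0≤η) (0≤* {τ} 0≤τ 0≤A))))

    defect-step : ∣ defect (t + τ) ∣ℚ ℚ.≤ (1ℚ + τ * t) * ∣ defect t ∣ℚ + source
    defect-step = subst₂ ℚ._≤_
      (cong ∣_∣ℚ (trans (sym expand) (cong (λ z → F 1 z + (t + τ) * F 0 z) α+δ)))
      (cong (_+ source) (solve 2 (λ d x → d :+ x :* con 1ℚ :* d := (con 1ℚ :+ x) :* d) refl (∣ defect t ∣ℚ) (τ * t)))
      (abs-+ (defect t + τ * t * β t * defect t) (τ * (σ * C) + (ρ * (t * S - C) + (τ * (δ * S) + (e₁ + (t + τ) * e₀))))
        (abs-+ (defect t) (τ * t * β t * defect t) ℚ.≤-refl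
          (∣*∣≤ (τ * t * β t) (defect t) (∣*∣≤ (τ * t) (β t) (∣*∣≤ τ t ∣τ∣ ∣t∣) hβ) ℚ.≤-refl))
        (abs-+ (τ * (σ * C)) (ρ * (t * S - C) + (τ * (δ * S) + (e₁ + (t + τ) * e₀)))
          (∣*∣≤ τ (σ * C) ∣τ∣ (∣*∣≤ σ C (slope-defect 0≤t t≤1′ 0 m) hC))
          (abs-+ (ρ * (t * S - C)) (τ * (δ * S) + (e₁ + (t + τ) * e₀))
            (∣*∣≤ ρ (t * S - C) hρ (abs-+ (t * S) (- C) tS (abs-neg C hC)))
            (abs-+ (τ * (δ * S)) (e₁ + (t + τ) * e₀) (∣*∣≤ τ (δ * S) ∣τ∣ (∣*∣≤ δ S hδ′ hS))
              (abs-+ e₁ ((t + τ) * e₀) he₁ te₀)))))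
      where
      ≤1* : ∀ {x y} → x ℚ.≤ 1ℚ * y → x ℚ.≤ y
      ≤1* {x} {y} = subst (x ℚ.≤_) (ℚ.*-identityˡ y)
      tS : ∣ t * S ∣ℚ ℚ.≤ B
      tS = ≤1* (∣*∣≤ t S (ℚ.≤-trans ∣t∣ t≤1′) hS)
      te₀ : ∣ (t + τ) * e₀ ∣ℚ ℚ.≤ E
      te₀ = ≤1* (∣*∣≤ (t + τ) e₀ (ℚ.≤-trans (ℚ.≤-reflexive (ℚ.0≤p⇒∣p∣≡p (0≤+ {t} 0≤t 0≤τ))) t+τ≤1) he₀)

  envelope : ℚ → ℚ → ℚ
  envelope τ t = B * (recip e * t ^ℚ suc e) + t * ((η + η) + τ * A)

  0≤envelope : ∀ {τ t} → 0ℚ ℚ.≤ τ → 0ℚ ℚ.≤ t → 0ℚ ℚ.≤ envelope τ t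
  0≤envelope {τ} {t} 0≤τ 0≤t = 0≤+ {B * (recip e * t ^ℚ suc e)}
    (0≤* {B} 0≤B (0≤* {recip e} (0≤recip e) (^-nonNeg (suc e) 0≤t)))
    (0≤* {t} 0≤t (0≤+ {η + η} (0≤+ {η} 0≤η 0≤η) (0≤* {τ} 0≤τ 0≤A)))

  module _ {t τ : ℚ} (0≤t : 0ℚ ℚ.≤ t) (0≤τ : 0ℚ ℚ.≤ τ) (t+τ≤1 : t + τ ℚ.≤ 1ℚ) where

    open Step 0≤t 0≤τ t+τ≤1

    envelope-step : envelope τ t + source ℚ.≤ envelope τ (t + τ)
    envelope-step = 0≤⇒≤ {envelope τ t + source} {envelope τ (t + τ)} (B * (recip e * powerRemainder e t τ))
      (0≤* {B} 0≤B (0≤* {recip e} (0≤recip e) (0≤powerRemainder 0≤t 0≤τ t+τ≤1 e)))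
      (begin
        B * (r * x⁺) + (t + τ) * h
          ≡⟨ solve 8 (λ B r x⁺ x y t τ h → B :* (r :* x⁺) :+ (t :+ τ) :* h
               := (B :* (r :* x) :+ t :* h) :+ (τ :* h :+ B :* y) :+ (B :* (r :* (x⁺ :- x)) :- B :* y)) refl B r x⁺ x (τ * t ^ℚ e) t τ h ⟩
        envelope τ t + (τ * h + B * (τ * t ^ℚ e)) + (B * (r * (x⁺ - x)) - B * (τ * t ^ℚ e))
          ≡⟨ cong₂ (λ u v → envelope τ t + u + (B * (r * (x⁺ - x)) - B * v))
               (trans (solve 4 (λ τ h B y → τ :* h :+ B :* (τ :* y) := τ :* (y :* B) :+ τ :* h) refl τ h B (t ^ℚ e)) (sym source≡))
               (sym (ExpCauchy.recip*ι e (τ * t ^ℚ e))) ⟩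
        envelope τ t + source + (B * (r * (x⁺ - x)) - B * (r * (ι (suc e) * (τ * t ^ℚ e))))
          ≡⟨ cong (λ z → envelope τ t + source + z) (solve 5 (λ B r x⁺ x y → B :* (r :* (x⁺ :- x)) :- B :* (r :* y) := B :* (r :* (x⁺ :- x :- y))) refl B r x⁺ x (ι (suc e) * (τ * t ^ℚ e))) ⟩
        envelope τ t + source + B * (r * powerRemainder e t τ) ∎)
      where
      open ≡-Reasoning
      r x x⁺ h : ℚ
      r = recip e
      x = t ^ℚ suc e
      x⁺ = (t + τ) ^ℚ suc e
      h = (η + η) + τ * A

    defect-induct : ∣ defect t ∣ℚ ℚ.≤ (1ℚ + t * t) * envelope τ t → ∣ defect (t + τ) ∣ℚ ℚ.≤ (1ℚ + (t + τ) * (t + τ)) * envelope τ (t + τ)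
    defect-induct ih = begin
      ∣ defect (t + τ) ∣ℚ
        ≤⟨ defect-step ⟩
      (1ℚ + τ * t) * ∣ defect t ∣ℚ + source
        ≤⟨ ℚ.+-monoˡ-≤ source (*-monoˡ {1ℚ + τ * t} (0≤+ {1ℚ} 0≤1 (0≤* {τ} 0≤τ 0≤t)) ih) ⟩
      (1ℚ + τ * t) * ((1ℚ + t * t) * G) + source
        ≡⟨ cong (_+ source) (ℚ.*-assoc (1ℚ + τ * t) (1ℚ + t * t) G) ⟨
      (1ℚ + τ * t) * (1ℚ + t * t) * G + source
        ≤⟨ ℚ.+-mono-≤ (*-monoʳ {G} (0≤envelope 0≤τ 0≤t) weights) one ⟩
      W * G + W * source
        ≡⟨ ℚ.*-distribˡ-+ W G source ⟨
      W * (G + source)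
        ≤⟨ *-monoˡ {W} 0≤W envelope-step ⟩
      W * envelope τ (t + τ) ∎
      where
      open ℚ.≤-Reasoning
      G W : ℚ
      G = envelope τ t
      W = 1ℚ + (t + τ) * (t + τ)
      0≤W : 0ℚ ℚ.≤ W
      0≤W = 0≤+ {1ℚ} 0≤1 (0≤² (t + τ))
      weights : (1ℚ + τ * t) * (1ℚ + t * t) ℚ.≤ W
      weights = 0≤⇒≤ {(1ℚ + τ * t) * (1ℚ + t * t)} {W} (τ * τ + τ * t * (1ℚ - t * t))
        (0≤+ {τ * τ} (0≤² τ) (0≤* {τ * t} (0≤* {τ} 0≤τ 0≤t)
          (≤⇒0≤ (*-mono {t} {1ℚ} {t} {1ℚ} 0≤t 0≤t t≤1′ t≤1′))))
        (solve 2 (λ t τ → con 1ℚ :+ (t :+ τ) :* (t :+ τ)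
          := (con 1ℚ :+ τ :* t) :* (con 1ℚ :+ t :* t) :+ (τ :* τ :+ τ :* t :* (con 1ℚ :- t :* t))) refl t τ)
      one : source ℚ.≤ W * source
      one = 0≤⇒≤ {source} {W * source} ((t + τ) * (t + τ) * source) (0≤* {(t + τ) * (t + τ)} (0≤² (t + τ)) 0≤source)
        (solve 2 (λ x s → (con 1ℚ :+ x) :* s := s :+ x :* s) refl ((t + τ) * (t + τ)) source)

  defect-grid : ∀ l i → i ℕ.≤ suc l →
    ∣ defect (ι i * recip l) ∣ℚ ℚ.≤ (1ℚ + (ι i * recip l) * (ι i * recip l)) * envelope (recip l) (ι i * recip l)
  defect-grid l zero i≤ = ℚ.≤-trans (ℚ.≤-reflexive (cong ∣_∣ℚ zero-defect))
    (0≤* {1ℚ + (ι 0 * recip l) * (ι 0 * recip l)} (0≤+ {1ℚ} 0≤1 (0≤² (ι 0 * recip l))) (0≤envelope (0≤recip l) (0≤ι*recip 0 l)))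
    where
    zero-defect : defect (ι 0 * recip l) ≡ 0ℚ
    zero-defect = trans (cong defect (ℚ.*-zeroˡ (recip l))) (trans
      (cong (λ z → F 1 z + 0ℚ * F 0 z) (arctan-0 0 m)) (trans (cong₂ _+_ F-1 (ℚ.*-zeroˡ (F 0 0ℚ))) refl))
  defect-grid l (suc i) i< = subst (λ t → ∣ defect t ∣ℚ ℚ.≤ (1ℚ + t * t) * envelope (recip l) t) (sym (ι-suc*recip i l))
    (defect-induct (0≤ι*recip i l) (0≤recip l) (subst (ℚ._≤ 1ℚ) (ι-suc*recip i l) (ι*recip≤1 l i<))
      (defect-grid l i (ℕ.<⇒≤ i<)))

  quarter-turn : ∣ F 1 (leibniz 0 m) + F 0 (leibniz 0 m) ∣ℚ ℚ.≤ (B * recip e + (η + η)) + (B * recip e + (η + η))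
  quarter-turn = limit-≤ {A = A + A} (0≤+ {A} 0≤A 0≤A) λ l → subst₂ ℚ._≤_
    (cong ∣_∣ℚ (trans (cong defect (ι*recip l)) (trans (cong (λ z → F 1 z + 1ℚ * F 0 z) (arctan-1 0 m))
      (cong (λ z → F 1 (leibniz 0 m) + z) (ℚ.*-identityˡ (F 0 (leibniz 0 m)))))))
    (trans (cong (λ t → (1ℚ + t * t) * envelope (recip l) t) (ι*recip l))
      (trans (cong (λ z → (1ℚ + 1ℚ * 1ℚ) * (B * (recip e * z) + 1ℚ * ((η + η) + recip l * A))) (1^ (suc e)))
        (solve 5 (λ B r η l A → (con 1ℚ :+ con 1ℚ :* con 1ℚ) :* (B :* (r :* con 1ℚ) :+ con 1ℚ :* ((η :+ η) :+ l :* A))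
          := l :* (A :+ A) :+ ((B :* r :+ (η :+ η)) :+ (B :* r :+ (η :+ η)))) refl B (recip e) η (recip l) A)))
    (defect-grid l (suc l) ℕ.≤-refl)

eighth quarter half : ℚ
eighth = + 1 / 8
quarter = eighth + eighth
half = quarter + quarter

module CircleFunctions where

  open +-*-Solver using (solve; _:+_; _:*_; _:-_; :-_; con; _:=_)
  angle : ℕ → ℚ → ℚ
  angle n q = + 2 / 1 * (+ 4 / 1 * leibniz 0 n) * q

  cos sin : ℚ → Expr
  cos q = realPart (exp (0ℝ +i (fromℕ 2 *ℝ π *ℝ fromℚ q)))
  sin q = imagPart (exp (0ℝ +i (fromℕ 2 *ℝ π *ℝ fromℚ q)))

  value-cos : ∀ q n → value (cos q) n ≡ osc n 0 (angle n q)
  value-cos q n = cong ℚ[i].re (expSum≡ (angle n q) n)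

  value-sin : ∀ q n → value (sin q) n ≡ - osc n 1 (angle n q)
  value-sin q n = cong ℚ[i].im (expSum≡ (angle n q) n)

  angle-bound : ∀ n q → ∣ angle n q ∣ℚ ℚ.≤ + 8 / 1 * ∣ q ∣ℚ
  angle-bound n q = subst (ℚ._≤ + 8 / 1 * ∣ q ∣ℚ)
    (trans (cong (_* ∣ q ∣ℚ) (trans (sym (ℚ.0≤p⇒∣p∣≡p (0≤* {+ 8 / 1} (0≤ι 8) (LeibnizLemmas.leibniz-lower 0 n))))
      (cong ∣_∣ℚ (solve 1 (λ l → con (+ 8 / 1) :* l := con (+ 2 / 1) :* (con (+ 4 / 1) :* l)) refl (leibniz 0 n)))))
      (sym (ℚ.∣p*q∣≡∣p∣*∣q∣ (+ 2 / 1 * (+ 4 / 1 * leibniz 0 n)) q)))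
    (*-monoʳ {∣ q ∣ℚ} (ℚ.0≤∣p∣ q) (ℚ.≤-trans (*-monoˡ {+ 8 / 1} (0≤ι 8) (LeibnizLemmas.leibniz-upper 0 n))
      (ℚ.≤-reflexive (ℚ.*-identityʳ (+ 8 / 1)))))

  module Truncated (K n′ : ℕ) (M≤n′ : K ℕ.+ K ℕ.≤ n′) where

    open ExpCauchy.Majorant K using (b; 0≤b; B; total-bound; 0≤total)
    open Bounds K using (osc-bound; increment)

    F : ℕ → ℚ → ℚ
    F = osc (suc (suc n′))

    η : ℚ
    η = b (suc n′)

    F-bound : ∀ j θ → ∣ θ ∣ℚ ℚ.≤ ι K → ∣ F j θ ∣ℚ ℚ.≤ B
    F-bound j θ hθ = ℚ.≤-trans (osc-bound (suc (suc n′)) j hθ)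
      (total-bound (suc (suc n′)) (ℕ.m≤n⇒m≤1+n (ℕ.m≤n⇒m≤1+n M≤n′)))

    F-increment : ∀ j θ δ → ∣ θ ∣ℚ ℚ.≤ ι K → ∣ θ + δ ∣ℚ ℚ.≤ ι K →
      ∣ F j (θ + δ) - F j θ - δ * F (suc j) θ ∣ℚ ℚ.≤ δ * δ * B + ∣ δ ∣ℚ * η
    F-increment j θ δ hθ hθ+δ = ℚ.≤-trans (increment hθ hθ+δ n′ j)
      (ℚ.+-monoˡ-≤ (∣ δ ∣ℚ * η) (*-monoˡ {δ * δ} (0≤² δ) (total-bound n′ M≤n′)))

    open Subtraction F (ι K) B η (0≤b (suc n′)) (osc-2 (suc (suc n′))) F-bound F-increment
      (osc-0 (suc n′) 0) (osc-0 (suc n′) 1) public using (subtraction)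

  eventually-truncated : ∀ K ε → 0ℚ ℚ.< ε → Σ ℕ λ N → ∀ n → N ℕ.≤ n →
    Σ ℕ λ n′ → n ≡ suc (suc n′) × K ℕ.+ K ℕ.≤ n′ × ExpCauchy.Majorant.b K (suc n′) ℚ.≤ ε
  eventually-truncated K ε 0<ε = suc (suc (M ℕ.+ N)) , go
    where
    open ExpCauchy.Majorant K using (M; b-small)
    N = proj₁ (b-small ε 0<ε)
    go : ∀ n → suc (suc (M ℕ.+ N)) ℕ.≤ n → _
    go (suc (suc n)) (ℕ.s≤s (ℕ.s≤s le)) = n , refl , ℕ.m+n≤o⇒m≤o M le ,
      proj₂ (b-small ε 0<ε) (suc n) (ℕ.m≤n⇒m≤1+n (ℕ.m+n≤o⇒n≤o M le))

  osc-subtraction : ∀ j q r ε → 0ℚ ℚ.< ε → Σ ℕ λ N → ∀ n → N ℕ.≤ n →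
    ∣ osc n j (angle n q) * osc n 0 (angle n r) + osc n (suc j) (angle n q) * osc n 1 (angle n r) - osc n j (angle n (q - r)) ∣ℚ ℚ.≤ ε
  osc-subtraction j q r ε 0<ε = proj₁ large , λ n n≥ → go n (proj₂ large n n≥)
    where
    u v : ℚ
    u = + 8 / 1 * ∣ q - r ∣ℚ
    v = + 8 / 1 * ∣ r ∣ℚ
    K : ℕ
    K = ℤ.∣ ℚ.↥ (u + v) ∣
    B = ExpCauchy.Majorant.B K
    C : ℚ
    C = (B + B + B + B) * v
    0≤4B : 0ℚ ℚ.≤ B + B + B + B
    0≤4B = 0≤+ {B + B + B} (0≤+ {B + B} (0≤+ {B} h h) h) h
      where h = ExpCauchy.Majorant.0≤B K
    0≤v : 0ℚ ℚ.≤ v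
    0≤v = 0≤* {+ 8 / 1} (0≤ι 8) (ℚ.0≤∣p∣ r)
    δ : Σ ℚ λ d → 0ℚ ℚ.< d × (1ℚ + C) * d ≡ ε
    δ = scale-down {1ℚ + C} {ε} (0<1+ {C} (0≤* {B + B + B + B} 0≤4B 0≤v)) 0<ε
    d = proj₁ δ
    large = eventually-truncated K d (proj₁ (proj₂ δ))
    go : ∀ n → (Σ ℕ λ n′ → n ≡ suc (suc n′) × K ℕ.+ K ℕ.≤ n′ × ExpCauchy.Majorant.b K (suc n′) ℚ.≤ d) → _
    go n (n′ , refl , M≤n′ , η≤d) = ℚ.≤-trans
      (subst (λ z → ∣ osc n j z * osc n 0 θ + osc n (suc j) z * osc n 1 θ - osc n j w ∣ℚ ℚ.≤ (B + B + B + B) * (∣ θ ∣ℚ * η))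
        (trans (sym (ℚ.*-distribˡ-+ k (q - r) r)) (cong (k *_) (solve 2 (λ q r → (q :- r) :+ r := q) refl q r)))
        (subtraction j w θ (ℚ.≤-trans (ℚ.+-mono-≤ (angle-bound n (q - r)) (angle-bound n r)) (archimedean (u + v)))))
      (ℚ.≤-trans (*-monoˡ {B + B + B + B} 0≤4B (*-mono {∣ θ ∣ℚ} {v} {η} {d} (ℚ.0≤∣p∣ θ) (ExpCauchy.Majorant.0≤b K (suc n′)) (angle-bound n r) η≤d))
        (subst₂ ℚ._≤_ (ℚ.*-assoc (B + B + B + B) v d) (proj₂ (proj₂ δ)) (*-monoʳ {d} (ℚ.<⇒≤ (proj₁ (proj₂ δ))) (≤1+ C))))
      where
      open Truncated K n′ M≤n′
      k θ w : ℚ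
      k = + 2 / 1 * (+ 4 / 1 * leibniz 0 n)
      θ = angle n r
      w = angle n (q - r)

  ≈-by : ∀ {x y} {f g : ℕ → ℚ} → (∀ n → value x n ≡ f n) → (∀ n → value y n ≡ g n) →
    (∀ ε → 0ℚ ℚ.< ε → Σ ℕ λ N → ∀ n → N ℕ.≤ n → ∣ f n - g n ∣ℚ ℚ.≤ ε) → x ≈ y
  ≈-by hx hy h = mk≈ λ ε 0<ε → proj₁ (h ε 0<ε) , λ n n≥ →
    subst₂ (λ a b → ∣ a - b ∣ℚ ℚ.≤ ε) (sym (hx n)) (sym (hy n)) (proj₂ (h ε 0<ε) n n≥)

  cos-sub : ∀ q r → cos (q - r) ≈ cos q ⊗ cos r ⊕ sin q ⊗ sin r
  cos-sub q r = ≈-sym (≈-by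
    (λ n → trans (cong₂ _+_ (cong₂ _*_ (value-cos q n) (value-cos r n)) (cong₂ _*_ (value-sin q n) (value-sin r n)))
      (cong (λ z → osc n 0 (angle n q) * osc n 0 (angle n r) + z)
        (solve 2 (λ a b → :- a :* :- b := a :* b) refl (osc n 1 (angle n q)) (osc n 1 (angle n r)))))
    (value-cos (q - r)) (osc-subtraction 0 q r))

  sin-sub : ∀ q r → sin (q - r) ≈ sin q ⊗ cos r ⊖ cos q ⊗ sin r
  sin-sub q r = ≈-sym (≈-by
    (λ n → trans (cong₂ _-_ (cong₂ _*_ (value-sin q n) (value-cos r n)) (cong₂ _*_ (value-cos q n) (value-sin r n))) refl)
    (value-sin (q - r))
    (λ ε 0<ε → proj₁ (osc-subtraction 1 q r ε 0<ε) , λ n n≥ → subst (ℚ._≤ ε)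
      (trans (sym (ℚ.∣-p∣≡∣p∣ _)) (cong ∣_∣ℚ (trans
        (cong (λ z → - (osc n 1 (angle n q) * osc n 0 (angle n r) + z * osc n 1 (angle n r) - osc n 1 (angle n (q - r)))) (osc-2 n 0 (angle n q)))
        (solve 5 (λ a b c d e → :- (a :* b :+ (:- c) :* d :- e) := (:- a :* b :- c :* (:- d)) :- (:- e)) refl
          (osc n 1 (angle n q)) (osc n 0 (angle n r)) (osc n 0 (angle n q)) (osc n 1 (angle n r)) (osc n 1 (angle n (q - r)))))))
      (proj₂ (osc-subtraction 1 q r ε 0<ε) n n≥)))

  angle-0 : ∀ n → angle n 0ℚ ≡ 0ℚ
  angle-0 n = ℚ.*-zeroʳ (+ 2 / 1 * (+ 4 / 1 * leibniz 0 n))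

  ≈-eventually : ∀ {x y} N → (∀ n → N ℕ.≤ n → value x n ≡ value y n) → x ≈ y
  ≈-eventually {x} {y} N eq = mk≈ λ ε 0<ε → N , λ n n≥ → subst (λ z → ∣ z ∣ℚ ℚ.≤ ε)
    (sym (trans (cong (_- value y n) (eq n n≥)) (ℚ.+-inverseʳ (value y n)))) (ℚ.<⇒≤ 0<ε)

  cos-0 : cos 0ℚ ≈ 1ᴱ
  cos-0 = ≈-eventually 1 λ where
    (suc n) _ → trans (value-cos 0ℚ (suc n)) (trans (cong (osc (suc n) 0) (angle-0 (suc n))) (osc-0 n 0))

  sin-0 : sin 0ℚ ≈ 0ᴱ
  sin-0 = ≈-eventually 1 λ where
    (suc n) _ → trans (value-sin 0ℚ (suc n)) (cong -_ (trans (cong (osc (suc n) 1) (angle-0 (suc n))) (osc-0 n 1)))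

  sin-eighth : sin eighth ≈ cos eighth
  sin-eighth = mk≈ λ ε 0<ε →
    let ¼ε = ½ * (½ * ε)
        ⅛ε = ½ * ¼ε
        0<¼ε = 0<½* {½ * ε} (0<½* {ε} 0<ε)
        0<⅛ε = 0<½* {¼ε} 0<¼ε
        N₁ , small = scaled-recip-small {B} {¼ε} 0≤B 0<¼ε
        N₂ , large = eventually-truncated 1 ⅛ε 0<⅛ε
        N₃ , large₁ = eventually-truncated 1 1ℚ 0<1
    in N₁ ℕ.+ (N₂ ℕ.+ N₃) , λ n n≥ → subst (ℚ._≤ ε)
      (trans (sym (ℚ.∣-p∣≡∣p∣ (osc n 1 (leibniz 0 n) + osc n 0 (leibniz 0 n)))) (cong ∣_∣ℚ (trans
        (solve 2 (λ s c → :- (s :+ c) := :- s :- c) refl (osc n 1 (leibniz 0 n)) (osc n 0 (leibniz 0 n)))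
        (sym (cong₂ _-_ (trans (value-sin eighth n) (cong (λ z → - osc n 1 z) (angle-eighth n)))
          (trans (value-cos eighth n) (cong (osc n 0) (angle-eighth n))))))))
      (bound {ε} {⅛ε} {¼ε} n refl refl
        (proj₂ (scaled-recip-small {B} {¼ε} 0≤B 0<¼ε) (n ℕ.+ n) (ℕ.≤-trans (ℕ.m+n≤o⇒m≤o N₁ n≥) (ℕ.m≤m+n n n)))
        (large n (ℕ.m+n≤o⇒m≤o N₂ (ℕ.m+n≤o⇒n≤o N₁ n≥)))
        (large₁ n (ℕ.m+n≤o⇒n≤o N₂ (ℕ.m+n≤o⇒n≤o N₁ n≥))))
    where
    angle-eighth : ∀ n → angle n eighth ≡ leibniz 0 n
    angle-eighth n = solve 1 (λ l → con (+ 2 / 1) :* (con (+ 4 / 1) :* l) :* con eighth := l) refl (leibniz 0 n)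
    open ExpCauchy.Majorant 1 using (B; 0≤B; b; 0≤b)
    bound : ∀ {ε d c} n → d ≡ ½ * c → c ≡ ½ * (½ * ε) → recip (n ℕ.+ n) * B ℚ.≤ c →
      (Σ ℕ λ n′ → n ≡ suc (suc n′) × 2 ℕ.≤ n′ × b (suc n′) ℚ.≤ d) →
      (Σ ℕ λ n′ → n ≡ suc (suc n′) × 2 ℕ.≤ n′ × b (suc n′) ℚ.≤ 1ℚ) →
      ∣ osc n 1 (leibniz 0 n) + osc n 0 (leibniz 0 n) ∣ℚ ℚ.≤ ε
    bound {ε} {d} {c} n d≡ c≡ Br≤ (n′ , refl , 2≤n′ , η≤d) (_ , refl , _ , η≤1) = result
      where
      open Truncated 1 n′ 2≤n′
      open QuarterTurn F (ι 1) B η ℚ.≤-refl (0≤b (suc n′)) η≤1 (osc-2 n) F-bound F-increment (osc-0 (suc n′) 0) (osc-0 (suc n′) 1) n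
        using (quarter-turn)
      half-bound : B * recip (n ℕ.+ n) + (η + η) ℚ.≤ ½ * ε
      half-bound = subst (B * recip (n ℕ.+ n) + (η + η) ℚ.≤_)
        (trans (cong (λ z → c + z) (trans (cong₂ _+_ d≡ d≡) (halves c))) (trans (cong₂ _+_ c≡ c≡) (halves (½ * ε))))
        (ℚ.+-mono-≤ (subst (ℚ._≤ c) (ℚ.*-comm (recip (n ℕ.+ n)) B) Br≤) (ℚ.+-mono-≤ η≤d η≤d))
      result : ∣ osc n 1 (leibniz 0 n) + osc n 0 (leibniz 0 n) ∣ℚ ℚ.≤ ε
      result = ℚ.≤-trans quarter-turn (ℚ.≤-trans (ℚ.+-mono-≤ half-bound half-bound) (ℚ.≤-reflexive (halves ε)))

module UnitCircle
  (cos sin : ℚ → Expr)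
  (cos-sub : ∀ q r → cos (q - r) ≈ cos q ⊗ cos r ⊕ sin q ⊗ sin r)
  (sin-sub : ∀ q r → sin (q - r) ≈ sin q ⊗ cos r ⊖ cos q ⊗ sin r)
  (cos-0 : cos 0ℚ ≈ 1ᴱ) (sin-0 : sin 0ℚ ≈ 0ᴱ)
  (sin-eighth : sin eighth ≈ cos eighth) where

  open +-*-Solver using (solve; _:+_; _:*_; _:-_; :-_; con; _:=_)
  open ≈-Reasoning

  cos-neg : ∀ q → cos (- q) ≈ cos q
  cos-neg q = begin
    cos (- q)                             ≈⟨ ≡⇒≈ cos (sym (ℚ.+-identityˡ (- q))) ⟩
    cos (0ℚ - q)                          ≈⟨ cos-sub 0ℚ q ⟩
    cos 0ℚ ⊗ cos q ⊕ sin 0ℚ ⊗ sin q       ≈⟨ +-cong (*-cong cos-0 (≈-refl {cos q})) (*-cong sin-0 (≈-refl {sin q})) ⟩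
    1ᴱ ⊗ cos q ⊕ 0ᴱ ⊗ sin q               ≗⟨ (λ n → solve 2 (λ c s → con 1ℚ :* c :+ con 0ℚ :* s := c) refl (value (cos q) n) (value (sin q) n)) ⟩
    cos q                                 ∎

  sin-neg : ∀ q → sin (- q) ≈ 0ᴱ ⊖ sin q
  sin-neg q = begin
    sin (- q)                             ≈⟨ ≡⇒≈ sin (sym (ℚ.+-identityˡ (- q))) ⟩
    sin (0ℚ - q)                          ≈⟨ sin-sub 0ℚ q ⟩
    sin 0ℚ ⊗ cos q ⊖ cos 0ℚ ⊗ sin q       ≈⟨ -‿cong (*-cong sin-0 (≈-refl {cos q})) (*-cong cos-0 (≈-refl {sin q})) ⟩
    0ᴱ ⊗ cos q ⊖ 1ᴱ ⊗ sin q               ≗⟨ (λ n → solve 2 (λ c s → con 0ℚ :* c :- con 1ℚ :* s := con 0ℚ :- s) refl (value (cos q) n) (value (sin q) n)) ⟩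
    0ᴱ ⊖ sin q                            ∎

  cos-add : ∀ q r → cos (q + r) ≈ cos q ⊗ cos r ⊖ sin q ⊗ sin r
  cos-add q r = begin
    cos (q + r)                                   ≈⟨ ≡⇒≈ cos (solve 2 (λ q r → q :+ r := q :- (:- r)) refl q r) ⟩
    cos (q - (- r))                               ≈⟨ cos-sub q (- r) ⟩
    cos q ⊗ cos (- r) ⊕ sin q ⊗ sin (- r)         ≈⟨ +-cong (*-cong (≈-refl {cos q}) (cos-neg r)) (*-cong (≈-refl {sin q}) (sin-neg r)) ⟩
    cos q ⊗ cos r ⊕ sin q ⊗ (0ᴱ ⊖ sin r)          ≗⟨ (λ n → solve 4 (λ a b c d → a :* b :+ c :* (con 0ℚ :- d) := a :* b :- c :* d) refl (value (cos q) n) (value (cos r) n) (value (sin q) n) (value (sin r) n)) ⟩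
    cos q ⊗ cos r ⊖ sin q ⊗ sin r                 ∎

  sin-add : ∀ q r → sin (q + r) ≈ sin q ⊗ cos r ⊕ cos q ⊗ sin r
  sin-add q r = begin
    sin (q + r)                                   ≈⟨ ≡⇒≈ sin (solve 2 (λ q r → q :+ r := q :- (:- r)) refl q r) ⟩
    sin (q - (- r))                               ≈⟨ sin-sub q (- r) ⟩
    sin q ⊗ cos (- r) ⊖ cos q ⊗ sin (- r)         ≈⟨ -‿cong (*-cong (≈-refl {sin q}) (cos-neg r)) (*-cong (≈-refl {cos q}) (sin-neg r)) ⟩
    sin q ⊗ cos r ⊖ cos q ⊗ (0ᴱ ⊖ sin r)          ≗⟨ (λ n → solve 4 (λ a b c d → a :* b :- c :* (con 0ℚ :- d) := a :* b :+ c :* d) refl (value (sin q) n) (value (cos r) n) (value (cos q) n) (value (sin r) n)) ⟩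
    sin q ⊗ cos r ⊕ cos q ⊗ sin r                 ∎

  pythagoras : ∀ q → cos q ⊗ cos q ⊕ sin q ⊗ sin q ≈ 1ᴱ
  pythagoras q = ≈-trans (≈-sym (cos-sub q q)) (≈-trans (≡⇒≈ cos (ℚ.+-inverseʳ q)) cos-0)

  cos-quarter : cos quarter ≈ 0ᴱ
  cos-quarter = begin
    cos quarter                                            ≈⟨ cos-add eighth eighth ⟩
    cos eighth ⊗ cos eighth ⊖ sin eighth ⊗ sin eighth      ≈⟨ -‿cong ≈-refl (*-cong sin-eighth sin-eighth) ⟩
    cos eighth ⊗ cos eighth ⊖ cos eighth ⊗ cos eighth      ≗⟨ (λ n → ℚ.+-inverseʳ (value (cos eighth ⊗ cos eighth) n)) ⟩
    0ᴱ                                                     ∎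

  sin-quarter : sin quarter ≈ 1ᴱ
  sin-quarter = begin
    sin quarter                                            ≈⟨ sin-add eighth eighth ⟩
    sin eighth ⊗ cos eighth ⊕ cos eighth ⊗ sin eighth      ≈⟨ +-cong (*-cong sin-eighth ≈-refl) (*-cong (≈-sym sin-eighth) ≈-refl) ⟩
    cos eighth ⊗ cos eighth ⊕ sin eighth ⊗ sin eighth      ≈⟨ pythagoras eighth ⟩
    1ᴱ                                                     ∎

  cos-half : cos half ≈ const (- 1ℚ)
  cos-half = begin
    cos half                                               ≈⟨ cos-add quarter quarter ⟩
    cos quarter ⊗ cos quarter ⊖ sin quarter ⊗ sin quarter  ≈⟨ -‿cong (*-cong cos-quarter cos-quarter) (*-cong sin-quarter sin-quarter) ⟩
    0ᴱ ⊗ 0ᴱ ⊖ 1ᴱ ⊗ 1ᴱ                                      ≗⟨ (λ n → refl) ⟩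
    const (- 1ℚ)                                           ∎

  sin-half : sin half ≈ 0ᴱ
  sin-half = begin
    sin half                                               ≈⟨ sin-add quarter quarter ⟩
    sin quarter ⊗ cos quarter ⊕ cos quarter ⊗ sin quarter  ≈⟨ +-cong (*-cong sin-quarter cos-quarter) (*-cong cos-quarter sin-quarter) ⟩
    1ᴱ ⊗ 0ᴱ ⊕ 0ᴱ ⊗ 1ᴱ                                      ≗⟨ (λ n → refl) ⟩
    0ᴱ                                                     ∎

  Trivial : ℚ → Set
  Trivial q = cos q ≈ 1ᴱ × sin q ≈ 0ᴱ

  trivial-1 : Trivial 1ℚ
  trivial-1 = (begin
      cos (half + half)                              ≈⟨ cos-add half half ⟩
      cos half ⊗ cos half ⊖ sin half ⊗ sin half      ≈⟨ -‿cong (*-cong cos-half cos-half) (*-cong sin-half sin-half) ⟩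
      const (- 1ℚ) ⊗ const (- 1ℚ) ⊖ 0ᴱ ⊗ 0ᴱ          ≗⟨ (λ n → refl) ⟩
      1ᴱ                                             ∎)
    , (begin
      sin (half + half)                              ≈⟨ sin-add half half ⟩
      sin half ⊗ cos half ⊕ cos half ⊗ sin half      ≈⟨ +-cong (*-cong sin-half cos-half) (*-cong cos-half sin-half) ⟩
      0ᴱ ⊗ const (- 1ℚ) ⊕ const (- 1ℚ) ⊗ 0ᴱ          ≗⟨ (λ n → refl) ⟩
      0ᴱ                                             ∎)

  trivial-+ : ∀ {q r} → Trivial q → Trivial r → Trivial (q + r)
  trivial-+ {q} {r} (cq , sq) (cr , sr) = (begin
      cos (q + r)                            ≈⟨ cos-add q r ⟩
      cos q ⊗ cos r ⊖ sin q ⊗ sin r          ≈⟨ -‿cong (*-cong cq cr) (*-cong sq sr) ⟩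
      1ᴱ ⊗ 1ᴱ ⊖ 0ᴱ ⊗ 0ᴱ                      ≗⟨ (λ n → refl) ⟩
      1ᴱ                                     ∎)
    , (begin
      sin (q + r)                            ≈⟨ sin-add q r ⟩
      sin q ⊗ cos r ⊕ cos q ⊗ sin r          ≈⟨ +-cong (*-cong sq cr) (*-cong cq sr) ⟩
      0ᴱ ⊗ 1ᴱ ⊕ 1ᴱ ⊗ 0ᴱ                      ≗⟨ (λ n → refl) ⟩
      0ᴱ                                     ∎)

  trivial-neg : ∀ {q} → Trivial q → Trivial (- q)
  trivial-neg {q} (cq , sq) = ≈-trans (cos-neg q) cq , (begin
      sin (- q)     ≈⟨ sin-neg q ⟩
      0ᴱ ⊖ sin q    ≈⟨ -‿cong ≈-refl sq ⟩
      0ᴱ ⊖ 0ᴱ       ≗⟨ (λ n → refl) ⟩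
      0ᴱ            ∎)

  trivial-ℕ : ∀ n → Trivial (ι n)
  trivial-ℕ zero    = cos-0 , sin-0
  trivial-ℕ (suc n) = subst Trivial (sym (ι-suc n)) (trivial-+ {1ℚ} {ι n} trivial-1 (trivial-ℕ n))

  trivial-ℤ : ∀ k → Trivial (k / 1)
  trivial-ℤ (+ n)      = trivial-ℕ n
  trivial-ℤ ℤ.-[1+ n ] = trivial-neg {ι (suc n)} (trivial-ℕ (suc n))

  module Characters (p : ℕ) .{{_ : NonZero p}} where

    c s : ℤ → Expr
    c k = cos (k / p)
    s k = sin (k / p)

    /-+ : ∀ j k (d : ℕ) .{{_ : NonZero d}} → (j ℤ.+ k) / d ≡ j / d + k / d
    /-+ j k (suc n) = ℚ.toℚᵘ-injective (ℚᵘ.≃-trans (toℚᵘ-/ (j ℤ.+ k) n) (ℚᵘ.≃-sym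
      (ℚᵘ.≃-trans (ℚ.toℚᵘ-homo-+ (j / suc n) (k / suc n)) (ℚᵘ.≃-trans (ℚᵘ.+-cong (toℚᵘ-/ j n) (toℚᵘ-/ k n))
        (ℚᵘ.*≡* (Z.solve 3 (λ j k d → (j Z.:* d Z.:+ k Z.:* d) Z.:* d Z.:= (j Z.:+ k) Z.:* (d Z.:* d)) refl j k (+ suc n)))))))

    /-sub : ∀ j k → (j ℤ.- k) / p ≡ j / p - k / p
    /-sub j k = trans (/-+ j (ℤ.- k) p) (cong (λ z → j / p + z) (/-neg k))
      where
      /-neg : ∀ k → (ℤ.- k) / p ≡ - (k / p)
      /-neg k = trans (solve 2 (λ a b → b := :- a :+ (a :+ b)) refl (k / p) ((ℤ.- k) / p))
          (trans (cong (λ z → - (k / p) + z) (trans (sym (/-+ k (ℤ.- k) p)) (trans (cong (_/ p) (ℤ.+-inverseʳ k)) (0/ p))))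
            (trans (solve 1 (λ a → :- a :+ con 0ℚ := :- a) refl (k / p)) refl))
          where
          0/ : ∀ d .{{_ : NonZero d}} → + 0 / d ≡ 0ℚ
          0/ (suc n) = ℚ.0/n≡0 (suc n)

    *-/ : ∀ k → (k ℤ.* + p) / p ≡ k / 1
    *-/ k = go p
      where
      go : ∀ d .{{_ : NonZero d}} → (k ℤ.* + d) / d ≡ k / 1
      go (suc n) = ℚ.toℚᵘ-injective (ℚᵘ.≃-trans (toℚᵘ-/ (k ℤ.* + suc n) n) (ℚᵘ.≃-trans
        (ℚᵘ.*≡* (ℤ.*-identityʳ (k ℤ.* + suc n))) (ℚᵘ.≃-sym (toℚᵘ-/ k 0))))

    c-sub : ∀ j k → c (j ℤ.- k) ≈ c j ⊗ c k ⊕ s j ⊗ s k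
    c-sub j k = ≈-trans (≡⇒≈ cos (/-sub j k)) (cos-sub (j / p) (k / p))

    s-sub : ∀ j k → s (j ℤ.- k) ≈ s j ⊗ c k ⊖ c j ⊗ s k
    s-sub j k = ≈-trans (≡⇒≈ sin (/-sub j k)) (sin-sub (j / p) (k / p))

    c-add : ∀ j k → c (j ℤ.+ k) ≈ c j ⊗ c k ⊖ s j ⊗ s k
    c-add j k = ≈-trans (≡⇒≈ cos (/-+ j k p)) (cos-add (j / p) (k / p))

    s-add : ∀ j k → s (j ℤ.+ k) ≈ s j ⊗ c k ⊕ c j ⊗ s k
    s-add j k = ≈-trans (≡⇒≈ sin (/-+ j k p)) (sin-add (j / p) (k / p))

    c-period : ∀ k → c (k ℤ.* + p) ≈ 1ᴱ
    c-period k = ≈-trans (≡⇒≈ cos (*-/ k)) (proj₁ (trivial-ℤ k))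

    s-period : ∀ k → s (k ℤ.* + p) ≈ 0ᴱ
    s-period k = ≈-trans (≡⇒≈ sin (*-/ k)) (proj₂ (trivial-ℤ k))

module Counting where

  length-filter : ∀ {A : Set} {P : A → Set} (P? : ∀ x → Dec (P x)) xs →
    ι (length (filter P? xs)) ≡ sumℚ xs (λ x → if does (P? x) then 1ℚ else 0ℚ)
  length-filter P? []       = refl
  length-filter P? (x ∷ xs) with does (P? x)
  ... | false = trans (length-filter P? xs) (sym (ℚ.+-identityˡ _))
  ... | true  = trans (ι-suc (length (filter P? xs))) (cong (λ z → 1ℚ + z) (length-filter P? xs))

  length-filter-map : ∀ {A B : Set} {P : B → Set} {Q : A → Set} (P? : ∀ x → Dec (P x)) (Q? : ∀ x → Dec (Q x)) f xs →
    (∀ x → does (P? (f x)) ≡ does (Q? x)) → length (filter P? (map f xs)) ≡ length (filter Q? xs)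
  length-filter-map P? Q? f []       eq = refl
  length-filter-map P? Q? f (x ∷ xs) eq with does (P? (f x)) | does (Q? x) | eq x
  ... | true  | true  | _ = cong suc (length-filter-map P? Q? f xs eq)
  ... | false | false | _ = length-filter-map P? Q? f xs eq

  length-elements : ∀ {n} (X : Subset n) → length (elements X) ≡ ∣ X ∣
  length-elements []              = refl
  length-elements {suc n} (b ∷ X) = go b
    where
    rest : ∀ b → length (filter (_∈? (b ∷ X)) (tabulate suc)) ≡ ∣ X ∣
    rest b = trans (cong (λ l → length (filter (_∈? (b ∷ X)) l)) (sym (List.map-tabulate id suc)))
      (trans (length-filter-map (_∈? (b ∷ X)) (_∈? X) suc (allFin n) (λ _ → refl)) (length-elements X))
    go : ∀ b → length (elements (b ∷ X)) ≡ ∣ b ∷ X ∣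
    go true  = cong suc (rest true)
    go false = rest false

  module _ (p : ℕ) .{{_ : NonZero p}} (X : Subset p) where

    open Residues p

    ns : List ℕ
    ns = map toℕ (elements X)

    open Windows p (map +_ ns) using (hits)

    J₃≡hits : ∀ S T → ι (J₃ p X S T) ≡ hits S T
    J₃≡hits S T = trans (length-filter (λ ((x , y) : ℤ × ℤ) → + p ℤ.∣? (x ℤ.- y)) (cartesianProduct as (interval S T)))
      (trans (sum-cartesian _,_ as (interval S T) (λ (x , y) → δ (x ℤ.- y)))
        (trans (sum-map (elements X) (λ x → + toℕ x) (λ x → sumℚ (interval S T) (λ y → δ (x ℤ.- y))))
          (trans (sum-cong (elements X) (λ x → sum-map (upTo T) (λ j → S ℤ.+ + suc j) (λ y → δ (+ toℕ x ℤ.- y))))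
            (sym (trans (sum-map ns +_ (λ x → sumℚ (upTo T) (λ j → δ (x ℤ.- (S ℤ.+ + suc j)))))
              (sum-map (elements X) toℕ (λ x → sumℚ (upTo T) (λ j → δ (+ x ℤ.- (S ℤ.+ + suc j))))))))))
      where
      as : List ℤ
      as = map (λ x → + toℕ x) (elements X)

  prime∤⇒coprime : ∀ {p} → Prime p → ∀ k → ¬ + p ℤ.∣ k → Coprime k (+ p)
  prime∤⇒coprime hp k p∤k {d} (d∣k , d∣p) with prime⇒irreducible hp d∣p
  ... | inj₁ d≡1  = d≡1
  ... | inj₂ refl = contradiction (ℤ.∣ᵤ⇒∣ d∣k) p∤k

open Counting

module RootBounds where

  open RootLemmas

  root-≤ : ∀ k q n {y} → rootApprox (suc k) q n + recip n ℚ.≤ y → q ℚ.≤ y ^ℚ suc k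
  root-≤ k q n {y} h = ℚ.≤-trans (ℚ.<⇒≤ (root-upper k q n))
    (^-mono {rootApprox (suc k) q n + recip n} {y} (suc k) (0≤+ {rootApprox (suc k) q n} (0≤root (suc k) q n) (0≤recip n)) h)

open RootBounds

module Deviation
  (e : ℚ → ℂ) (p : ℕ) .{{_ : NonZero p}} (hp : Prime p) (X : Subset p) (Δ : ℝ)
  (c-sub : ∀ j k → realPart (e ((j ℤ.- k) / p))
    ≈ realPart (e (j / p)) ⊗ realPart (e (k / p)) ⊕ imagPart (e (j / p)) ⊗ imagPart (e (k / p)))
  (s-sub : ∀ j k → imagPart (e ((j ℤ.- k) / p))
    ≈ imagPart (e (j / p)) ⊗ realPart (e (k / p)) ⊖ realPart (e (j / p)) ⊗ imagPart (e (k / p)))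
  (c-add : ∀ j k → realPart (e ((j ℤ.+ k) / p))
    ≈ realPart (e (j / p)) ⊗ realPart (e (k / p)) ⊖ imagPart (e (j / p)) ⊗ imagPart (e (k / p)))
  (s-add : ∀ j k → imagPart (e ((j ℤ.+ k) / p))
    ≈ imagPart (e (j / p)) ⊗ realPart (e (k / p)) ⊕ realPart (e (j / p)) ⊗ imagPart (e (k / p)))
  (c-period : ∀ k → realPart (e ((k ℤ.* + p) / p)) ≈ 1ᴱ)
  (s-period : ∀ k → imagPart (e ((k ℤ.* + p) / p)) ≈ 0ᴱ)
  (exponential-sum : ∀ a → Coprime a (+ p) →
    ∣ ∑ (elements X) (λ x → e ((a ℤ.* + toℕ x) / p)) ∣ℂ ≤ℝ fromℕ (∣ X ∣) *ℝ Δ) where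

  open +-*-Solver using (solve; _:+_; _:*_; _:-_; :-_; con; _:=_)
  c s : ℤ → Expr
  c k = realPart (e (k / p))
  s k = imagPart (e (k / p))

  xs : List ℤ
  xs = map +_ (ns p X)

  length-ns : length (ns p X) ≡ ∣ X ∣
  length-ns = trans (List.length-map toℕ (elements X)) (length-elements X)

  length-xs : length xs ≡ ∣ X ∣
  length-xs = trans (List.length-map +_ (ns p X)) length-ns

  seq-re : ∀ {A : Set} (l : List A) f n → seq (ℂ.re (∑ l f)) n ≡ sumℚ l (λ x → seq (ℂ.re (f x)) n)
  seq-re []      f n = refl
  seq-re (x ∷ l) f n = cong (λ z → seq (ℂ.re (f x)) n + z) (seq-re l f n)

  seq-im : ∀ {A : Set} (l : List A) f n → seq (ℂ.im (∑ l f)) n ≡ sumℚ l (λ x → seq (ℂ.im (f x)) n)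
  seq-im []      f n = refl
  seq-im (x ∷ l) f n = cong (λ z → seq (ℂ.im (f x)) n + z) (seq-im l f n)

  modulus-≤ : ∀ z n {y} → seq (∣ z ∣ℂ) n + recip n ℚ.≤ y →
    seq (ℂ.re z) n * seq (ℂ.re z) n + seq (ℂ.im z) n * seq (ℂ.im z) n ℚ.≤ y * y
  modulus-≤ z n {y} h = ℚ.≤-trans (ℚ.≤-reflexive (squares (seq (ℂ.re z) n) (seq (ℂ.im z) n)))
    (ℚ.≤-trans (ℚ.p≤p⊔q v 0ℚ) (ℚ.≤-trans (root-≤ 1 (v ℚ.⊔ 0ℚ) n {y} h) (ℚ.≤-reflexive (cong (y *_) (ℚ.*-identityʳ y)))))
    where
    v : ℚ
    v = seq (ℂ.re z ^ℝ 2 +ℝ ℂ.im z ^ℝ 2) n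
    squares : ∀ a b → a * a + b * b ≡ a * (a * 1ℚ) + b * (b * 1ℚ)
    squares = solve 2 (λ a b → a :* a :+ b :* b := a :* (a :* con 1ℚ) :+ b :* (b :* con 1ℚ)) refl

  SlightlyAbove : ℚ → Set
  SlightlyAbove D = Σ ℚ λ ε → 0ℚ ℚ.< ε × Σ ℕ λ N → ∀ n → N ℕ.≤ n → seq Δ n + ε ℚ.≤ D

  module _ .{{_ : NonZero (length (ns p X))}} {D : ℚ} (Δ<D : SlightlyAbove D) where

    open Fourier p c s c-sub s-sub c-add s-add c-period s-period (ns p X) using (N; normSquared; cosSum; sinSum; module Orthogonality)

    norm-small : ∀ k → ¬ + p ℤ.∣ k → Eventually≤ (normSquared xs k) (const (N * N * (D * D)))
    norm-small k p∤k = N₁ ℕ.+ (N₂ ℕ.+ N₃) , λ n n≥ → bound n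
      (proj₂ (proj₂ (proj₂ Δ<D)) n (ℕ.m+n≤o⇒m≤o N₁ n≥))
      (proj₂ hyp n (ℕ.m+n≤o⇒m≤o N₂ (ℕ.m+n≤o⇒n≤o N₁ n≥)))
      (proj₂ small n (ℕ.m+n≤o⇒n≤o N₂ (ℕ.m+n≤o⇒n≤o N₁ n≥)))
      where
      ε : ℚ
      ε = proj₁ Δ<D
      0<ε : 0ℚ ℚ.< ε
      0<ε = proj₁ (proj₂ Δ<D)
      W : ℂ
      W = ∑ (elements X) (λ x → e ((k ℤ.* + toℕ x) / p))
      hyp = exponential-sum k (prime∤⇒coprime hp k p∤k) (½ * ε) (0<½* {ε} 0<ε)
      small = recip-small {½ * ε} (0<½* {ε} 0<ε)
      N₁ = proj₁ (proj₂ (proj₂ Δ<D))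
      N₂ = proj₁ hyp
      N₃ = proj₁ small
      1≤N : 1ℚ ℚ.≤ N
      1≤N = ι-mono {1} {length (ns p X)} (ℕ.>-nonZero⁻¹ (length (ns p X)))
      sum-ns : ∀ (f : ℤ → ℝ) n → value (sumᴱ xs (λ u → real (f u))) n ≡ sumℚ (elements X) (λ x → seq (f (+ toℕ x)) n)
      sum-ns f n = trans (seq-sum xs (λ u → real (f u)) n)
        (trans (sum-map (ns p X) +_ (λ u → seq (f u) n)) (sum-map (elements X) toℕ (λ x → seq (f (+ x)) n)))
      re≡ : ∀ n → value (cosSum xs k) n ≡ seq (ℂ.re W) n
      re≡ n = trans (sum-ns (λ u → ℂ.re (e ((k ℤ.* u) / p))) n) (sym (seq-re (elements X) (λ x → e ((k ℤ.* + toℕ x) / p)) n))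
      im≡ : ∀ n → value (sinSum xs k) n ≡ seq (ℂ.im W) n
      im≡ n = trans (sum-ns (λ u → ℂ.im (e ((k ℤ.* u) / p))) n) (sym (seq-im (elements X) (λ x → e ((k ℤ.* + toℕ x) / p)) n))
      ρ+≤ND : ∀ ρ δ η → δ + ε ℚ.≤ D → ρ ℚ.≤ ι (∣ X ∣) * δ + ½ * ε → η ℚ.≤ ½ * ε → ρ + η ℚ.≤ N * D
      ρ+≤ND ρ δ η δ+ε≤D ρ≤ η≤ = begin
        ρ + η                              ≤⟨ ℚ.+-mono-≤ ρ≤ η≤ ⟩
        ι (∣ X ∣) * δ + ½ * ε + ½ * ε     ≡⟨ trans (ℚ.+-assoc (ι (∣ X ∣) * δ) (½ * ε) (½ * ε)) (cong₂ (λ m h → ι m * δ + h) (sym length-ns) (halves ε)) ⟩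
        N * δ + ε                          ≤⟨ ℚ.+-monoʳ-≤ (N * δ) (subst (ℚ._≤ N * ε) (ℚ.*-identityˡ ε) (*-monoʳ {ε} (ℚ.<⇒≤ 0<ε) 1≤N)) ⟩
        N * δ + N * ε                      ≡⟨ ℚ.*-distribˡ-+ N δ ε ⟨
        N * (δ + ε)                        ≤⟨ *-monoˡ {N} (0≤ι (length (ns p X))) δ+ε≤D ⟩
        N * D                              ∎
        where open ℚ.≤-Reasoning
      bound : ∀ n → seq Δ n + ε ℚ.≤ D → seq (∣ W ∣ℂ) n ℚ.≤ ι (∣ X ∣) * seq Δ n + ½ * ε → recip n ℚ.≤ ½ * ε →
        value (normSquared xs k) n ℚ.≤ N * N * (D * D)
      bound n Δ+ε≤D root≤ recip≤ = subst₂ ℚ._≤_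
        (sym (cong₂ (λ x y → x * x + y * y) (re≡ n) (im≡ n)))
        (solve 2 (λ N D → N :* D :* (N :* D) := N :* N :* (D :* D)) refl N D)
        (modulus-≤ W n {N * D} (ρ+≤ND (seq (∣ W ∣ℂ) n) (seq Δ n) (recip n) Δ+ε≤D root≤ recip≤))

    energy-bound : 0ℚ ℚ.≤ D → D ℚ.< 1ℚ → Windows.EnergyBound p xs D
    energy-bound 0≤D D<1 t t≤p = begin
      P * energy (differences t)
        ≤⟨ energy-difference (positives t) ⟩
      N * N * (ι l * ι l) + N * N * (D * D) * (P * energy (positives t))
        ≤⟨ ℚ.+-monoʳ-≤ (N * N * (ι l * ι l)) (*-monoˡ {N * N * (D * D)} (0≤* {N * N} (0≤² N) (0≤² D))
             (*-monoˡ {P} (ℚ.<⇒≤ (0<ι p)) (energy-positives t t≤p))) ⟩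
      N * N * (ι l * ι l) + N * N * (D * D) * (P * ι t)
        ≡⟨ cong₂ (λ m k → ι m * ι m * (ι k * ι k) + ι m * ι m * (D * D) * (P * ι t))
             (sym (List.length-map +_ (ns p X))) (trans (List.length-map (λ j → + suc j) (upTo t)) (List.length-upTo t)) ⟩
      N′ * N′ * (ι t * ι t) + N′ * N′ * (D * D) * (P * ι t)
        ≡⟨ cong (_+ N′ * N′ * (D * D) * (P * ι t)) (solve 2 (λ N t → N :* N :* (t :* t) := N :* t :* (N :* t)) refl N′ (ι t)) ⟩
      N′ * ι t * (N′ * ι t) + N′ * N′ * (D * D) * (P * ι t) ∎
      where
      open ℚ.≤-Reasoning
      open Windows p xs using (differences; positives; energy-positives)
      open Residues p using (energy)
      open Orthogonality 0≤D D<1 norm-small using (energy-difference)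
      P N′ : ℚ
      P = ι p
      N′ = ι (length xs)
      l : ℕ
      l = length (positives t)

  open Windows p xs using (deviation; deviation-bound; hits; hits-≤; 0≤hits; N; P; 0≤N; 0<P)

  trivial-bound : ∀ S T → T ℕ.≤ p → ∣ deviation S T ∣ℚ ℚ.≤ P * N
  trivial-bound S T T≤p = ∣∣≤ {deviation S T}
    (below (P * hits S T) (N * ι T) (0≤* {N} 0≤N (0≤ι T)) (*-monoˡ {P} (ℚ.<⇒≤ 0<P) (hits-≤ S T T≤p)))
    (subst (ℚ._≤ P * N) (solve 2 (λ a b → b :- a := :- (a :- b)) refl (P * hits S T) (N * ι T))
      (below (N * ι T) (P * hits S T) (0≤* {P} (ℚ.<⇒≤ 0<P) (0≤hits S T))
        (subst (N * ι T ℚ.≤_) (ℚ.*-comm N P) (*-monoˡ {N} 0≤N (ι-mono T≤p)))))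
    where
    below : ∀ a b {c} → 0ℚ ℚ.≤ b → a ℚ.≤ c → a - b ℚ.≤ c
    below a b 0≤b a≤c = ℚ.≤-trans (subst (a - b ℚ.≤_) (ℚ.+-identityʳ a) (ℚ.+-monoʳ-≤ a (ℚ.neg-antimono-≤ 0≤b))) a≤c

  rational-bound : ∀ {D x} → SlightlyAbove D → 0ℚ ℚ.≤ D → 0ℚ ℚ.≤ x → ∀ S T → T ℕ.≤ p →
    D * D * ι T ℚ.≤ P * (x * (x * x)) → ∣ deviation S T ∣ℚ ℚ.≤ P * N * (x + x + x + D)
  rational-bound {D} {x} Δ<D 0≤D 0≤x S T T≤p large = go (ℕ.nonZero? (length (ns p X))) (D ℚ.<? 1ℚ)
    where
    zero-length : ∀ m → ¬ NonZero m → m ≡ 0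
    zero-length zero    _ = refl
    zero-length (suc m) z = contradiction _ z
    go : Dec (NonZero (length (ns p X))) → Dec (D ℚ.< 1ℚ) → ∣ deviation S T ∣ℚ ℚ.≤ P * N * (x + x + x + D)
    go (yes nz) (yes D<1) = deviation-bound {D} (energy-bound {{nz}} {D} Δ<D 0≤D D<1) 0≤D {x} 0≤x S T T≤p large
    go _        (no D≮1)  = ℚ.≤-trans (trivial-bound S T T≤p) (subst (ℚ._≤ P * N * (x + x + x + D)) (ℚ.*-identityʳ (P * N))
      (*-monoˡ {P * N} (0≤* {P} (ℚ.<⇒≤ 0<P) 0≤N) (ℚ.≤-trans (ℚ.≮⇒≥ D≮1)
        (subst (D ℚ.≤_) (ℚ.+-comm D (x + x + x)) (≤-add {D} (0≤+ {x + x} (0≤+ {x} 0≤x 0≤x) 0≤x))))))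
    go (no z)   (yes _)   = ℚ.≤-trans (trivial-bound S T T≤p) (ℚ.≤-reflexive (trans PN≡0
      (sym (trans (cong (_* (x + x + x + D)) PN≡0) (ℚ.*-zeroˡ (x + x + x + D))))))
      where
      PN≡0 : P * N ≡ 0ℚ
      PN≡0 = trans (cong (λ m → P * ι m) (trans (List.length-map +_ (ns p X)) (zero-length _ z))) (ℚ.*-zeroʳ P)

module Estimates where

  open +-*-Solver using (solve; _:+_; _:*_; con; _:=_)

  product-perturbation : ∀ {a b c e H} → 0ℚ ℚ.≤ a → 0ℚ ℚ.≤ b → 0ℚ ℚ.≤ c → 0ℚ ℚ.≤ e →
    a + e ℚ.≤ H → b + e ℚ.≤ H → c + e ℚ.≤ H →
    (a + e) * (b + e) * (b + e) * (c + e) ℚ.≤ a * b * b * c + ι 4 * (e * (H * H * H))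
  product-perturbation {a} {b} {c} {e} {H} 0≤a 0≤b 0≤c 0≤e a+e≤H b+e≤H c+e≤H = begin
    (a + e) * (b + e) * (b + e) * (c + e)
      ≡⟨ solve 4 (λ a b c e → (a :+ e) :* (b :+ e) :* (b :+ e) :* (c :+ e)
           := a :* b :* b :* c :+ (e :* ((b :+ e) :* (b :+ e) :* (c :+ e)) :+ e :* (a :* (b :+ e) :* (c :+ e)) :+ e :* (a :* b :* (c :+ e)) :+ e :* (a :* b :* b)))
           refl a b c e ⟩
    a * b * b * c + (e * ((b + e) * (b + e) * (c + e)) + e * (a * (b + e) * (c + e)) + e * (a * b * (c + e)) + e * (a * b * b))
      ≤⟨ ℚ.+-monoʳ-≤ (a * b * b * c) (ℚ.+-mono-≤ (ℚ.+-mono-≤ (ℚ.+-mono-≤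
           (bound (b + e) (b + e) (c + e) 0≤b+e 0≤b+e 0≤c+e b+e≤H b+e≤H c+e≤H)
           (bound a (b + e) (c + e) 0≤a 0≤b+e 0≤c+e a≤H b+e≤H c+e≤H))
           (bound a b (c + e) 0≤a 0≤b 0≤c+e a≤H b≤H c+e≤H))
           (bound a b b 0≤a 0≤b 0≤b a≤H b≤H b≤H)) ⟩
    a * b * b * c + (e * (H * H * H) + e * (H * H * H) + e * (H * H * H) + e * (H * H * H))
      ≡⟨ cong (λ z → a * b * b * c + z) (solve 1 (λ x → x :+ x :+ x :+ x := con (ι 4) :* x) refl (e * (H * H * H))) ⟩
    a * b * b * c + ι 4 * (e * (H * H * H)) ∎
    where
    open ℚ.≤-Reasoning
    0≤b+e = 0≤+ {b} 0≤b 0≤e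
    0≤c+e = 0≤+ {c} 0≤c 0≤e
    a≤H = ℚ.≤-trans (≤-add {a} 0≤e) a+e≤H
    b≤H = ℚ.≤-trans (≤-add {b} 0≤e) b+e≤H
    bound : ∀ x y z → 0ℚ ℚ.≤ x → 0ℚ ℚ.≤ y → 0ℚ ℚ.≤ z → x ℚ.≤ H → y ℚ.≤ H → z ℚ.≤ H → e * (x * y * z) ℚ.≤ e * (H * H * H)
    bound x y z 0≤x 0≤y 0≤z x≤H y≤H z≤H = *-monoˡ {e} 0≤e (*-mono {x * y} {H * H} {z} {H} (0≤* {x} 0≤x 0≤y) 0≤z
      (*-mono {x} {H} {y} {H} 0≤x 0≤y x≤H y≤H) z≤H)

open Estimates

-- In terms of approximants, r is at least the cube root of max x 0.
record CubeRoot (x r : ℝ) : Set where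
  constructor mkCubeRoot
  field
    nonNeg : ∀ n → 0ℚ ℚ.≤ seq r n
    cube   : ∀ n {y} → seq r n + recip n ℚ.≤ y → seq x n ℚ.⊔ 0ℚ ℚ.≤ y ^ℚ 3
open CubeRoot

cubeRoot : ∀ x → CubeRoot x (cbrt x)
cubeRoot x = mkCubeRoot
  (λ n → RootLemmas.0≤root 3 (seq x n ℚ.⊔ 0ℚ) n)
  (λ n {y} h → root-≤ 2 (seq x n ℚ.⊔ 0ℚ) n {y} h)

module CubeRootBound
  (p : ℕ) .{{_ : NonZero p}} (t : ℕ) (N E : ℚ) (0≤N : 0ℚ ℚ.≤ N) (Δ r d u : ℝ) (0≤Δ : 0ℝ ≤ℝ Δ)
  (r-root : CubeRoot (fromℕ t) r) (d-root : CubeRoot Δ d) (u-root : CubeRoot (fromℚ (+ 1 / p)) u)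
  (rational : ∀ {D x} → (Σ ℚ λ ε → 0ℚ ℚ.< ε × Σ ℕ λ n₀ → ∀ n → n₀ ℕ.≤ n → seq Δ n + ε ℚ.≤ D) → 0ℚ ℚ.≤ D → 0ℚ ℚ.≤ x →
    D * D * ι t ℚ.≤ ι p * (x * (x * x)) → E ℚ.≤ N * (x + x + x + D)) where

  open +-*-Solver using (solve; _:+_; _:*_; con; _:=_)
  open RootLemmas using (max0-close)

  bounded-r = eventually-bounded (seq r) (cauchy r)
  bounded-d = eventually-bounded (seq d) (cauchy d)
  bounded-u = eventually-bounded (seq u) (cauchy u)

  K₁ K₂ K₃ H C : ℚ
  K₁ = proj₁ bounded-r
  K₂ = proj₁ bounded-d
  K₃ = proj₁ bounded-u
  H = K₁ + K₂ + K₃ + ι 2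
  C = N * (ι 24 * (H * H * H) + ι 3)

  0≤K₁ : 0ℚ ℚ.≤ K₁
  0≤K₁ = ℚ.<⇒≤ (proj₁ (proj₂ bounded-r))
  0≤K₂ : 0ℚ ℚ.≤ K₂
  0≤K₂ = ℚ.<⇒≤ (proj₁ (proj₂ bounded-d))
  0≤K₃ : 0ℚ ℚ.≤ K₃
  0≤K₃ = ℚ.<⇒≤ (proj₁ (proj₂ bounded-u))

  0≤H : 0ℚ ℚ.≤ H
  0≤H = 0≤+ {K₁ + K₂ + K₃} (0≤+ {K₁ + K₂} (0≤+ {K₁} 0≤K₁ 0≤K₂) 0≤K₃) (0≤ι 2)

  0≤C : 0ℚ ℚ.≤ C
  0≤C = 0≤* {N} 0≤N (0≤+ {ι 24 * (H * H * H)} (0≤* {ι 24} (0≤ι 24) (0≤* {H * H} (0≤² H) 0≤H)) (0≤ι 3))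

  recip-p : ∀ m .{{_ : NonZero m}} → ι m * (+ 1 / m) ≡ 1ℚ
  recip-p (suc m) = ι*recip m

  estimate-at : ∀ n {μ D} → 0ℚ ℚ.≤ μ → μ ℚ.≤ 1ℚ → recip n ℚ.≤ μ → 0ℚ ℚ.≤ D →
    (Σ ℚ λ ε → 0ℚ ℚ.< ε × Σ ℕ λ n₀ → ∀ n → n₀ ℕ.≤ n → seq Δ n + ε ℚ.≤ D) →
    D ℚ.≤ seq Δ n ℚ.⊔ 0ℚ + μ ^ℚ 3 → D ℚ.≤ seq Δ n + μ →
    seq r n ℚ.≤ K₁ → seq d n ℚ.≤ K₂ → seq u n ℚ.≤ K₃ →
    E ℚ.≤ ι 3 * (N * seq r n * (seq d n * (seq d n * 1ℚ)) * seq u n + N * seq Δ n) + μ * C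
  estimate-at n {μ} {D} 0≤μ μ≤1 κ≤μ 0≤D Δ<D D≤ D≤′ r≤ d≤ u≤ = begin
    E
      ≤⟨ rational {D} {x} Δ<D 0≤D 0≤x cubes ⟩
    N * (x + x + x + D)
      ≤⟨ *-monoˡ {N} 0≤N (ℚ.+-monoʳ-≤ (x + x + x) (≤-add {D} (0≤+ {D} 0≤D 0≤D))) ⟩
    N * (x + x + x + (D + (D + D)))
      ≡⟨ solve 3 (λ N x D → N :* (x :+ x :+ x :+ (D :+ (D :+ D))) := con (ι 3) :* N :* (x :+ D)) refl N x D ⟩
    ι 3 * N * (x + D)
      ≤⟨ *-monoˡ {ι 3 * N} (0≤* {ι 3} (0≤ι 3) 0≤N) (ℚ.+-mono-≤ x≤ D≤′) ⟩
    ι 3 * N * (a * b * b * c + ι 4 * (e * (H * H * H)) + (δ + μ))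
      ≡⟨ solve 7 (λ N a b c δ μ h → con (ι 3) :* N :* (a :* b :* b :* c :+ con (ι 4) :* ((μ :+ μ) :* h) :+ (δ :+ μ))
           := con (ι 3) :* (N :* a :* (b :* (b :* con 1ℚ)) :* c :+ N :* δ) :+ μ :* (N :* (con (ι 24) :* h :+ con (ι 3))))
           refl N a b c δ μ (H * H * H) ⟩
    ι 3 * (N * a * (b * (b * 1ℚ)) * c + N * δ) + μ * C ∎
    where
    open ℚ.≤-Reasoning
    a b c δ e x : ℚ
    a = seq r n
    b = seq d n
    c = seq u n
    δ = seq Δ n
    e = μ + μ
    x = (a + e) * (b + e) * (b + e) * (c + e)
    0≤e : 0ℚ ℚ.≤ e
    0≤e = 0≤+ {μ} 0≤μ 0≤μ
    0≤a+e = 0≤+ {a} (nonNeg r-root n) 0≤e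
    0≤b+e = 0≤+ {b} (nonNeg d-root n) 0≤e
    0≤c+e = 0≤+ {c} (nonNeg u-root n) 0≤e
    0≤x : 0ℚ ℚ.≤ x
    0≤x = 0≤* {(a + e) * (b + e) * (b + e)} (0≤* {(a + e) * (b + e)} (0≤* {a + e} 0≤a+e 0≤b+e) 0≤b+e) 0≤c+e
    e≤2 : e ℚ.≤ ι 2
    e≤2 = ℚ.+-mono-≤ μ≤1 μ≤1
    κ≤e : recip n ℚ.≤ e
    κ≤e = ℚ.≤-trans κ≤μ (≤-add {μ} 0≤μ)
    x≤ : x ℚ.≤ a * b * b * c + ι 4 * (e * (H * H * H))
    x≤ = product-perturbation {a} {b} {c} {e} {H} (nonNeg r-root n) (nonNeg d-root n) (nonNeg u-root n) 0≤e
      (ℚ.+-mono-≤ (ℚ.≤-trans r≤ (ℚ.≤-trans (≤-add {K₁} 0≤K₂) (≤-add {K₁ + K₂} 0≤K₃))) e≤2)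
      (ℚ.+-mono-≤ (ℚ.≤-trans d≤ (ℚ.≤-trans (subst (K₂ ℚ.≤_) (ℚ.+-comm K₂ K₁) (≤-add {K₂} 0≤K₁)) (≤-add {K₁ + K₂} 0≤K₃))) e≤2)
      (ℚ.+-mono-≤ (ℚ.≤-trans u≤ (subst (K₃ ℚ.≤_) (ℚ.+-comm K₃ (K₁ + K₂)) (≤-add {K₃} (0≤+ {K₁} 0≤K₁ 0≤K₂)))) e≤2)
    a³ b³ c³ : ℚ
    a³ = (a + e) ^ℚ 3
    b³ = (b + e) ^ℚ 3
    c³ = (c + e) ^ℚ 3
    D≤b³ : D ℚ.≤ b³
    D≤b³ = ℚ.≤-trans D≤ (ℚ.≤-trans (ℚ.+-monoˡ-≤ (μ ^ℚ 3) (cube d-root n {b + μ} (ℚ.+-monoʳ-≤ b κ≤μ)))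
      (subst (λ z → (b + μ) ^ℚ 3 + μ ^ℚ 3 ℚ.≤ z ^ℚ 3) (ℚ.+-assoc b μ μ)
        (^-superadditive {b + μ} {μ} 2 (0≤+ {b} (nonNeg d-root n) 0≤μ) 0≤μ)))
    cubes : D * D * ι t ℚ.≤ ι p * (x * (x * x))
    cubes = begin
      D * D * ι t
        ≡⟨ solve 1 (λ y → y := con 1ℚ :* y) refl (D * D * ι t) ⟩
      1ℚ * (D * D * ι t)
        ≡⟨ cong (_* (D * D * ι t)) (recip-p p) ⟨
      ι p * (+ 1 / p) * (D * D * ι t)
        ≤⟨ *-mono {ι p * (+ 1 / p)} {ι p * c³} {D * D * ι t} {b³ * b³ * a³}
             (subst (0ℚ ℚ.≤_) (sym (recip-p p)) 0≤1) (0≤* {D * D} (0≤² D) (0≤ι t))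
             (*-monoˡ {ι p} (0≤ι p) (ℚ.≤-trans (ℚ.p≤p⊔q (+ 1 / p) 0ℚ) (cube u-root n {c + e} (ℚ.+-monoʳ-≤ c κ≤e))))
             (*-mono {D * D} {b³ * b³} {ι t} {a³} (0≤² D) (0≤ι t)
               (*-mono {D} {b³} {D} {b³} 0≤D 0≤D D≤b³ D≤b³) (ℚ.≤-trans (ℚ.p≤p⊔q (ι t) 0ℚ) (cube r-root n {a + e} (ℚ.+-monoʳ-≤ a κ≤e)))) ⟩
      ι p * c³ * (b³ * b³ * a³)
        ≡⟨ solve 4 (λ P a b c → P :* (c :* (c :* (c :* con 1ℚ))) :* (b :* (b :* (b :* con 1ℚ)) :* (b :* (b :* (b :* con 1ℚ))) :* (a :* (a :* (a :* con 1ℚ))))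
             := P :* (a :* b :* b :* c :* (a :* b :* b :* c :* (a :* b :* b :* c)))) refl (ι p) (a + e) (b + e) (c + e) ⟩
      ι p * (x * (x * x)) ∎

  cube-root-bound : ∀ ε → 0ℚ ℚ.< ε → Σ ℕ λ n₀ → ∀ n → n₀ ℕ.≤ n →
    E ℚ.≤ ι 3 * (N * seq r n * (seq d n * (seq d n * 1ℚ)) * seq u n + N * seq Δ n) + ε
  cube-root-bound ε 0<ε = k ℕ.+ (N₁ ℕ.+ (N₂ ℕ.+ (M₁ ℕ.+ (M₂ ℕ.+ M₃)))) , go
    where
    small = scaled-recip-small {C} {ε} 0≤C 0<ε
    k : ℕ
    k = proj₁ small
    μ η : ℚ
    μ = recip k
    η = ½ * (½ * μ ^ℚ 3)
    0<μ³ : 0ℚ ℚ.< μ ^ℚ 3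
    0<μ³ = ^-pos {μ} 3 (0<recip k)
    0<η : 0ℚ ℚ.< η
    0<η = 0<½* {½ * μ ^ℚ 3} (0<½* {μ ^ℚ 3} 0<μ³)
    0≤η = ℚ.<⇒≤ 0<η
    settled = cauchy Δ η 0<η
    eventually-nonNeg = 0≤Δ η 0<η
    N₁ N₂ M₁ M₂ M₃ : ℕ
    N₁ = proj₁ settled
    N₂ = proj₁ eventually-nonNeg
    M₁ = proj₁ (proj₂ (proj₂ bounded-r))
    M₂ = proj₁ (proj₂ (proj₂ bounded-d))
    M₃ = proj₁ (proj₂ (proj₂ bounded-u))
    δ₀ D : ℚ
    δ₀ = seq Δ N₁
    D = δ₀ ℚ.⊔ 0ℚ + (η + η)
    0≤D : 0ℚ ℚ.≤ D
    0≤D = 0≤+ {δ₀ ℚ.⊔ 0ℚ} (ℚ.p≤q⊔p δ₀ 0ℚ) (0≤+ {η} 0≤η 0≤η)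
    Δ<D : Σ ℚ λ ε → 0ℚ ℚ.< ε × Σ ℕ λ n₀ → ∀ n → n₀ ℕ.≤ n → seq Δ n + ε ℚ.≤ D
    Δ<D = η , 0<η , N₁ , λ n n≥ → ℚ.≤-trans (ℚ.+-monoˡ-≤ η (ℚ.≤-trans
        (≤-from-diff {seq Δ n} {δ₀} (proj₂ settled n N₁ n≥ ℕ.≤-refl)) (ℚ.+-monoˡ-≤ η (ℚ.p≤p⊔q δ₀ 0ℚ))))
      (ℚ.≤-reflexive (ℚ.+-assoc (δ₀ ℚ.⊔ 0ℚ) η η))
    4η : η + η + (η + η) ≡ μ ^ℚ 3
    4η = trans (cong₂ _+_ (halves (½ * μ ^ℚ 3)) (halves (½ * μ ^ℚ 3))) (halves (μ ^ℚ 3))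
    μ≤1 : μ ℚ.≤ 1ℚ
    μ≤1 = recip-antitone {0} {k} ℕ.z≤n
    μ³≤μ : μ ^ℚ 3 ℚ.≤ μ
    μ³≤μ = begin
      μ * (μ * (μ * 1ℚ))  ≡⟨ cong (λ z → μ * (μ * z)) (ℚ.*-identityʳ μ) ⟩
      μ * (μ * μ)         ≤⟨ *-monoˡ {μ} (0≤recip k) (*-mono {μ} {1ℚ} {μ} {1ℚ} (0≤recip k) (0≤recip k) μ≤1 μ≤1) ⟩
      μ * (1ℚ * 1ℚ)       ≡⟨ solve 1 (λ μ → μ :* (con 1ℚ :* con 1ℚ) := μ) refl μ ⟩
      μ                   ∎
      where open ℚ.≤-Reasoning
    go : ∀ n → k ℕ.+ (N₁ ℕ.+ (N₂ ℕ.+ (M₁ ℕ.+ (M₂ ℕ.+ M₃)))) ℕ.≤ n →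
      E ℚ.≤ ι 3 * (N * seq r n * (seq d n * (seq d n * 1ℚ)) * seq u n + N * seq Δ n) + ε
    go n n≥ = ℚ.≤-trans
      (estimate-at n {μ} {D} (0≤recip k) μ≤1 (recip-antitone (ℕ.m+n≤o⇒m≤o k n≥)) 0≤D Δ<D D≤ D≤′
        (ℚ.≤-trans (≤∣∣ (seq r n)) (proj₂ (proj₂ (proj₂ bounded-r)) n (ℕ.m+n≤o⇒m≤o M₁ n≥₃)))
        (ℚ.≤-trans (≤∣∣ (seq d n)) (proj₂ (proj₂ (proj₂ bounded-d)) n (ℕ.m+n≤o⇒m≤o M₂ (ℕ.m+n≤o⇒n≤o M₁ n≥₃))))
        (ℚ.≤-trans (≤∣∣ (seq u n)) (proj₂ (proj₂ (proj₂ bounded-u)) n (ℕ.m+n≤o⇒n≤o M₂ (ℕ.m+n≤o⇒n≤o M₁ n≥₃)))))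
      (ℚ.+-monoʳ-≤ (ι 3 * (N * seq r n * (seq d n * (seq d n * 1ℚ)) * seq u n + N * seq Δ n)) (proj₂ small k ℕ.≤-refl))
      where
      n≥₁ = ℕ.m+n≤o⇒n≤o k n≥
      n≥₂ = ℕ.m+n≤o⇒n≤o N₁ n≥₁
      n≥₃ = ℕ.m+n≤o⇒n≤o N₂ n≥₂
      δ : ℚ
      δ = seq Δ n
      D≤₃ : D ℚ.≤ δ ℚ.⊔ 0ℚ + (η + (η + η))
      D≤₃ = ℚ.≤-trans (ℚ.+-monoˡ-≤ (η + η) (max0-close {δ₀} {δ} {η} 0≤η
          (≤-from-diff {δ₀} {δ} (proj₂ settled N₁ n ℕ.≤-refl (ℕ.m+n≤o⇒m≤o N₁ n≥₁)))))
        (ℚ.≤-reflexive (ℚ.+-assoc (δ ℚ.⊔ 0ℚ) η (η + η)))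
      D≤ : D ℚ.≤ δ ℚ.⊔ 0ℚ + μ ^ℚ 3
      D≤ = ℚ.≤-trans D≤₃ (ℚ.+-monoʳ-≤ (δ ℚ.⊔ 0ℚ) (subst (η + (η + η) ℚ.≤_) 4η
        (0≤⇒≤ {η + (η + η)} {η + η + (η + η)} η 0≤η (solve 1 (λ η → η :+ η :+ (η :+ η) := η :+ (η :+ η) :+ η) refl η))))
      D≤′ : D ℚ.≤ δ + μ
      D≤′ = ℚ.≤-trans D≤₃ (ℚ.≤-trans
        (ℚ.+-monoˡ-≤ (η + (η + η)) (ℚ.⊔-lub (≤-add {δ} 0≤η) (proj₂ eventually-nonNeg n (ℕ.m+n≤o⇒m≤o N₂ n≥₂))))
        (ℚ.≤-trans (ℚ.≤-reflexive (solve 2 (λ δ η → δ :+ η :+ (η :+ (η :+ η)) := δ :+ (η :+ η :+ (η :+ η))) refl δ η))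
          (ℚ.+-monoʳ-≤ δ (subst (ℚ._≤ μ) (sym 4η) μ³≤μ))))

module Discrepancy
  (e : ℚ → ℂ)
  (cos-sub : ∀ q r → realPart (e (q - r)) ≈ realPart (e q) ⊗ realPart (e r) ⊕ imagPart (e q) ⊗ imagPart (e r))
  (sin-sub : ∀ q r → imagPart (e (q - r)) ≈ imagPart (e q) ⊗ realPart (e r) ⊖ realPart (e q) ⊗ imagPart (e r))
  (cos-0 : realPart (e 0ℚ) ≈ 1ᴱ) (sin-0 : imagPart (e 0ℚ) ≈ 0ᴱ)
  (sin-eighth : imagPart (e eighth) ≈ realPart (e eighth)) where

  open UnitCircle (λ q → realPart (e q)) (λ q → imagPart (e q)) cos-sub sin-sub cos-0 sin-0 sin-eighth using (module Characters)

  discrepancy-roots : (p : ℕ) .{{_ : NonZero p}} → Prime p → (X : Subset p) (Δ : ℝ) → 0ℝ ≤ℝ Δ →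
    ((a : ℤ) → Coprime a (+ p) → ∣ ∑ (elements X) (λ x → e (a ℤ.* + toℕ x / p)) ∣ℂ ≤ℝ fromℕ ∣ X ∣ *ℝ Δ) →
    (S : ℤ) (T : ℕ) → T ℕ.≤ p → (r d u : ℝ) → CubeRoot (fromℕ T) r → CubeRoot Δ d → CubeRoot (fromℚ (+ 1 / p)) u →
    ∣ fromℕ (J₃ p X S T) -ℝ fromℚ (+ (∣ X ∣ ℕ.* T) / p) ∣ℝ
      ≤ℝ fromℕ 3 *ℝ (fromℕ ∣ X ∣ *ℝ r *ℝ d ^ℝ 2 *ℝ u +ℝ fromℕ ∣ X ∣ *ℝ Δ)
  discrepancy-roots p hp X Δ 0≤Δ hyp S T T≤p r d u hr hd hu = cube-root-bound
    where
    open Characters p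
    open Deviation e p hp X Δ c-sub s-sub c-add s-add c-period s-period hyp
      using (xs; rational-bound; length-xs; SlightlyAbove)
    open Windows p xs using (deviation; P; 0<P)
    N E : ℚ
    N = ι ∣ X ∣
    E = ∣ ι (J₃ p X S T) - + (∣ X ∣ ℕ.* T) / p ∣ℚ
    scaled-error : P * E ≡ ∣ deviation S T ∣ℚ
    scaled-error = trans (trans (cong (_* E) (sym (ℚ.0≤p⇒∣p∣≡p (ℚ.<⇒≤ 0<P)))) (sym (ℚ.∣p*q∣≡∣p∣*∣q∣ P (ι (J₃ p X S T) - + (∣ X ∣ ℕ.* T) / p))))
      (cong ∣_∣ℚ (trans (solve 3 (λ P a b → P :* (a :- b) := P :* a :- P :* b) refl P (ι (J₃ p X S T)) (+ (∣ X ∣ ℕ.* T) / p))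
        (cong₂ _-_ (cong (P *_) (J₃≡hits p X S T))
          (trans (multiply p (∣ X ∣ ℕ.* T)) (trans (ι-* ∣ X ∣ T) (cong (λ m → ι m * ι T) (sym length-xs)))))))
      where
      open +-*-Solver using (solve; _:*_; _:-_; _:=_)
      multiply : ∀ d .{{_ : NonZero d}} j → ι d * (+ j / d) ≡ ι j
      multiply (suc d) j = trans (cong (ι (suc d) *_) (/-ι j d))
        (trans (solve 3 (λ d j r → d :* (j :* r) := j :* (d :* r)) refl (ι (suc d)) (ι j) (recip d))
          (trans (cong (ι j *_) (ι*recip d)) (ℚ.*-identityʳ (ι j))))
    rational : ∀ {D x} → SlightlyAbove D → 0ℚ ℚ.≤ D → 0ℚ ℚ.≤ x → D * D * ι T ℚ.≤ P * (x * (x * x)) → E ℚ.≤ N * (x + x + x + D)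
    rational {D} {x} Δ<D 0≤D 0≤x large = *-cancel-≤ {P} 0<P (subst₂ ℚ._≤_ (sym scaled-error)
      (trans (cong (λ m → P * ι m * (x + x + x + D)) length-xs) (ℚ.*-assoc P N (x + x + x + D)))
      (rational-bound {D} {x} Δ<D 0≤D 0≤x S T T≤p large))
    open CubeRootBound p T N E (0≤ι ∣ X ∣) Δ r d u 0≤Δ hr hd hu rational using (cube-root-bound)

  discrepancy : (p : ℕ) .{{_ : NonZero p}} → Prime p → (X : Subset p) (Δ : ℝ) → 0ℝ ≤ℝ Δ →
    ((a : ℤ) → Coprime a (+ p) → ∣ ∑ (elements X) (λ x → e (a ℤ.* + toℕ x / p)) ∣ℂ ≤ℝ fromℕ ∣ X ∣ *ℝ Δ) →
    (S : ℤ) (T : ℕ) → 1 ℕ.≤ T → T ℕ.≤ p →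
    ∣ fromℕ (J₃ p X S T) -ℝ fromℚ (+ (∣ X ∣ ℕ.* T) / p) ∣ℝ
      ≤ℝ fromℕ 3 *ℝ (fromℕ ∣ X ∣ *ℝ cbrt (fromℕ T) *ℝ cbrt Δ ^ℝ 2 *ℝ cbrt (fromℚ (+ 1 / p))
                      +ℝ fromℕ ∣ X ∣ *ℝ Δ)
  discrepancy p {{nz}} hp X Δ 0≤Δ hyp S T _ T≤p = discrepancy-roots p {{nz}} hp X Δ 0≤Δ hyp S T T≤p
    _ _ _ (cubeRoot _) (cubeRoot _) (cubeRoot _)

theorem4 : Σ ℝ λ C → 0ℝ <ℝ C ×
    ((p : ℕ) .{{_ : NonZero p}} → Prime p →
    (X : Subset p) (Δ : ℝ) → 0ℝ ≤ℝ Δ →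
    ((a : ℤ) → Coprime a (+ p) →
    ∣ ∑ (elements X) (λ x → exp (0ℝ +i (fromℕ 2 *ℝ π *ℝ fromℚ (a ℤ.* + toℕ x / p)))) ∣ℂ
    ≤ℝ fromℕ ∣ X ∣ *ℝ Δ) →
    (S : ℤ) (T : ℕ) → 1 ℕ.≤ T → T ℕ.≤ p →
    ∣ fromℕ (J₃ p X S T) -ℝ fromℚ (+ (∣ X ∣ ℕ.* T) / p) ∣ℝ
    ≤ℝ C *ℝ (fromℕ ∣ X ∣ *ℝ cbrt (fromℕ T) *ℝ cbrt Δ ^ℝ 2 *ℝ cbrt (fromℚ (+ 1 / p))
    +ℝ fromℕ ∣ X ∣ *ℝ Δ))
theorem4 = fromℕ 3 , 0<3 ,
  Discrepancy.discrepancy (λ q → exp (0ℝ +i (fromℕ 2 *ℝ π *ℝ fromℚ q))) cos-sub sin-sub cos-0 sin-0 sin-eighth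
  where
  open CircleFunctions
  0<3 : 0ℝ <ℝ fromℕ 3
  0<3 = 1ℚ , 0<1 , 0 , λ _ _ → ι-mono {1} {3} (ℕ.s≤s ℕ.z≤n)
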